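{- For all integers $n\geq 0$ and $m\geq 0$, $$B_{9,5}\left(5^{4m}n+\frac{5^{4m}-1}{2}\right)\equiv 2^m B_{9,5}(n)\pmod 3,$$ and, for each $k\in\{4,5\}$, $$B_{9,5}\left(5^{4m+4}n+\frac{(2k+1)\cdot 5^{4m+3}-1}{2}\right)\equiv 0\pmod 3.$$
   Context: For integers $l,m>1$, an $l$-regular partition is a partition none of whose parts is divisible by $l$. A $(l,m)$-regular bipartition of $n$ is a pair of partitions $(\lambda,\mu)$ such that the sum of all parts of $\lambda$ and $\mu$ is $n$, $\lambda$ is $l$-regular and $\mu$ is $m$-regular. $B_{l,m}(n)$ denotes the number of $(l,m)$-regular bipartitions of $n$; equivalently $\sum_{n\ge 0}B_{l,m}(n)q^n=\frac{f_lf_m}{f_1^2}$, where $f_k=\prod_{j\ge1}(1-q^{jk})$. -}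

module Defs where

open import Data.List using (List; []; _∷_; length; filter; upTo; cartesianProduct; cartesianProductWith)
open import Data.List.Membership.Propositional using (_∈_)
open import Data.List.Membership.Propositional.Properties using (∈-upTo⁺; ∈-filter⁺; ∈-filter⁻; ∈-cartesianProduct⁺; ∈-cartesianProductWith⁺; ∈-cartesianProductWith⁻)
open import Data.List.Properties using (∷-injective)
open import Data.List.Relation.Unary.All as All using (All; []; _∷_)
open import Data.List.Relation.Unary.Any using (here; there)
open import Data.List.Relation.Unary.AllPairs using ([]; _∷_)
open import Data.List.Relation.Unary.Linked using (Linked; linked?)
open import Data.List.Relation.Unary.Unique.Propositional using (Unique)
open import Data.List.Relation.Unary.Unique.Propositional.Properties using (upTo⁺; filter⁺; cartesianProduct⁺)
import Data.List.Relation.Unary.Unique.Setoid.Properties as UniqueSetoid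
open import Data.Nat using (ℕ; zero; suc; _+_; _≤_; _<_; _≥_; z≤n; s≤s)
open import Data.Nat.Divisibility using (_∣_; _∣?_)
open import Data.Nat.ListAction using (sum)
open import Data.Nat.Properties using (_≟_; _<?_; _≥?_; ≤-trans; ≤-reflexive; m≤m+n; m≤n+m; +-mono-≤)
open import Data.Product using (_×_; _,_; proj₁; proj₂)
open import Function.Bundles using (_⇔_; mk⇔)
open import Relation.Binary.PropositionalEquality using (_≡_; refl; setoid)
open import Relation.Nullary using (¬_; Dec)
open import Relation.Nullary.Decidable using (_×-dec_; ¬?)

-- A partition is the weakly decreasing list of its (positive) parts.
IsPartition : List ℕ → Set
IsPartition α = All (0 <_) α × Linked _≥_ α

IsRegular : ℕ → List ℕ → Set
IsRegular l α = All (λ p → ¬ (l ∣ p)) α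

IsRegularBipartition : (l m n : ℕ) → List ℕ × List ℕ → Set
IsRegularBipartition l m n (α , β) =
  IsPartition α × IsPartition β × (sum α + sum β ≡ n) × IsRegular l α × IsRegular m β

isPartition? : ∀ α → Dec (IsPartition α)
isPartition? α = All.all? (0 <?_) α ×-dec linked? _≥?_ α

isRegular? : ∀ l α → Dec (IsRegular l α)
isRegular? l = All.all? (λ p → ¬? (l ∣? p))

isRegularBipartition? : ∀ l m n αβ → Dec (IsRegularBipartition l m n αβ)
isRegularBipartition? l m n (α , β) =
  isPartition? α ×-dec isPartition? β ×-dec (sum α + sum β ≟ n)
    ×-dec isRegular? l α ×-dec isRegular? m β

-- All lists of length at most k with entries at most n.  With k = n this is a
-- finite search space containing every partition of every number up to n.
boundedLists : (k n : ℕ) → List (List ℕ)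
boundedLists zero    n = [] ∷ []
boundedLists (suc k) n = [] ∷ cartesianProductWith _∷_ (upTo (suc n)) (boundedLists k n)

regularBipartitions : (l m n : ℕ) → List (List ℕ × List ℕ)
regularBipartitions l m n =
  filter (isRegularBipartition? l m n)
         (cartesianProduct (boundedLists n n) (boundedLists n n))

-- This length is the number of (l,m)-regular bipartitions of n: by
-- ∈-regularBipartitions and regularBipartitions-unique below, the list contains
-- each of them exactly once and nothing else.
B : (l m n : ℕ) → ℕ
B l m n = length (regularBipartitions l m n)

∈-boundedLists : ∀ {k n} α → length α ≤ k → All (_≤ n) α → α ∈ boundedLists k n
∈-boundedLists {zero}  []      _         _          = here refl
∈-boundedLists {suc k} []      _         _          = here refl
∈-boundedLists {suc k} (p ∷ α) (s≤s len) (p≤n ∷ le) =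
  there (∈-cartesianProductWith⁺ _∷_ (∈-upTo⁺ (s≤s p≤n)) (∈-boundedLists α len le))

boundedLists-unique : ∀ k n → Unique (boundedLists k n)
boundedLists-unique zero    n = [] ∷ []
boundedLists-unique (suc k) n = All.tabulate nonempty ∷ tails
  where
  nonempty : ∀ {α} → α ∈ cartesianProductWith _∷_ (upTo (suc n)) (boundedLists k n) → ¬ ([] ≡ α)
  nonempty α∈ refl with ∈-cartesianProductWith⁻ _∷_ (upTo (suc n)) (boundedLists k n) α∈
  ... | _ , _ , _ , _ , ()

  tails : Unique (cartesianProductWith _∷_ (upTo (suc n)) (boundedLists k n))
  tails = UniqueSetoid.cartesianProductWith⁺ (setoid ℕ) (setoid (List ℕ)) (setoid (List ℕ))
            _∷_ ∷-injective (upTo⁺ (suc n)) (boundedLists-unique k n)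

parts≤sum : ∀ α → All (_≤ sum α) α
parts≤sum []      = []
parts≤sum (p ∷ α) = m≤m+n p (sum α) ∷ All.map (λ q≤ → ≤-trans q≤ (m≤n+m (sum α) p)) (parts≤sum α)

length≤sum : ∀ {α} → All (0 <_) α → length α ≤ sum α
length≤sum []        = z≤n
length≤sum (0<p ∷ +) = +-mono-≤ 0<p (length≤sum +)

partition∈boundedLists : ∀ {n α} → IsPartition α → sum α ≤ n → α ∈ boundedLists n n
partition∈boundedLists {α = α} (pos , _) sum≤n =
  ∈-boundedLists α (≤-trans (length≤sum pos) sum≤n)
                   (All.map (λ p≤ → ≤-trans p≤ sum≤n) (parts≤sum α))

∈-regularBipartitions : ∀ l m n αβ →
  αβ ∈ regularBipartitions l m n ⇔ IsRegularBipartition l m n αβ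
∈-regularBipartitions l m n (α , β) = mk⇔
  (λ ∈B → proj₂ (∈-filter⁻ (isRegularBipartition? l m n) {xs = cartesianProduct (boundedLists n n) (boundedLists n n)} ∈B))
  complete
  where
  complete : IsRegularBipartition l m n (α , β) → (α , β) ∈ regularBipartitions l m n
  complete reg@(Pα , Pβ , sum≡n , _) =
    ∈-filter⁺ (isRegularBipartition? l m n)
      (∈-cartesianProduct⁺
        (partition∈boundedLists Pα (≤-trans (m≤m+n (sum α) (sum β)) (≤-reflexive sum≡n)))
        (partition∈boundedLists Pβ (≤-trans (m≤n+m (sum β) (sum α)) (≤-reflexive sum≡n))))
      reg

regularBipartitions-unique : ∀ l m n → Unique (regularBipartitions l m n)
regularBipartitions-unique l m n =
  filter⁺ (isRegularBipartition? l m n)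
    (cartesianProduct⁺ (boundedLists-unique n n) (boundedLists-unique n n))

{-# OPTIONS --safe #-}
module Submission where

-- Write f(q) = ∏ (1 - q^j) and f₅ = f(q⁵).  Modulo 3 the generating function f(q⁹) f₅ / f² of B 9 5 is
-- F = f⁷ f₅.  Let U select the coefficients of q^(5n+2); iterating it produces the indices of the theorem.
-- The 5-dissection f = a(q⁵) + q b(q⁵) + q² c(q⁵), with b = - f₅ by the pentagonal number theorem, satisfies
-- a c = - b² (a sign-reversing reflection of the Gaussian lattice points of norm divisible by 5) and
-- (a⁵ + 11 q b⁵ + q² c⁵) f₅ = f⁶ (take the norm ∏ f(ζ^i q) over the fifth roots of unity ζ).  Expanding f⁷
-- with these relations gives U F = - F - G and U G = - F modulo 3, where G = q f f₅⁷.  Hence U³ F = G and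
-- U⁴ F = 2 F, and G has no terms q^(5n) or q^(5n+4) because f has no terms q^(5n+3) or q^(5n+4).  All
-- series have coefficients in 𝔽₈₁ = 𝔽₃(ζ).

open import Defs
open import Algebra.Bundles using (CommutativeRing; RawRing)
open import Data.Empty using (⊥; ⊥-elim)
open import Data.Integer as ℤ using (+_; -[1+_]; ℤ)
open import Data.Integer.DivMod using (_%ℕ_; _/ℕ_; a≡a%ℕn+[a/ℕn]*n; n%ℕd<d)
import Data.Integer.Divisibility.Signed as ℤ∣
import Data.Integer.Properties as ℤₚ
import Data.Integer.Tactic.RingSolver as ℤSolver
open import Data.List using (List; []; _++_; _∷_; cartesianProduct; filter; length; map)
open import Data.List.Membership.Propositional using (_∈_)
open import Data.List.Membership.Propositional.Properties using (∈-++⁺ʳ; ∈-++⁺ˡ; ∈-++⁻; ∈-cartesianProduct⁺; ∈-cartesianProduct⁻; ∈-filter⁺; ∈-filter⁻; ∈-map⁺; ∈-map⁻)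
open import Data.List.Membership.Propositional.Properties.WithK using (unique∧set⇒bag)
open import Data.List.Relation.Binary.BagAndSetEquality using (∼bag⇒↭)
open import Data.List.Relation.Binary.Permutation.Propositional as Perm using (_↭_; ↭-sym)
open import Data.List.Relation.Unary.All as All using (All; []; _∷_)
open import Data.List.Relation.Unary.AllPairs using (AllPairs; []; _∷_)
open import Data.List.Relation.Unary.Any using (here; there)
open import Data.List.Relation.Unary.Linked as Linked using (Linked; [-]; []; _∷_)
open import Data.List.Relation.Unary.Linked.Properties using (Linked⇒AllPairs)
open import Data.List.Relation.Unary.Unique.Propositional using (Unique)
open import Data.List.Relation.Unary.Unique.Propositional.Properties using (++⁺; cartesianProduct⁺; filter⁺; map⁺)
open import Data.Maybe using (Maybe; just; nothing)
open import Data.Nat as ℕ using (_<_; _≤?_; _≤_; _≥_; suc; s≤s; zero; z≤n; ℕ)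
open import Data.Nat.DivMod using (%-distribˡ-*; %-distribˡ-+; m*n%n≡0; m*n/n≡m)
open import Data.Nat.Divisibility using (_∣0; _∣?_; _∣_; divides; n∣m*n; ∣-refl; ∣m+n∣m⇒∣n; ∣m∣n⇒∣m+n; ∣⇒≤)
open import Data.Nat.ListAction using (sum)
open import Data.Nat.Primality using (euclidsLemma; prime?)
import Data.Nat.Properties as ℕₚ
import Data.Nat.Tactic.RingSolver as ℕSolver
open import Data.Product using (_,_; _×_; proj₁; proj₂; swap; ∃; ∃₂)
open import Data.Sum as Sum using (_⊎_; inj₁; inj₂)
open import Function using (_∘_; mk⇔)
open import Function.Bundles using (Equivalence)
open import Level using (0ℓ)
open import Relation.Binary.PropositionalEquality as ≡ using (_≡_; _≢_)
open import Relation.Nullary using (Dec; contradiction; no; yes; ¬_)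
open import Relation.Nullary.Decidable using (_×-dec_; from-no; from-yes)
open import Relation.Unary using (Decidable)

-- On the span of `F` and `G` the operator `U` has characteristic polynomial x² + x - 1, irreducible
-- modulo 3. Its roots in 𝔽₉ have order 8, so U⁴ acts as -1 = 2: this is the origin of both the
-- period 4 in the exponent of 5 and the factor 2^m. The norm needs a primitive fifth root of unity
-- in characteristic 3. Since 3 has order 4 modulo 5, the smallest field containing one has 81
-- elements. The extension loses nothing, because multiples of 1 in it agree only if the multipliers
-- agree modulo 3. The numerator f(q⁹) becomes f⁹ by applying Frobenius twice, whence the exponent 7
-- in `F`. Two constraints shape the formal side. Quotients of products are never formed: each
-- identity is multiplied out, and a factor with constant term 1 is cancelled where necessary.
-- Infinite products are reached only through finite ones that agree with them up to a growing
-- degree.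

CharacteristicThree : ∀ {c ℓ} → CommutativeRing c ℓ → Set ℓ
CharacteristicThree R = 1# + 1# + 1# ≈ 0#
  where open CommutativeRing R

-- A ring solver with coefficients reduced modulo 3.

module CharacteristicThreeSolver {c ℓ} (R : CommutativeRing c ℓ) (3≈0 : CharacteristicThree R) where

  open CommutativeRing R
  open import Algebra.Solver.Ring.AlmostCommutativeRing
    using (fromCommutativeRing; _-Raw-AlmostCommutative⟶_)
  open import Algebra.Properties.Ring ring using (-‿distribˡ-*; -‿involutive; -0#≈0#; -‿+-comm)
  open import Relation.Binary.Reasoning.Setoid setoid

  -- Normalizing with these coefficients lets the solver accept polynomial identities that hold only
  -- modulo 3, such as (1 - x)⁹ = 1 - x⁹.
  data F₃ : Set where
    𝟎 𝟏 𝟐 : F₃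

  infixl 6 _⊕_
  infixl 7 _⊗_

  _⊕_ : F₃ → F₃ → F₃
  𝟎 ⊕ y = y
  x ⊕ 𝟎 = x
  𝟏 ⊕ 𝟏 = 𝟐
  𝟏 ⊕ 𝟐 = 𝟎
  𝟐 ⊕ 𝟏 = 𝟎
  𝟐 ⊕ 𝟐 = 𝟏

  ⊝_ : F₃ → F₃
  ⊝ 𝟎 = 𝟎
  ⊝ 𝟏 = 𝟐
  ⊝ 𝟐 = 𝟏

  _⊗_ : F₃ → F₃ → F₃
  𝟎 ⊗ y = 𝟎
  𝟏 ⊗ y = y
  𝟐 ⊗ y = ⊝ y

  F₃-rawRing : RawRing _ _
  F₃-rawRing = record
    { Carrier = F₃ ; _≈_ = _≡_ ; _+_ = _⊕_ ; _*_ = _⊗_ ; -_ = ⊝_ ; 0# = 𝟎 ; 1# = 𝟏 }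

  fromF₃ : F₃ → Carrier
  fromF₃ 𝟎 = 0#
  fromF₃ 𝟏 = 1#
  fromF₃ 𝟐 = - 1#

  2≈-1 : 1# + 1# ≈ - 1#
  2≈-1 = begin
    1# + 1#               ≈⟨ +-identityʳ _ ⟨
    1# + 1# + 0#          ≈⟨ +-congˡ (-‿inverseʳ 1#) ⟨
    1# + 1# + (1# + - 1#) ≈⟨ +-assoc _ _ _ ⟨
    1# + 1# + 1# + - 1#   ≈⟨ +-congʳ 3≈0 ⟩
    0# + - 1#             ≈⟨ +-identityˡ _ ⟩
    - 1#                  ∎

  -2≈1 : - 1# + - 1# ≈ 1#
  -2≈1 = begin
    - 1# + - 1# ≈⟨ -‿+-comm 1# 1# ⟩
    - (1# + 1#) ≈⟨ -‿cong 2≈-1 ⟩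
    - - 1#      ≈⟨ -‿involutive 1# ⟩
    1#          ∎

  +-homo : ∀ x y → fromF₃ (x ⊕ y) ≈ fromF₃ x + fromF₃ y
  +-homo 𝟎 y = sym (+-identityˡ _)
  +-homo 𝟏 𝟎 = sym (+-identityʳ _)
  +-homo 𝟏 𝟏 = sym 2≈-1
  +-homo 𝟏 𝟐 = sym (-‿inverseʳ 1#)
  +-homo 𝟐 𝟎 = sym (+-identityʳ _)
  +-homo 𝟐 𝟏 = sym (-‿inverseˡ 1#)
  +-homo 𝟐 𝟐 = sym -2≈1

  -‿homo : ∀ x → fromF₃ (⊝ x) ≈ - fromF₃ x
  -‿homo 𝟎 = sym -0#≈0#
  -‿homo 𝟏 = refl
  -‿homo 𝟐 = sym (-‿involutive 1#)

  *-homo : ∀ x y → fromF₃ (x ⊗ y) ≈ fromF₃ x * fromF₃ y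
  *-homo 𝟎 y = sym (zeroˡ _)
  *-homo 𝟏 y = sym (*-identityˡ _)
  *-homo 𝟐 y = begin
    fromF₃ (⊝ y)       ≈⟨ -‿homo y ⟩
    - fromF₃ y         ≈⟨ -‿cong (*-identityˡ _) ⟨
    - (1# * fromF₃ y)  ≈⟨ -‿distribˡ-* 1# _ ⟩
    - 1# * fromF₃ y    ∎

  fromF₃-homomorphism : F₃-rawRing -Raw-AlmostCommutative⟶ fromCommutativeRing R
  fromF₃-homomorphism = record
    { ⟦_⟧ = fromF₃ ; +-homo = +-homo ; *-homo = *-homo ; -‿homo = -‿homo
    ; 0-homo = refl ; 1-homo = refl }

  fromF₃-≟ : ∀ x y → Maybe (fromF₃ x ≈ fromF₃ y)
  fromF₃-≟ 𝟎 𝟎 = just refl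
  fromF₃-≟ 𝟏 𝟏 = just refl
  fromF₃-≟ 𝟐 𝟐 = just refl
  fromF₃-≟ _ _ = nothing

  open import Algebra.Solver.Ring F₃-rawRing (fromCommutativeRing R)
    fromF₃-homomorphism fromF₃-≟ public
    using (Polynomial; solve; _:=_; _:+_; _:*_; _:-_; :-_; _:^_; con)

-- Formal power series over a commutative ring.

module PowerSeries {c ℓ} (R : CommutativeRing c ℓ) where

  private module R = CommutativeRing R
  open import Relation.Binary.Reasoning.Setoid R.setoid
  open import Algebra.Properties.CommutativeSemigroup R.+-commutativeSemigroup
    using (interchange)

  Series : Set c
  Series = ℕ → R.Carrier

  infix 4 _≈_
  infixl 6 _+_
  infixl 7 _*_
  infix 8 -_

  -- A record, so that the two sides can be inferred from a proof.
  record _≈_ (f g : Series) : Set ℓ where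
    constructor coefficientwise
    field at : ∀ n → f n R.≈ g n
  open _≈_ public

  _+_ : Series → Series → Series
  (f + g) n = f n R.+ g n

  -_ : Series → Series
  (- f) n = R.- f n

  tail : Series → Series
  tail f n = f (suc n)

  _*_ : Series → Series → Series
  (f * g) zero    = f 0 R.* g 0
  (f * g) (suc n) = f 0 R.* g (suc n) R.+ (tail f * g) n

  0# : Series
  0# n = R.0#

  C : R.Carrier → Series
  C a zero    = a
  C a (suc n) = R.0#

  1# : Series
  1# = C R.1#

  X : Series
  X zero    = R.0#
  X (suc n) = 1# n

  -- Coefficient n of a Cauchy product sees only the coefficients up to n of its factors; this is
  -- what lets products pass to the limit in `⟶-*`.
  *-cong-≤ : ∀ {f f′ g g′} n → (∀ i → i ≤ n → f i R.≈ f′ i) → (∀ i → i ≤ n → g i R.≈ g′ i) →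
             (f * g) n R.≈ (f′ * g′) n
  *-cong-≤ zero    f≈ g≈ = R.*-cong (f≈ 0 z≤n) (g≈ 0 z≤n)
  *-cong-≤ (suc n) f≈ g≈ = R.+-cong (R.*-cong (f≈ 0 z≤n) (g≈ (suc n) ℕₚ.≤-refl))
    (*-cong-≤ n (λ i i≤n → f≈ (suc i) (s≤s i≤n)) (λ i i≤n → g≈ i (ℕₚ.m≤n⇒m≤1+n i≤n)))

  *-cong : ∀ {f f′ g g′} → f ≈ f′ → g ≈ g′ → f * g ≈ f′ * g′
  *-cong f≈ g≈ .at n = *-cong-≤ n (λ i _ → f≈ .at i) (λ i _ → g≈ .at i)

  *-distribʳ-+ : ∀ h f g → (f + g) * h ≈ f * h + g * h
  *-distribʳ-+ h f g .at zero    = R.distribʳ _ _ _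
  *-distribʳ-+ h f g .at (suc n) = R.trans
    (R.+-cong (R.distribʳ _ _ _) (*-distribʳ-+ h (tail f) (tail g) .at n))
    (interchange _ _ _ _)

  -- The recursion defining `_*_` peels off the term containing `f 0`. This is the mirror image,
  -- peeling off the term containing `g 0`, and it makes commutativity a single induction.
  *-tailʳ : ∀ f g n → (f * g) (suc n) R.≈ (f * tail g) n R.+ f (suc n) R.* g 0
  *-tailʳ f g zero    = R.refl
  *-tailʳ f g (suc n) = R.trans (R.+-congˡ (*-tailʳ (tail f) g n)) (R.sym (R.+-assoc _ _ _))

  *-comm : ∀ f g → f * g ≈ g * f
  *-comm f g .at zero    = R.*-comm _ _
  *-comm f g .at (suc n) = begin
    f 0 R.* g (suc n) R.+ (tail f * g) n  ≈⟨ R.+-cong (R.*-comm _ _) (*-comm (tail f) g .at n) ⟩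
    g (suc n) R.* f 0 R.+ (g * tail f) n  ≈⟨ R.+-comm _ _ ⟩
    (g * tail f) n R.+ g (suc n) R.* f 0  ≈⟨ *-tailʳ g f n ⟨
    (g * f) (suc n)                       ∎

  scale : R.Carrier → Series → Series
  scale a f n = a R.* f n

  scale-* : ∀ a f g n → (scale a f * g) n R.≈ a R.* (f * g) n
  scale-* a f g zero    = R.*-assoc _ _ _
  scale-* a f g (suc n) =
    R.trans (R.+-cong (R.*-assoc _ _ _) (scale-* a (tail f) g n)) (R.sym (R.distribˡ _ _ _))

  *-assoc : ∀ f g h → (f * g) * h ≈ f * (g * h)
  *-assoc f g h .at zero    = R.*-assoc _ _ _
  *-assoc f g h .at (suc n) = begin
    f 0 R.* g 0 R.* h (suc n) R.+ ((scale (f 0) (tail g) + tail f * g) * h) n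
      ≈⟨ R.+-cong (R.*-assoc _ _ _) (*-distribʳ-+ h (scale (f 0) (tail g)) (tail f * g) .at n) ⟩
    f 0 R.* (g 0 R.* h (suc n)) R.+ ((scale (f 0) (tail g) * h) n R.+ ((tail f * g) * h) n)
      ≈⟨ R.+-assoc _ _ _ ⟨
    f 0 R.* (g 0 R.* h (suc n)) R.+ (scale (f 0) (tail g) * h) n R.+ ((tail f * g) * h) n
      ≈⟨ R.+-cong (R.+-congˡ (scale-* _ _ _ n)) (*-assoc (tail f) g h .at n) ⟩
    f 0 R.* (g 0 R.* h (suc n)) R.+ f 0 R.* (tail g * h) n R.+ (tail f * (g * h)) n
      ≈⟨ R.+-congʳ (R.distribˡ _ _ _) ⟨
    f 0 R.* (g 0 R.* h (suc n) R.+ (tail g * h) n) R.+ (tail f * (g * h)) n ∎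

  0*f≈0 : ∀ f n → (0# * f) n R.≈ R.0#
  0*f≈0 f zero    = R.zeroˡ _
  0*f≈0 f (suc n) = R.trans (R.+-cong (R.zeroˡ _) (0*f≈0 f n)) (R.+-identityˡ _)

  C-* : ∀ a f n → (C a * f) n R.≈ a R.* f n
  C-* a f zero    = R.refl
  C-* a f (suc n) = R.trans (R.+-congˡ (0*f≈0 f n)) (R.+-identityʳ _)

  *-identityˡ : ∀ f → 1# * f ≈ f
  *-identityˡ f .at n = R.trans (C-* R.1# f n) (R.*-identityˡ _)

  X*-zero : ∀ f → (X * f) 0 R.≈ R.0#
  X*-zero f = R.zeroˡ _

  X*-suc : ∀ f n → (X * f) (suc n) R.≈ f n
  X*-suc f n = R.trans (R.+-cong (R.zeroˡ _) (*-identityˡ f .at n)) (R.+-identityˡ _)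

  commutativeRing : CommutativeRing c ℓ
  commutativeRing = record
    { Carrier = Series ; _≈_ = _≈_ ; _+_ = _+_ ; _*_ = _*_ ; -_ = -_ ; 0# = 0# ; 1# = 1#
    ; isCommutativeRing = record
      { isRing = record
        { +-isAbelianGroup = record
          { isGroup = record
            { isMonoid = record
              { isSemigroup = record
                { isMagma = record
                  { isEquivalence = record
                    { refl  = coefficientwise λ n → R.refl
                    ; sym   = λ f≈g → coefficientwise λ n → R.sym (f≈g .at n)
                    ; trans = λ f≈g g≈h → coefficientwise λ n → R.trans (f≈g .at n) (g≈h .at n)
                    }
                  ; ∙-cong = λ f≈ g≈ → coefficientwise λ n → R.+-cong (f≈ .at n) (g≈ .at n)
                  }
                ; assoc = λ f g h → coefficientwise λ n → R.+-assoc _ _ _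
                }
              ; identity = (λ f → coefficientwise λ n → R.+-identityˡ _)
                         , (λ f → coefficientwise λ n → R.+-identityʳ _)
              }
            ; inverse = (λ f → coefficientwise λ n → R.-‿inverseˡ _)
                      , (λ f → coefficientwise λ n → R.-‿inverseʳ _)
            ; ⁻¹-cong = λ f≈g → coefficientwise λ n → R.-‿cong (f≈g .at n)
            }
          ; comm = λ f g → coefficientwise λ n → R.+-comm _ _
          }
        ; *-cong = *-cong
        ; *-assoc = *-assoc
        ; *-identity = *-identityˡ
                     , λ f → coefficientwise λ n → R.trans (*-comm f 1# .at n) (*-identityˡ f .at n)
        ; distrib = (λ f g h → coefficientwise λ n → begin
                      (f * (g + h)) n            ≈⟨ *-comm f (g + h) .at n ⟩
                      ((g + h) * f) n            ≈⟨ *-distribʳ-+ f g h .at n ⟩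
                      (g * f) n R.+ (h * f) n    ≈⟨ R.+-cong (*-comm g f .at n) (*-comm h f .at n) ⟩
                      (f * g) n R.+ (f * h) n    ∎)
                  , *-distribʳ-+
        }
      ; *-comm = *-comm
      }
    }

-- Substitution of powers of q, and sections modulo 5.

module Dilation {c ℓ} (R : CommutativeRing c ℓ) (3≈0 : CharacteristicThree R) where

  module R = CommutativeRing R
  module PS = PowerSeries R
  open PS public using (Series; coefficientwise; at; tail; X; C; C-*; *-cong-≤; X*-zero; X*-suc)
  open CommutativeRing PS.commutativeRing public
  open import Algebra.Properties.Semiring.Exp semiring public using (_^_; ^-congˡ; ^-homo-*; ^-assocʳ)
  open import Algebra.Properties.CommutativeSemiring.Exp commutativeSemiring public using (^-distrib-*)
  import Relation.Binary.Reasoning.Setoid R.setoid as R-Reasoning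
  open import Relation.Binary.Reasoning.Setoid setoid

  Series-3≈0 : CharacteristicThree PS.commutativeRing
  Series-3≈0 .at zero    = 3≈0
  Series-3≈0 .at (suc n) = R.trans (R.+-identityʳ _) (R.+-identityʳ _)

  open CharacteristicThreeSolver PS.commutativeRing Series-3≈0 public
    using (Polynomial; solve; _:=_; _:+_; _:*_; _:-_; :-_; _:^_; con; 𝟎; 𝟏)

  X^*-+ : ∀ k f n → (X ^ k * f) (k ℕ.+ n) R.≈ f n
  X^*-+ zero    f n = *-identityˡ f .at n
  X^*-+ (suc k) f n = R.trans (*-assoc X (X ^ k) f .at (suc k ℕ.+ n))
    (R.trans (X*-suc (X ^ k * f) (k ℕ.+ n)) (X^*-+ k f n))

  X^*-< : ∀ k f {n} → n < k → (X ^ k * f) n R.≈ R.0#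
  X^*-< (suc k) f {zero}  _         = R.trans (*-assoc X (X ^ k) f .at 0) (X*-zero (X ^ k * f))
  X^*-< (suc k) f {suc n} (s≤s n<k) = R.trans (*-assoc X (X ^ k) f .at (suc n))
    (R.trans (X*-suc (X ^ k * f) n) (X^*-< k f n<k))

  head-tail : ∀ f → f ≈ C (f 0) + X * tail f
  head-tail f .at zero    = R.sym (R.trans (R.+-congˡ (X*-zero (tail f))) (R.+-identityʳ _))
  head-tail f .at (suc n) = R.sym (R.trans (R.+-congˡ (X*-suc (tail f) n)) (R.+-identityˡ _))

  -- spread k j f is q^j f(q^(k+1)); so dilate k substitutes q^(k+1), not q^k.
  spread : ℕ → ℕ → Series → Series
  spread k zero    f zero    = f 0
  spread k zero    f (suc n) = spread k k (tail f) n
  spread k (suc j) f zero    = R.0#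
  spread k (suc j) f (suc n) = spread k j f n

  spread-cong-≤ : ∀ k j {f g} n → (∀ i → i ≤ n → f i R.≈ g i) → ∀ i → i ≤ n →
                  spread k j f i R.≈ spread k j g i
  spread-cong-≤ k zero    n       f≈g zero    _         = f≈g 0 z≤n
  spread-cong-≤ k zero    (suc n) f≈g (suc i) (s≤s i≤n) =
    spread-cong-≤ k k n (λ j j≤n → f≈g (suc j) (s≤s j≤n)) i i≤n
  spread-cong-≤ k (suc j) n       f≈g zero    _         = R.refl
  spread-cong-≤ k (suc j) (suc n) f≈g (suc i) (s≤s i≤n) =
    spread-cong-≤ k j n (λ j j≤n → f≈g j (ℕₚ.m≤n⇒m≤1+n j≤n)) i i≤n

  spread-cong : ∀ k j {f g} → f ≈ g → spread k j f ≈ spread k j g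
  spread-cong k j f≈g .at n = spread-cong-≤ k j n (λ i _ → f≈g .at i) n ℕₚ.≤-refl

  spread-+ : ∀ k j f g → spread k j (f + g) ≈ spread k j f + spread k j g
  spread-+ k zero    f g .at zero    = R.refl
  spread-+ k zero    f g .at (suc n) = spread-+ k k (tail f) (tail g) .at n
  spread-+ k (suc j) f g .at zero    = R.sym (R.+-identityʳ _)
  spread-+ k (suc j) f g .at (suc n) = spread-+ k j f g .at n

  spread-scale : ∀ k j a f n → spread k j (PS.scale a f) n R.≈ a R.* spread k j f n
  spread-scale k zero    a f zero    = R.refl
  spread-scale k zero    a f (suc n) = spread-scale k k a (tail f) n
  spread-scale k (suc j) a f zero    = R.sym (R.zeroʳ a)
  spread-scale k (suc j) a f (suc n) = spread-scale k j a f n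

  spread-* : ∀ k j f g → spread k j (f * g) ≈ spread k j f * spread k 0 g
  spread-* k zero    f g .at zero    = R.refl
  spread-* k zero    f g .at (suc n) = R-Reasoning.begin
    spread k k (PS.scale (f 0) (tail g) + tail f * g) n
      R-Reasoning.≈⟨ spread-+ k k (PS.scale (f 0) (tail g)) (tail f * g) .at n ⟩
    spread k k (PS.scale (f 0) (tail g)) n R.+ spread k k (tail f * g) n
      R-Reasoning.≈⟨ R.+-cong (spread-scale k k (f 0) (tail g) n) (spread-* k k (tail f) g .at n) ⟩
    f 0 R.* spread k k (tail g) n R.+ (spread k k (tail f) * spread k 0 g) n R-Reasoning.∎
  spread-* k (suc j) f g .at zero    = R.sym (R.zeroˡ _)
  spread-* k (suc j) f g .at (suc n) =
    R.trans (spread-* k j f g .at n) (R.sym (R.trans (R.+-congʳ (R.zeroˡ _)) (R.+-identityˡ _)))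

  spread-X^ : ∀ k j f → spread k j f ≈ X ^ j * spread k 0 f
  spread-X^ k zero    f = sym (*-identityˡ _)
  spread-X^ k (suc j) f = begin
    spread k (suc j) f           ≈⟨ step ⟩
    X * spread k j f             ≈⟨ *-congˡ (spread-X^ k j f) ⟩
    X * (X ^ j * spread k 0 f)   ≈⟨ *-assoc _ _ _ ⟨
    X ^ suc j * spread k 0 f     ∎
    where
    step : spread k (suc j) f ≈ X * spread k j f
    step .at zero    = R.sym (X*-zero (spread k j f))
    step .at (suc n) = R.sym (X*-suc (spread k j f) n)

  spread-0 : ∀ k j n → spread k j 0# n R.≈ R.0#
  spread-0 k zero    zero    = R.refl
  spread-0 k zero    (suc n) = spread-0 k k n
  spread-0 k (suc j) zero    = R.refl
  spread-0 k (suc j) (suc n) = spread-0 k j n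

  dilate : ℕ → Series → Series
  dilate k = spread k 0

  dilate-C : ∀ k a → dilate k (C a) ≈ C a
  dilate-C k a .at zero    = R.refl
  dilate-C k a .at (suc n) = spread-0 k k n

  dilate-X : ∀ k → dilate k X ≈ X ^ suc k
  dilate-X k = begin
    dilate k X                     ≈⟨ step ⟩
    X * spread k k 1#              ≈⟨ *-congˡ (spread-X^ k k 1#) ⟩
    X * (X ^ k * dilate k 1#)      ≈⟨ *-congˡ (*-congˡ (dilate-C k R.1#)) ⟩
    X * (X ^ k * 1#)               ≈⟨ *-congˡ (*-identityʳ _) ⟩
    X * X ^ k                      ∎
    where
    step : dilate k X ≈ X * spread k k 1#
    step .at zero    = R.sym (X*-zero (spread k k 1#))
    step .at (suc n) = R.sym (X*-suc (spread k k 1#) n)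

  dilate-^ : ∀ k f n → dilate k (f ^ n) ≈ dilate k f ^ n
  dilate-^ k f zero    = dilate-C k R.1#
  dilate-^ k f (suc n) = trans (spread-* k 0 f (f ^ n)) (*-congˡ (dilate-^ k f n))

  spread-neg : ∀ k j f → spread k j (- f) ≈ - spread k j f
  spread-neg k zero    f .at zero    = R.refl
  spread-neg k zero    f .at (suc n) = spread-neg k k (tail f) .at n
  spread-neg k (suc j) f .at zero    = R.sym -0#≈0#
    where open import Algebra.Properties.Ring R.ring using (-0#≈0#)
  spread-neg k (suc j) f .at (suc n) = spread-neg k j f .at n

  sec : ℕ → Series → Series
  sec r f n = f (r ℕ.+ n ℕ.* 5)

  sec-cong : ∀ r {f g} → f ≈ g → sec r f ≈ sec r g
  sec-cong r f≈g .at n = f≈g .at (r ℕ.+ n ℕ.* 5)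

  dissection : ∀ f → f ≈ spread 4 0 (sec 0 f) + spread 4 1 (sec 1 f) + spread 4 2 (sec 2 f)
                       + spread 4 3 (sec 3 f) + spread 4 4 (sec 4 f)
  dissection f .at n = go f n
    where
    open CharacteristicThreeSolver R 3≈0 using () renaming
      (solve to solveR; _:=_ to _:=R_; _:+_ to _:+R_; con to conR; 𝟎 to 𝟎R)
    go : ∀ f n → f n R.≈ (spread 4 0 (sec 0 f) + spread 4 1 (sec 1 f) + spread 4 2 (sec 2 f)
                       + spread 4 3 (sec 3 f) + spread 4 4 (sec 4 f)) n
    go f 0 = solveR 1 (λ x → x :=R x :+R conR 𝟎R :+R conR 𝟎R :+R conR 𝟎R :+R conR 𝟎R) R.refl (f 0)
    go f 1 = solveR 1 (λ x → x :=R conR 𝟎R :+R x :+R conR 𝟎R :+R conR 𝟎R :+R conR 𝟎R) R.refl (f 1)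
    go f 2 = solveR 1 (λ x → x :=R conR 𝟎R :+R conR 𝟎R :+R x :+R conR 𝟎R :+R conR 𝟎R) R.refl (f 2)
    go f 3 = solveR 1 (λ x → x :=R conR 𝟎R :+R conR 𝟎R :+R conR 𝟎R :+R x :+R conR 𝟎R) R.refl (f 3)
    go f 4 = solveR 1 (λ x → x :=R conR 𝟎R :+R conR 𝟎R :+R conR 𝟎R :+R conR 𝟎R :+R x) R.refl (f 4)
    -- After five steps every `spread` is back at its initial phase, so the goal at n + 5 is by
    -- computation the goal at n for the series shifted by 5.
    go f (suc (suc (suc (suc (suc n))))) = go (λ i → f (5 ℕ.+ i)) n

  dilate-unfold : ∀ k f → dilate k f ≈ C (f 0) + X ^ suc k * dilate k (tail f)
  dilate-unfold k f = begin
    dilate k f                                      ≈⟨ spread-cong k 0 (head-tail f) ⟩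
    dilate k (C (f 0) + X * tail f)                 ≈⟨ spread-+ k 0 _ _ ⟩
    dilate k (C (f 0)) + dilate k (X * tail f)      ≈⟨ +-cong (dilate-C k _) (spread-* k 0 X (tail f)) ⟩
    C (f 0) + dilate k X * dilate k (tail f)        ≈⟨ +-congˡ (*-congʳ (dilate-X k)) ⟩
    C (f 0) + X ^ suc k * dilate k (tail f)         ∎

  dilate-*-unfold : ∀ k f g → dilate k f * g ≈ C (f 0) * g + X ^ suc k * (dilate k (tail f) * g)
  dilate-*-unfold k f g = begin
    dilate k f * g                                       ≈⟨ *-congʳ (dilate-unfold k f) ⟩
    (C (f 0) + X ^ suc k * dilate k (tail f)) * g        ≈⟨ distribʳ _ _ _ ⟩
    C (f 0) * g + X ^ suc k * dilate k (tail f) * g      ≈⟨ +-congˡ (*-assoc _ _ _) ⟩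
    C (f 0) * g + X ^ suc k * (dilate k (tail f) * g)    ∎

  -- All exponents of `dilate 4 f` are multiples of 5, so multiplication by it preserves residue
  -- classes and f leaves the section undilated. The induction strips the constant term of f, which
  -- lowers the index of the section by one.
  sec-dilate-* : ∀ r → r < 5 → ∀ f g → sec r (dilate 4 f * g) ≈ f * sec r g
  sec-dilate-* r r<5 f g .at n = go n f
    where
    go : ∀ n f → (dilate 4 f * g) (r ℕ.+ n ℕ.* 5) R.≈ (f * sec r g) n
    go n f = R.trans (dilate-*-unfold 4 f g .at (r ℕ.+ n ℕ.* 5)) (R.trans (R.+-congʳ (C-* (f 0) g _)) (step n))
      where
      step : ∀ n → f 0 R.* sec r g n R.+ (X ^ 5 * (dilate 4 (tail f) * g)) (r ℕ.+ n ℕ.* 5)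
                   R.≈ (f * sec r g) n
      step zero rewrite ℕₚ.+-identityʳ r = R.trans (R.+-congˡ (X^*-< 5 _ r<5)) (R.+-identityʳ _)
      step (suc n) rewrite ℕₚ.+-comm r (5 ℕ.+ n ℕ.* 5) | ℕₚ.+-comm (n ℕ.* 5) r =
        R.+-congˡ (R.trans (X^*-+ 5 (dilate 4 (tail f) * g) (r ℕ.+ n ℕ.* 5)) (go n (tail f)))

  sec-X-suc : ∀ r f → sec (suc r) (X * f) ≈ sec r f
  sec-X-suc r f .at n = X*-suc f (r ℕ.+ n ℕ.* 5)

  sec-X-zero : ∀ f → sec 0 (X * f) ≈ X * sec 4 f
  sec-X-zero f .at zero    = R.trans (X*-zero f) (R.sym (X*-zero (sec 4 f)))
  sec-X-zero f .at (suc n) = R.trans (X*-suc f (4 ℕ.+ n ℕ.* 5)) (R.sym (X*-suc (sec 4 f) n))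

-- Limits of series and infinite products.

module InfiniteProducts {c ℓ} (R : CommutativeRing c ℓ) (3≈0 : CharacteristicThree R) where

  open Dilation R 3≈0 public
  open import Relation.Binary.Reasoning.Setoid setoid

  infix 4 _⟶_
  -- The modulus of convergence is the index itself: stage k is already correct through degree k.
  -- This condition is stable under products, powers, dilations and norms, and it determines the
  -- limit.
  record _⟶_ (s : ℕ → Series) (f : Series) : Set ℓ where
    constructor agreeing
    field agree : ∀ k n → n ≤ k → s k n R.≈ f n
  open _⟶_ public

  ⟶-* : ∀ {s t f g} → s ⟶ f → t ⟶ g → (λ k → s k * t k) ⟶ f * g
  ⟶-* s⟶f t⟶g .agree k n n≤k = *-cong-≤ n
    (λ i i≤n → s⟶f .agree k i (ℕₚ.≤-trans i≤n n≤k))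
    (λ i i≤n → t⟶g .agree k i (ℕₚ.≤-trans i≤n n≤k))

  ⟶-const : ∀ f → (λ _ → f) ⟶ f
  ⟶-const f .agree k n n≤k = R.refl

  ⟶-^ : ∀ {s f} → s ⟶ f → ∀ m → (λ k → s k ^ m) ⟶ f ^ m
  ⟶-^ s⟶f zero    = ⟶-const 1#
  ⟶-^ s⟶f (suc m) = ⟶-* s⟶f (⟶-^ s⟶f m)

  ⟶-dilate : ∀ {s f} l → s ⟶ f → (λ k → dilate l (s k)) ⟶ dilate l f
  ⟶-dilate l s⟶f .agree k n n≤k = spread-cong-≤ l 0 k (s⟶f .agree k) n n≤k

  ⟶-unique : ∀ {s t f g} → s ⟶ f → t ⟶ g → (∀ k → s k ≈ t k) → f ≈ g
  ⟶-unique s⟶f t⟶g s≈t .at n = R.trans (R.sym (s⟶f .agree n n ℕₚ.≤-refl))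
    (R.trans (s≈t n .at n) (t⟶g .agree n n ℕₚ.≤-refl))

  *-1-X^ : ∀ f k {n} → n < k → (f * (1# - X ^ k)) n R.≈ f n
  *-1-X^ f k {n} n<k = R.trans
    (solve 2 (λ f x → f :* (con 𝟏 :- x) := f :- x :* f) refl f (X ^ k) .at n)
    (R.trans (R.+-congˡ (R.trans (R.-‿cong (X^*-< k f n<k)) -0#≈0#)) (R.+-identityʳ _))
    where open import Algebra.Properties.Ring R.ring using (-0#≈0#)

  stable : ∀ (s : ℕ → Series) → (∀ k {n} → n ≤ k → s (suc k) n R.≈ s k n) →
           ∀ {k m n} → n ≤ k → k ≤ m → s m n R.≈ s k n
  stable s step {k} n≤k k≤m = go (ℕₚ.≤⇒≤′ k≤m)
    where
    go : ∀ {m} → k ℕ.≤′ m → s m _ R.≈ s k _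
    go (ℕ.≤′-reflexive ≡.refl) = R.refl
    go (ℕ.≤′-step k≤m)         = R.trans (step _ (ℕₚ.≤-trans n≤k (ℕₚ.≤′⇒≤ k≤m))) (go k≤m)

  pochhammer : ℕ → Series
  pochhammer zero    = 1#
  pochhammer (suc k) = pochhammer k * (1# - X ^ suc k)

  factor : ∀ {l j} → Dec (l ∣ j) → Series
  factor {j = j} (yes _) = 1# - X ^ j
  factor         (no _)  = 1#

  -- Indexed by the same k as `pochhammer`, with a trivial factor wherever l does not divide the
  -- index, so that the two products can be compared factor by factor.
  multiples : ℕ → ℕ → Series
  multiples l zero    = 1#
  multiples l (suc k) = multiples l k * factor (l ∣? suc k)

  -- The diagonal form of ∏ (1 - q^j): factors with j > n do not touch the coefficient of q^n.
  euler : Series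
  euler n = pochhammer n n

  pochhammer⟶euler : pochhammer ⟶ euler
  pochhammer⟶euler .agree k n n≤k =
    stable pochhammer (λ k n≤k → *-1-X^ (pochhammer k) (suc k) (s≤s n≤k)) ℕₚ.≤-refl n≤k

  multiples-no : ∀ l k → ¬ l ∣ suc k → multiples l (suc k) ≈ multiples l k
  multiples-no l k l∤ with l ∣? suc k
  ... | yes l∣ = contradiction l∣ l∤
  ... | no _   = *-identityʳ _

  multiples-yes : ∀ l k → l ∣ suc k → multiples l (suc k) ≈ multiples l k * (1# - X ^ suc k)
  multiples-yes l k l∣ with l ∣? suc k
  ... | yes _ = refl
  ... | no l∤ = contradiction l∣ l∤

  dilate-1-X^ : ∀ l j → dilate l (1# - X ^ j) ≈ 1# - X ^ (suc l ℕ.* j)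
  dilate-1-X^ l j = begin
    dilate l (1# - X ^ j)            ≈⟨ spread-+ l 0 1# (- (X ^ j)) ⟩
    dilate l 1# + dilate l (- (X ^ j)) ≈⟨ +-cong (dilate-C l R.1#) (spread-neg l 0 (X ^ j)) ⟩
    1# - dilate l (X ^ j)            ≈⟨ +-congˡ (-‿cong (dilate-^ l X j)) ⟩
    1# - dilate l X ^ j              ≈⟨ +-congˡ (-‿cong (^-congˡ j (dilate-X l))) ⟩
    1# - (X ^ suc l) ^ j             ≈⟨ +-congˡ (-‿cong (^-assocʳ X (suc l) j)) ⟩
    1# - X ^ (suc l ℕ.* j)           ∎

  -- Between consecutive multiples of l + 1 all factors are trivial, which the induction on r walks
  -- through; each new multiple contributes the dilation of one factor of `pochhammer`.
  multiples≈dilate : ∀ l j r → r ≤ l → multiples (suc l) (r ℕ.+ j ℕ.* suc l) ≈ dilate l (pochhammer j)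
  multiples≈dilate l zero    zero    _   = sym (dilate-C l R.1#)
  multiples≈dilate l (suc j) zero    _   = begin
    multiples (suc l) (suc (l ℕ.+ j ℕ.* suc l))
      ≈⟨ multiples-yes (suc l) (l ℕ.+ j ℕ.* suc l) (n∣m*n (suc j)) ⟩
    multiples (suc l) (l ℕ.+ j ℕ.* suc l) * (1# - X ^ (suc j ℕ.* suc l))
      ≈⟨ *-cong (multiples≈dilate l j l ℕₚ.≤-refl)
           (trans (reflexive (≡.cong (λ e → 1# - X ^ e) (ℕₚ.*-comm (suc j) (suc l)))) (sym (dilate-1-X^ l (suc j)))) ⟩
    dilate l (pochhammer j) * dilate l (1# - X ^ suc j)
      ≈⟨ spread-* l 0 (pochhammer j) (1# - X ^ suc j) ⟨
    dilate l (pochhammer (suc j)) ∎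
  multiples≈dilate l j (suc r) r<l = trans (multiples-no (suc l) (r ℕ.+ j ℕ.* suc l) l∤)
                                           (multiples≈dilate l j r (ℕₚ.<⇒≤ r<l))
    where
    l∤ : ¬ suc l ∣ suc r ℕ.+ j ℕ.* suc l
    l∤ l∣ = ℕₚ.<⇒≱ r<l (ℕₚ.≤-pred (∣⇒≤ (∣m+n∣m⇒∣n
      (≡.subst (suc l ∣_) (ℕₚ.+-comm (suc r) (j ℕ.* suc l)) l∣) (n∣m*n j))))

  multiples⟶dilate-euler : ∀ l → multiples (suc l) ⟶ dilate l euler
  multiples⟶dilate-euler l .agree k n n≤k = R.trans
    -- At index k (l + 1) the product is exactly the dilation of `pochhammer k`, and its
    -- coefficients up to k no longer change from index k on.
    (R.sym (stable (multiples (suc l)) step n≤k (ℕₚ.m≤m*n k (suc l))))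
    (R.trans (multiples≈dilate l k 0 z≤n .at n)
             (spread-cong-≤ l 0 k (pochhammer⟶euler .agree k) n n≤k))
    where
    step : ∀ k {n} → n ≤ k → multiples (suc l) (suc k) n R.≈ multiples (suc l) k n
    step k {n} n≤k with suc l ∣? suc k
    ... | yes _ = *-1-X^ (multiples (suc l) k) (suc k) (s≤s n≤k)
    ... | no _  = *-identityʳ (multiples (suc l) k) .at n

  -- Frobenius applied twice, 9 being 3².
  [1-x]^9 : ∀ x → (1# - x) ^ 9 ≈ 1# - x ^ 9
  [1-x]^9 = solve 1 (λ x → (con 𝟏 :- x) :^ 9 := con 𝟏 :- x :^ 9) refl

  pochhammer^9 : ∀ k → pochhammer k ^ 9 ≈ dilate 8 (pochhammer k)
  pochhammer^9 zero    = trans (1^9≈1) (sym (dilate-C 8 R.1#))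
    where
    1^9≈1 : 1# ^ 9 ≈ 1#
    1^9≈1 = solve 0 (con 𝟏 :^ 9 := con 𝟏) refl
  pochhammer^9 (suc k) = begin
    (pochhammer k * (1# - X ^ suc k)) ^ 9           ≈⟨ ^-distrib-* (pochhammer k) (1# - X ^ suc k) 9 ⟩
    pochhammer k ^ 9 * (1# - X ^ suc k) ^ 9         ≈⟨ *-cong (pochhammer^9 k) step ⟩
    dilate 8 (pochhammer k) * dilate 8 (1# - X ^ suc k) ≈⟨ spread-* 8 0 (pochhammer k) (1# - X ^ suc k) ⟨
    dilate 8 (pochhammer (suc k))                   ∎
    where
    step : (1# - X ^ suc k) ^ 9 ≈ dilate 8 (1# - X ^ suc k)
    step = begin
      (1# - X ^ suc k) ^ 9      ≈⟨ [1-x]^9 (X ^ suc k) ⟩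
      1# - (X ^ suc k) ^ 9      ≈⟨ +-congˡ (-‿cong (^-assocʳ X (suc k) 9)) ⟩
      1# - X ^ (suc k ℕ.* 9)    ≈⟨ reflexive (≡.cong (λ e → 1# - X ^ e) (ℕₚ.*-comm (suc k) 9)) ⟩
      1# - X ^ (9 ℕ.* suc k)    ≈⟨ dilate-1-X^ 8 (suc k) ⟨
      dilate 8 (1# - X ^ suc k) ∎

  euler^9 : euler ^ 9 ≈ dilate 8 euler
  euler^9 = ⟶-unique (⟶-^ pochhammer⟶euler 9) (⟶-dilate 8 pochhammer⟶euler) pochhammer^9

-- Norms over the fifth roots of unity.

module FifthRoot {c ℓ} (R : CommutativeRing c ℓ) (ζ : CommutativeRing.Carrier R) where
  open CommutativeRing R
  IsPrimitiveFifthRoot : Set ℓ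
  IsPrimitiveFifthRoot = 1# + ζ + ζ * ζ + ζ * (ζ * ζ) + ζ * (ζ * (ζ * ζ)) ≈ 0#

module Norms {c ℓ} (R : CommutativeRing c ℓ) (3≈0 : CharacteristicThree R)
             (ζ : CommutativeRing.Carrier R) (Φ₅ζ≈0 : FifthRoot.IsPrimitiveFifthRoot R ζ) where

  open InfiniteProducts R 3≈0 public
  open import Algebra.Properties.Semiring.Exp R.semiring public using () renaming (_^_ to infixr 8 _^R_)
  open import Relation.Binary.Reasoning.Setoid setoid
  import Relation.Binary.Reasoning.Setoid R.setoid as R-Reasoning
  open import Algebra.Properties.CommutativeSemigroup R.*-commutativeSemigroup using (x∙yz≈y∙xz)

  -- The substitution of z q for q.
  twist : R.Carrier → Series → Series
  twist z f n = z ^R n R.* f n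

  twist-cong : ∀ z {f g} → f ≈ g → twist z f ≈ twist z g
  twist-cong z f≈g .at n = R.*-congˡ (f≈g .at n)

  twist-+ : ∀ z f g → twist z (f + g) ≈ twist z f + twist z g
  twist-+ z f g .at n = R.distribˡ _ _ _

  twist-neg : ∀ z f → twist z (- f) ≈ - twist z f
  twist-neg z f .at n = R.sym (-‿distribʳ-* _ _)
    where open import Algebra.Properties.Ring R.ring using (-‿distribʳ-*)

  twist-* : ∀ z f g → twist z (f * g) ≈ twist z f * twist z g
  twist-* z f g .at n = go n f
    where
    go : ∀ n f → twist z (f * g) n R.≈ (twist z f * twist z g) n
    go zero    f = R.trans (R.*-identityˡ _) (R.sym (R.*-cong (R.*-identityˡ _) (R.*-identityˡ _)))
    go (suc n) f = R-Reasoning.begin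
      z ^R suc n R.* (f 0 R.* g (suc n) R.+ (tail f * g) n)
        R-Reasoning.≈⟨ R.distribˡ _ _ _ ⟩
      z ^R suc n R.* (f 0 R.* g (suc n)) R.+ z ^R suc n R.* (tail f * g) n
        R-Reasoning.≈⟨ R.+-cong (x∙yz≈y∙xz _ _ _) (R.*-assoc _ _ _) ⟩
      f 0 R.* twist z g (suc n) R.+ z R.* twist z (tail f * g) n
        R-Reasoning.≈⟨ R.+-cong (R.*-congʳ (R.sym (R.*-identityˡ _))) (R.*-congˡ (go n (tail f))) ⟩
      twist z f 0 R.* twist z g (suc n) R.+ z R.* (twist z (tail f) * twist z g) n
        R-Reasoning.≈⟨ R.+-congˡ (PS.scale-* z (twist z (tail f)) (twist z g) n) ⟨
      twist z f 0 R.* twist z g (suc n) R.+ (PS.scale z (twist z (tail f)) * twist z g) n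
        R-Reasoning.≈⟨ R.+-congˡ (*-cong-≤ n (λ i _ → R.*-assoc _ _ _) (λ i _ → R.refl)) ⟨
      (twist z f * twist z g) (suc n) R-Reasoning.∎

  twist-C : ∀ z a → twist z (C a) ≈ C a
  twist-C z a .at zero    = R.*-identityˡ a
  twist-C z a .at (suc n) = R.zeroʳ _

  twist-X : ∀ z → twist z X ≈ C z * X
  twist-X z .at zero          = R.trans (R.*-identityˡ _) (R.sym (R.zeroʳ _))
  twist-X z .at (suc zero)    = R.trans (R.*-congʳ (R.*-identityʳ z)) (R.sym (C-* z X 1))
  twist-X z .at (suc (suc n)) = R.trans (R.zeroʳ _) (R.sym (R.trans (C-* z X (suc (suc n))) (R.zeroʳ z)))

  twist-^ : ∀ z f n → twist z (f ^ n) ≈ twist z f ^ n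
  twist-^ z f zero    = twist-C z R.1#
  twist-^ z f (suc n) = trans (twist-* z f (f ^ n)) (*-congˡ (twist-^ z f n))

  twist-spread : ∀ {z} k → z ^R suc k R.≈ R.1# → ∀ j f → twist z (spread k j f) ≈ C (z ^R j) * spread k j f
  twist-spread {z} k z^≈1 j f .at n = R.trans (go j f n) (R.sym (C-* _ _ n))
    where
    go : ∀ j f n → z ^R n R.* spread k j f n R.≈ z ^R j R.* spread k j f n
    go zero    f zero    = R.refl
    go zero    f (suc n) = R.trans (R.*-assoc _ _ _) (R.trans (R.*-congˡ (go k (tail f) n))
      (R.trans (R.sym (R.*-assoc _ _ _)) (R.*-congʳ z^≈1)))
    go (suc j) f zero    = R.trans (R.zeroʳ _) (R.sym (R.zeroʳ _))
    go (suc j) f (suc n) = R.trans (R.*-assoc _ _ _) (R.trans (R.*-congˡ (go j f n)) (R.sym (R.*-assoc _ _ _)))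

  C-homo-* : ∀ a b → C (a R.* b) ≈ C a * C b
  C-homo-* a b .at zero    = R.refl
  C-homo-* a b .at (suc n) = R.sym (R.trans (C-* a (C b) (suc n)) (R.zeroʳ a))

  C-homo-^ : ∀ a n → C (a ^R n) ≈ C a ^ n
  C-homo-^ a zero    = refl
  C-homo-^ a (suc n) = trans (C-homo-* a (a ^R n)) (*-congˡ (C-homo-^ a n))

  Φ₅ : Series → Series
  Φ₅ u = 1# + u + u ^ 2 + u ^ 3 + u ^ 4

  w : Series
  w = C ζ

  Φ₅w≈0 : Φ₅ w ≈ 0#
  Φ₅w≈0 = begin
    Φ₅ w ≈⟨ solve 1 (λ w → con 𝟏 :+ w :+ w :^ 2 :+ w :^ 3 :+ w :^ 4 :=
                       con 𝟏 :+ w :+ w :* w :+ w :* (w :* w) :+ w :* (w :* (w :* w))) refl w ⟩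
    1# + w + w * w + w * (w * w) + w * (w * (w * w))
         ≈⟨ +-cong (+-cong (+-congˡ (sym (C-homo-* _ _))) (cube)) (trans (*-congˡ cube) (sym (C-homo-* _ _))) ⟩
    1# + w + C (ζ R.* ζ) + C (ζ R.* (ζ R.* ζ)) + C (ζ R.* (ζ R.* (ζ R.* ζ)))
         ≈⟨ coefficientwise constant ⟩
    0#   ∎
    where
    cube : w * (w * w) ≈ C (ζ R.* (ζ R.* ζ))
    cube = trans (*-congˡ (sym (C-homo-* _ _))) (sym (C-homo-* _ _))
    constant : ∀ n → (1# + w + C (ζ R.* ζ) + C (ζ R.* (ζ R.* ζ)) + C (ζ R.* (ζ R.* (ζ R.* ζ)))) n R.≈ R.0#
    constant zero    = Φ₅ζ≈0
    constant (suc n) = zeros .at n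
      where
      zeros : 0# + 0# + 0# + 0# + 0# ≈ 0#
      zeros = solve 0 (con 𝟎 :+ con 𝟎 :+ con 𝟎 :+ con 𝟎 :+ con 𝟎 := con 𝟎) refl

  u^5≈1 : ∀ {u} → Φ₅ u ≈ 0# → u ^ 5 ≈ 1#
  u^5≈1 {u} Φu≈0 = begin
    u ^ 5                  ≈⟨ solve 1 (λ u → u :^ 5 := (u :- con 𝟏) :* (con 𝟏 :+ u :+ u :^ 2 :+ u :^ 3 :+ u :^ 4) :+ con 𝟏) refl u ⟩
    (u - 1#) * Φ₅ u + 1#   ≈⟨ +-congʳ (trans (*-congˡ Φu≈0) (zeroʳ _)) ⟩
    0# + 1#                ≈⟨ +-identityˡ _ ⟩
    1#                     ∎

  -- The solver knows no relations, so a relation `a ≈ 0` is used by exhibiting the quotient c of x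
  -- - y by a. The explicit cofactors in the solver calls below are such quotients.
  modulo : ∀ {x y a} → a ≈ 0# → ∀ c → x ≈ y + a * c → x ≈ y
  modulo {x} {y} {a} a≈0 c eq = begin
    x          ≈⟨ eq ⟩
    y + a * c  ≈⟨ +-congˡ (trans (*-congʳ a≈0) (zeroˡ c)) ⟩
    y + 0#     ≈⟨ +-identityʳ y ⟩
    y          ∎

  Φ₅-cong : ∀ {u v} → u ≈ v → Φ₅ u ≈ Φ₅ v
  Φ₅-cong u≈v = +-cong (+-cong (+-cong (+-congˡ u≈v) (^-congˡ 2 u≈v)) (^-congˡ 3 u≈v)) (^-congˡ 4 u≈v)

  :Φ₅ : ∀ {n} → Polynomial n → Polynomial n
  :Φ₅ u = con 𝟏 :+ u :+ u :^ 2 :+ u :^ 3 :+ u :^ 4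

  w^5≈1 : w ^ 5 ≈ 1#
  w^5≈1 = u^5≈1 Φ₅w≈0

  -- The cofactors are products of cyclotomic polynomials: Φ₅(x²) = Φ₅Φ₁₀, Φ₅(x³) = Φ₅Φ₁₅ and
  -- Φ₅(x⁴) = Φ₅Φ₁₀Φ₂₀.
  Φ₅-^ : ∀ k → ¬ 5 ∣ k → Φ₅ (w ^ k) ≈ 0#
  Φ₅-^ 0 5∤ = contradiction (5 ∣0) 5∤
  Φ₅-^ 1 _  = trans (Φ₅-cong (*-identityʳ w)) Φ₅w≈0
  Φ₅-^ 2 _  = modulo Φ₅w≈0 _
    (solve 1 (λ w → :Φ₅ (w :^ 2) := con 𝟎 :+ :Φ₅ w :* (con 𝟏 :- w :+ w :^ 2 :- w :^ 3 :+ w :^ 4)) refl w)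
  Φ₅-^ 3 _  = modulo Φ₅w≈0 _
    (solve 1 (λ w → :Φ₅ (w :^ 3) := con 𝟎 :+ :Φ₅ w :*
      (con 𝟏 :- w :+ w :^ 3 :- w :^ 4 :+ w :^ 5 :- w :^ 7 :+ w :^ 8)) refl w)
  Φ₅-^ 4 _  = modulo Φ₅w≈0 _
    (solve 1 (λ w → :Φ₅ (w :^ 4) := con 𝟎 :+ :Φ₅ w :* ((con 𝟏 :- w :+ w :^ 2 :- w :^ 3 :+ w :^ 4)
      :* (con 𝟏 :- w :^ 2 :+ w :^ 4 :- w :^ 6 :+ w :^ 8))) refl w)
  Φ₅-^ (suc (suc (suc (suc (suc k))))) 5∤ =
    trans (Φ₅-cong w^5+k≈w^k) (Φ₅-^ k (λ 5∣k → 5∤ (∣m∣n⇒∣m+n ∣-refl 5∣k)))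
    where
    w^5+k≈w^k : w ^ (5 ℕ.+ k) ≈ w ^ k
    w^5+k≈w^k = trans (^-homo-* w 5 k) (trans (*-congʳ w^5≈1) (*-identityˡ _))

  1^n≈1 : ∀ n → 1# ^ n ≈ 1#
  1^n≈1 zero    = refl
  1^n≈1 (suc n) = trans (*-identityˡ _) (1^n≈1 n)

  conjugate : ℕ → Series → Series
  conjugate i = twist (ζ ^R i)

  norm : Series → Series
  norm f = f * conjugate 1 f * conjugate 2 f * conjugate 3 f * conjugate 4 f

  *-cong₅ : ∀ {x₀ x₁ x₂ x₃ x₄ y₀ y₁ y₂ y₃ y₄} → x₀ ≈ y₀ → x₁ ≈ y₁ → x₂ ≈ y₂ → x₃ ≈ y₃ → x₄ ≈ y₄ →
            x₀ * x₁ * x₂ * x₃ * x₄ ≈ y₀ * y₁ * y₂ * y₃ * y₄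
  *-cong₅ e₀ e₁ e₂ e₃ e₄ = *-cong (*-cong (*-cong (*-cong e₀ e₁) e₂) e₃) e₄

  norm-cong : ∀ {f g} → f ≈ g → norm f ≈ norm g
  norm-cong f≈g = *-cong₅ f≈g (twist-cong _ f≈g) (twist-cong _ f≈g) (twist-cong _ f≈g) (twist-cong _ f≈g)

  norm-* : ∀ f g → norm (f * g) ≈ norm f * norm g
  norm-* f g = trans (*-cong₅ refl (twist-* _ f g) (twist-* _ f g) (twist-* _ f g) (twist-* _ f g))
    (solve 10 (λ a b c d e a′ b′ c′ d′ e′ →
      (a :* a′) :* (b :* b′) :* (c :* c′) :* (d :* d′) :* (e :* e′) :=
      (a :* b :* c :* d :* e) :* (a′ :* b′ :* c′ :* d′ :* e′)) refl _ _ _ _ _ _ _ _ _ _)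

  norm-1 : norm 1# ≈ 1#
  norm-1 = trans (*-cong₅ refl (twist-C _ R.1#) (twist-C _ R.1#) (twist-C _ R.1#) (twist-C _ R.1#))
    (solve 0 (con 𝟏 :* con 𝟏 :* con 𝟏 :* con 𝟏 :* con 𝟏 := con 𝟏) refl)

  ⟶-norm : ∀ {s f} → s ⟶ f → (λ k → norm (s k)) ⟶ norm f
  ⟶-norm {s} {f} s⟶f = ⟶-* (⟶-* (⟶-* (⟶-* s⟶f (⟶-conjugate 1)) (⟶-conjugate 2)) (⟶-conjugate 3)) (⟶-conjugate 4)
    where
    ⟶-conjugate : ∀ i → (λ k → conjugate i (s k)) ⟶ conjugate i f
    ⟶-conjugate i .agree k n n≤k = R.*-congˡ (s⟶f .agree k n n≤k)

  conjugate-1-X^ : ∀ i k → conjugate i (1# - X ^ k) ≈ 1# - (w ^ k) ^ i * X ^ k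
  conjugate-1-X^ i k = begin
    twist z (1# - X ^ k)              ≈⟨ twist-+ z 1# (- (X ^ k)) ⟩
    twist z 1# + twist z (- (X ^ k))  ≈⟨ +-cong (twist-C z R.1#) (twist-neg z (X ^ k)) ⟩
    1# - twist z (X ^ k)              ≈⟨ +-congˡ (-‿cong step) ⟩
    1# - (w ^ k) ^ i * X ^ k          ∎
    where
    z = ζ ^R i
    step : twist z (X ^ k) ≈ (w ^ k) ^ i * X ^ k
    step = begin
      twist z (X ^ k)        ≈⟨ twist-^ z X k ⟩
      twist z X ^ k          ≈⟨ ^-congˡ k (twist-X z) ⟩
      (C z * X) ^ k          ≈⟨ ^-distrib-* (C z) X k ⟩
      C z ^ k * X ^ k        ≈⟨ *-congʳ (^-congˡ k (C-homo-^ ζ i)) ⟩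
      (w ^ i) ^ k * X ^ k    ≈⟨ *-congʳ (^-assocʳ w i k) ⟩
      w ^ (i ℕ.* k) * X ^ k  ≈⟨ *-congʳ (reflexive (≡.cong (w ^_) (ℕₚ.*-comm i k))) ⟩
      w ^ (k ℕ.* i) * X ^ k  ≈⟨ *-congʳ (^-assocʳ w k i) ⟨
      (w ^ k) ^ i * X ^ k    ∎

  norm-1-X^ : ∀ k → norm (1# - X ^ k) ≈
    (1# - X ^ k) * (1# - (w ^ k) ^ 1 * X ^ k) * (1# - (w ^ k) ^ 2 * X ^ k)
      * (1# - (w ^ k) ^ 3 * X ^ k) * (1# - (w ^ k) ^ 4 * X ^ k)
  norm-1-X^ k = *-cong₅ refl (conjugate-1-X^ 1 k) (conjugate-1-X^ 2 k) (conjugate-1-X^ 3 k) (conjugate-1-X^ 4 k)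

  -- For k prime to 5 the powers of w^k run through all fifth roots of unity, as w^k is again a root
  -- of Φ₅.
  norm-1-X^-∤ : ∀ k → ¬ 5 ∣ k → norm (1# - X ^ k) ≈ dilate 4 (1# - X ^ k)
  norm-1-X^-∤ k 5∤k = begin
    norm (1# - X ^ k)  ≈⟨ norm-1-X^ k ⟩
    _                  ≈⟨ product (w ^ k) (X ^ k) (Φ₅-^ k 5∤k) ⟩
    1# - (X ^ k) ^ 5   ≈⟨ +-congˡ (-‿cong (trans (^-assocʳ X k 5) (reflexive (≡.cong (X ^_) (ℕₚ.*-comm k 5))))) ⟩
    1# - X ^ (5 ℕ.* k) ≈⟨ dilate-1-X^ 4 k ⟨
    dilate 4 (1# - X ^ k) ∎
    where
    product : ∀ u x → Φ₅ u ≈ 0# →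
      (1# - x) * (1# - u ^ 1 * x) * (1# - u ^ 2 * x) * (1# - u ^ 3 * x) * (1# - u ^ 4 * x) ≈ 1# - x ^ 5
    product u x Φu≈0 = begin
      (1# - x) * (1# - u ^ 1 * x) * (1# - u ^ 2 * x) * (1# - u ^ 3 * x) * (1# - u ^ 4 * x)
        ≈⟨ solve 2 (λ u x → (con 𝟏 :- x) :* (con 𝟏 :- u :^ 1 :* x) :* (con 𝟏 :- u :^ 2 :* x)
             :* (con 𝟏 :- u :^ 3 :* x) :* (con 𝟏 :- u :^ 4 :* x) :=
             (con 𝟏 :- x) :* ((con 𝟏 :- u :* x) :* (con 𝟏 :- u :^ 4 :* x))
               :* ((con 𝟏 :- u :^ 2 :* x) :* (con 𝟏 :- u :^ 3 :* x))) refl u x ⟩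
      (1# - x) * ((1# - u * x) * (1# - u ^ 4 * x)) * ((1# - u ^ 2 * x) * (1# - u ^ 3 * x))
        ≈⟨ *-cong (*-congˡ (modulo u^5-1≈0 _ (solve 2 (λ u x →
             (con 𝟏 :- u :* x) :* (con 𝟏 :- u :^ 4 :* x) :=
             con 𝟏 :- (u :+ u :^ 4) :* x :+ x :^ 2 :+ (u :^ 5 :- con 𝟏) :* x :^ 2) refl u x)))
           (modulo u^5-1≈0 _ (solve 2 (λ u x →
             (con 𝟏 :- u :^ 2 :* x) :* (con 𝟏 :- u :^ 3 :* x) :=
             con 𝟏 :- (u :^ 2 :+ u :^ 3) :* x :+ x :^ 2 :+ (u :^ 5 :- con 𝟏) :* x :^ 2) refl u x)) ⟩
      (1# - x) * (1# - (u + u ^ 4) * x + x ^ 2) * (1# - (u ^ 2 + u ^ 3) * x + x ^ 2)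
        -- With s = u + u⁴ and t = u² + u³, both s + t + 1 = Φ₅(u) and s t + 1 = Φ₅(u) (1 - u + u³)
        -- vanish, which leaves (1 - x) (1 + x + x² + x³ + x⁴).
        ≈⟨ modulo Φu≈0 _ (solve 2 (λ u x →
             (con 𝟏 :- x) :* (con 𝟏 :- (u :+ u :^ 4) :* x :+ x :^ 2) :* (con 𝟏 :- (u :^ 2 :+ u :^ 3) :* x :+ x :^ 2) :=
             con 𝟏 :- x :^ 5 :+ :Φ₅ u :* ((con 𝟏 :- x) :*
               ((con 𝟏 :- u :+ u :^ 3) :* x :^ 2 :- (x :+ x :^ 3)))) refl u x) ⟩
      1# - x ^ 5 ∎
      where
      u^5-1≈0 : u ^ 5 - 1# ≈ 0#
      u^5-1≈0 = trans (+-congʳ (u^5≈1 Φu≈0)) (-‿inverseʳ 1#)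

  -- Here w^k = 1, so all five conjugates coincide.
  norm-1-X^-∣ : ∀ k → 5 ∣ k → norm (1# - X ^ k) ≈ (1# - X ^ k) ^ 5
  norm-1-X^-∣ k (divides j ≡.refl) = begin
    norm (1# - x)  ≈⟨ norm-1-X^ k ⟩
    _              ≈⟨ *-cong₅ refl (step 1) (step 2) (step 3) (step 4) ⟩
    (1# - x) * (1# - x) * (1# - x) * (1# - x) * (1# - x)
                   ≈⟨ solve 1 (λ y → y :* y :* y :* y :* y := y :^ 5) refl (1# - x) ⟩
    (1# - x) ^ 5   ∎
    where
    x = X ^ (j ℕ.* 5)
    w^k≈1 : w ^ (j ℕ.* 5) ≈ 1#
    w^k≈1 = begin
      w ^ (j ℕ.* 5)  ≈⟨ reflexive (≡.cong (w ^_) (ℕₚ.*-comm j 5)) ⟩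
      w ^ (5 ℕ.* j)  ≈⟨ ^-assocʳ w 5 j ⟨
      (w ^ 5) ^ j    ≈⟨ ^-congˡ j w^5≈1 ⟩
      1# ^ j         ≈⟨ 1^n≈1 j ⟩
      1#             ∎
    step : ∀ i → 1# - (w ^ (j ℕ.* 5)) ^ i * x ≈ 1# - x
    step i = +-congˡ (-‿cong (trans (*-congʳ (trans (^-congˡ i w^k≈1) (1^n≈1 i))) (*-identityˡ x)))

  -- A factor 1 - q^j has norm 1 - q^(5j) if 5 does not divide j, and (1 - q^j)⁵ if it does. In the
  -- limit the norm of f is f(q⁵)⁶ / f(q²⁵); the denominator compensates for the factors with 5 ∣ j
  -- and is multiplied across.
  norm-pochhammer : ∀ k → norm (pochhammer k) * dilate 4 (multiples 5 k) ≈
                          dilate 4 (pochhammer k) * multiples 5 k ^ 5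
  norm-pochhammer zero = begin
    norm 1# * dilate 4 1#     ≈⟨ *-cong norm-1 (dilate-C 4 R.1#) ⟩
    1# * 1#                   ≈⟨ solve 0 (con 𝟏 :* con 𝟏 := con 𝟏 :* con 𝟏 :^ 5) refl ⟩
    1# * 1# ^ 5               ≈⟨ *-congʳ (dilate-C 4 R.1#) ⟨
    dilate 4 1# * 1# ^ 5      ∎
  norm-pochhammer (suc k) with 5 ∣? suc k
  ... | no 5∤ = begin
    norm (T * t) * dilate 4 (M * 1#)         ≈⟨ *-cong (norm-* T t) (spread-cong 4 0 (*-identityʳ M)) ⟩
    norm T * norm t * dilate 4 M             ≈⟨ *-congʳ (*-congˡ (norm-1-X^-∤ (suc k) 5∤)) ⟩
    norm T * dilate 4 t * dilate 4 M         ≈⟨ solve 3 (λ x y z → x :* y :* z := x :* z :* y) refl _ _ _ ⟩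
    norm T * dilate 4 M * dilate 4 t         ≈⟨ *-congʳ (norm-pochhammer k) ⟩
    dilate 4 T * M ^ 5 * dilate 4 t          ≈⟨ solve 3 (λ x y z → x :* y :* z := x :* z :* y) refl _ _ _ ⟩
    dilate 4 T * dilate 4 t * M ^ 5          ≈⟨ *-cong (spread-* 4 0 T t) (^-congˡ 5 (*-identityʳ M)) ⟨
    dilate 4 (T * t) * (M * 1#) ^ 5          ∎
    where
    T = pochhammer k
    M = multiples 5 k
    t = 1# - X ^ suc k
  ... | yes 5∣ = begin
    norm (T * t) * dilate 4 (M * t)                ≈⟨ *-cong (norm-* T t) (spread-* 4 0 M t) ⟩
    norm T * norm t * (dilate 4 M * dilate 4 t)    ≈⟨ *-congʳ (*-congˡ (norm-1-X^-∣ (suc k) 5∣)) ⟩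
    norm T * t ^ 5 * (dilate 4 M * dilate 4 t)
      ≈⟨ solve 4 (λ x y z u → x :* y :* (z :* u) := x :* z :* (u :* y)) refl _ _ _ _ ⟩
    norm T * dilate 4 M * (dilate 4 t * t ^ 5)     ≈⟨ *-congʳ (norm-pochhammer k) ⟩
    dilate 4 T * M ^ 5 * (dilate 4 t * t ^ 5)
      ≈⟨ solve 4 (λ x y z u → x :* y :* (z :* u) := x :* z :* (y :* u)) refl _ _ _ _ ⟩
    dilate 4 T * dilate 4 t * (M ^ 5 * t ^ 5)      ≈⟨ *-cong (spread-* 4 0 T t) (^-distrib-* M t 5) ⟨
    dilate 4 (T * t) * (M * t) ^ 5                 ∎
    where
    T = pochhammer k
    M = multiples 5 k
    t = 1# - X ^ suc k

  norm-euler : norm euler * dilate 4 (dilate 4 euler) ≈ dilate 4 euler * dilate 4 euler ^ 5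
  norm-euler = ⟶-unique
    (⟶-* (⟶-norm pochhammer⟶euler) (⟶-dilate 4 (multiples⟶dilate-euler 4)))
    (⟶-* (⟶-dilate 4 pochhammer⟶euler) (⟶-^ (multiples⟶dilate-euler 4) 5))
    norm-pochhammer

-- Lists that enumerate a predicate without repetition.

record Enumerates {A : Set} (P : A → Set) (xs : List A) : Set where
  constructor enumerates
  field
    unique   : Unique xs
    sound    : ∀ {x} → x ∈ xs → P x
    complete : ∀ {x} → P x → x ∈ xs

module _ {A : Set} where

  open Enumerates

  -- Duplicate-free lists with the same members are permutations of each other. Every rearrangement
  -- of a sum below is thereby reduced to an equivalence of two predicates.
  enumerates-↭ : ∀ {P Q : A → Set} {xs ys} → Enumerates P xs → Enumerates Q ys →
                 (∀ {x} → P x → Q x) → (∀ {x} → Q x → P x) → xs ↭ ys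
  enumerates-↭ X Y to from = ∼bag⇒↭ (unique∧set⇒bag (unique X) (unique Y)
    (mk⇔ (complete Y ∘ to ∘ sound X) (complete X ∘ from ∘ sound Y)))

  enumerates-filter : ∀ {P Q : A → Set} {xs} (Q? : Decidable Q) → Enumerates P xs →
                      Enumerates (λ x → P x × Q x) (filter Q? xs)
  enumerates-filter Q? X = enumerates (filter⁺ Q? (unique X))
    (λ x∈ → let x∈xs , Qx = ∈-filter⁻ Q? x∈ in sound X x∈xs , Qx)
    (λ (Px , Qx) → ∈-filter⁺ Q? (complete X Px) Qx)

  enumerates-++ : ∀ {P Q : A → Set} {xs ys} → (∀ {x} → P x → Q x → ⊥) →
                  Enumerates P xs → Enumerates Q ys → Enumerates (λ x → P x ⊎ Q x) (xs ++ ys)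
  enumerates-++ {P} {Q} {xs} {ys} disjoint X Y = enumerates
    (++⁺ (unique X) (unique Y) (λ (x∈xs , x∈ys) → disjoint (sound X x∈xs) (sound Y x∈ys)))
    (λ x∈ → from (∈-++⁻ xs x∈))
    to
    where
    from : ∀ {x} → x ∈ xs ⊎ x ∈ ys → P x ⊎ Q x
    from (inj₁ x∈) = inj₁ (sound X x∈)
    from (inj₂ x∈) = inj₂ (sound Y x∈)
    to : ∀ {x} → P x ⊎ Q x → x ∈ xs ++ ys
    to (inj₁ Px) = ∈-++⁺ˡ (complete X Px)
    to (inj₂ Qx) = ∈-++⁺ʳ xs (complete Y Qx)

module _ {A B : Set} where

  open Enumerates

  enumerates-map : ∀ {P : A → Set} {xs} {f : A → B} → (∀ {x y} → f x ≡ f y → x ≡ y) →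
                   Enumerates P xs → Enumerates (λ y → ∃ λ x → P x × y ≡ f x) (map f xs)
  enumerates-map {f = f} f-inj X = enumerates (map⁺ f-inj (unique X))
    (λ y∈ → let x , x∈ , y≡ = ∈-map⁻ f y∈ in x , sound X x∈ , y≡)
    (λ { (x , Px , ≡.refl) → ∈-map⁺ f (complete X Px) })

  enumerates-× : ∀ {P : A → Set} {Q : B → Set} {xs ys} → Enumerates P xs → Enumerates Q ys →
                 Enumerates (λ xy → P (proj₁ xy) × Q (proj₂ xy)) (cartesianProduct xs ys)
  enumerates-× {xs = xs} {ys} X Y = enumerates (cartesianProduct⁺ (unique X) (unique Y))
    (λ xy∈ → let x∈ , y∈ = ∈-cartesianProduct⁻ xs ys xy∈ in sound X x∈ , sound Y y∈)
    (λ (Px , Qy) → ∈-cartesianProduct⁺ (complete X Px) (complete Y Qy))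

  -- The recursion copies that of the series product, so that `generating-*` requires no reindexing.
  convolution : (ℕ → List A) → (ℕ → List B) → ℕ → List (A × B)
  convolution xs ys zero    = cartesianProduct (xs 0) (ys 0)
  convolution xs ys (suc n) = cartesianProduct (xs 0) (ys (suc n)) ++ convolution (xs ∘ suc) ys n

  Graded : (ℕ → A → Set) → (ℕ → B → Set) → ℕ → A × B → Set
  Graded P Q n (x , y) = ∃₂ λ i j → i ℕ.+ j ≡ n × P i x × Q j y

  -- An element x has at most one grade (`P-disjoint`), so blocks with different i do not overlap;
  -- this property passes to the shifted grading `P ∘ suc`, on which the induction runs.
  enumerates-convolution : ∀ {P : ℕ → A → Set} {Q : ℕ → B → Set} {xs ys} →
    (∀ {i j x} → P i x → P j x → i ≡ j) →
    (∀ n → Enumerates (P n) (xs n)) → (∀ n → Enumerates (Q n) (ys n)) →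
    ∀ n → Enumerates (Graded P Q n) (convolution xs ys n)
  enumerates-convolution P-disjoint X Y zero = enumerates (unique XY)
    (λ xy∈ → 0 , 0 , ≡.refl , sound XY xy∈)
    (λ { (zero , zero , ≡.refl , Pxy) → complete XY Pxy })
    where XY = enumerates-× (X 0) (Y 0)
  enumerates-convolution {P} {Q} P-disjoint X Y (suc n) = enumerates (unique XY)
    (from ∘ sound XY) (complete XY ∘ to)
    where
    XY = enumerates-++ (λ { (P₀x , _) (i , _ , _ , Pᵢx , _) → ℕₚ.0≢1+n (P-disjoint P₀x Pᵢx) })
      (enumerates-× (X 0) (Y (suc n)))
      (enumerates-convolution (λ Px P′x → ℕₚ.suc-injective (P-disjoint Px P′x)) (X ∘ suc) Y n)
    from : ∀ {xy} → (P 0 (proj₁ xy) × Q (suc n) (proj₂ xy)) ⊎ Graded (P ∘ suc) Q n xy → Graded P Q (suc n) xy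
    from (inj₁ Pxy)                    = 0 , suc n , ≡.refl , Pxy
    from (inj₂ (i , j , ≡.refl , Pxy)) = suc i , j , ≡.refl , Pxy
    to : ∀ {xy} → Graded P Q (suc n) xy → (P 0 (proj₁ xy) × Q (suc n) (proj₂ xy)) ⊎ Graded (P ∘ suc) Q n xy
    to (zero , j , ≡.refl , Pxy)  = inj₁ Pxy
    to (suc i , j , ≡.refl , Pxy) = inj₂ (i , j , ≡.refl , Pxy)

-- Finite sums over lists.

module Sums {c ℓ} (R : CommutativeRing c ℓ) where

  open CommutativeRing R
  open import Algebra.Properties.CommutativeSemigroup +-commutativeSemigroup using (x∙yz≈y∙xz; interchange)
  open import Relation.Binary.Reasoning.Setoid setoid
  private module PS = PowerSeries R

  ∑ : {A : Set} → (A → Carrier) → List A → Carrier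
  ∑ u []       = 0#
  ∑ u (x ∷ xs) = u x + ∑ u xs

  ∑-cong-∈ : ∀ {A : Set} {u v : A → Carrier} xs → (∀ {x} → x ∈ xs → u x ≈ v x) → ∑ u xs ≈ ∑ v xs
  ∑-cong-∈ []       u≈v = refl
  ∑-cong-∈ (x ∷ xs) u≈v = +-cong (u≈v (here ≡.refl)) (∑-cong-∈ xs (u≈v ∘ there))

  ∑-+ : ∀ {A : Set} (u v : A → Carrier) xs → ∑ (λ x → u x + v x) xs ≈ ∑ u xs + ∑ v xs
  ∑-+ u v []       = sym (+-identityˡ 0#)
  ∑-+ u v (x ∷ xs) = trans (+-congˡ (∑-+ u v xs)) (interchange _ _ _ _)

  ∑-neg : ∀ {A : Set} (u : A → Carrier) xs → ∑ (λ x → - u x) xs ≈ - ∑ u xs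
  ∑-neg u []       = sym -0#≈0#
    where open import Algebra.Properties.Ring ring using (-0#≈0#)
  ∑-neg u (x ∷ xs) = trans (+-congˡ (∑-neg u xs)) (-‿+-comm _ _)
    where open import Algebra.Properties.Ring ring using (-‿+-comm)

  ∑-*ˡ : ∀ {A : Set} a (u : A → Carrier) xs → ∑ (λ x → a * u x) xs ≈ a * ∑ u xs
  ∑-*ˡ a u []       = sym (zeroʳ a)
  ∑-*ˡ a u (x ∷ xs) = trans (+-congˡ (∑-*ˡ a u xs)) (sym (distribˡ _ _ _))

  ∑-++ : ∀ {A : Set} (u : A → Carrier) xs ys → ∑ u (xs ++ ys) ≈ ∑ u xs + ∑ u ys
  ∑-++ u []       ys = sym (+-identityˡ _)
  ∑-++ u (x ∷ xs) ys = trans (+-congˡ (∑-++ u xs ys)) (sym (+-assoc _ _ _))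

  ∑-map : ∀ {A B : Set} (u : B → Carrier) (f : A → B) xs → ∑ u (map f xs) ≡ ∑ (u ∘ f) xs
  ∑-map u f []       = ≡.refl
  ∑-map u f (x ∷ xs) = ≡.cong (λ y → u (f x) + y) (∑-map u f xs)

  ∑-↭ : ∀ {A : Set} (u : A → Carrier) {xs ys} → xs ↭ ys → ∑ u xs ≈ ∑ u ys
  ∑-↭ u Perm.refl                 = refl
  ∑-↭ u (Perm.prep x xs↭ys)       = +-congˡ (∑-↭ u xs↭ys)
  ∑-↭ u (Perm.swap x y xs↭ys)     = trans (+-congˡ (+-congˡ (∑-↭ u xs↭ys))) (x∙yz≈y∙xz _ _ _)
  ∑-↭ u (Perm.trans xs↭ys ys↭zs)  = trans (∑-↭ u xs↭ys) (∑-↭ u ys↭zs)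

  ∑-× : ∀ {A B : Set} (u : A → Carrier) (v : B → Carrier) xs ys →
        ∑ (λ xy → u (proj₁ xy) * v (proj₂ xy)) (cartesianProduct xs ys) ≈ ∑ u xs * ∑ v ys
  ∑-× u v []       ys = sym (zeroˡ _)
  ∑-× u v (x ∷ xs) ys = begin
    ∑ uv (map (x ,_) ys ++ cartesianProduct xs ys)        ≈⟨ ∑-++ uv (map (x ,_) ys) _ ⟩
    ∑ uv (map (x ,_) ys) + ∑ uv (cartesianProduct xs ys)
      ≈⟨ +-cong (trans (reflexive (∑-map uv (x ,_) ys)) (∑-*ˡ (u x) v ys)) (∑-× u v xs ys) ⟩
    u x * ∑ v ys + ∑ u xs * ∑ v ys                        ≈⟨ distribʳ _ _ _ ⟨
    (u x + ∑ u xs) * ∑ v ys                               ∎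
    where uv = λ xy → u (proj₁ xy) * v (proj₂ xy)

  generating : {A : Set} → (A → Carrier) → (ℕ → List A) → ℕ → Carrier
  generating u xs n = ∑ u (xs n)

  generating-* : ∀ {A B : Set} (u : A → Carrier) (v : B → Carrier) xs ys n →
    ∑ (λ xy → u (proj₁ xy) * v (proj₂ xy)) (convolution xs ys n) ≈ (generating u xs PS.* generating v ys) n
  generating-* u v xs ys zero    = ∑-× u v (xs 0) (ys 0)
  generating-* u v xs ys (suc n) = trans
    (∑-++ (λ xy → u (proj₁ xy) * v (proj₂ xy)) (cartesianProduct (xs 0) (ys (suc n))) _)
    (+-cong (∑-× u v (xs 0) (ys (suc n))) (generating-* u v (xs ∘ suc) ys n))

  indicator : ∀ {P : Set} → Dec P → Carrier → Carrier
  indicator (yes _) a = a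
  indicator (no _)  a = 0#

  ∑-filter : ∀ {A : Set} {P : A → Set} (P? : Decidable P) (u : A → Carrier) xs →
             ∑ u (filter P? xs) ≈ ∑ (λ x → indicator (P? x) (u x)) xs
  ∑-filter P? u []       = refl
  ∑-filter P? u (x ∷ xs) with P? x
  ... | yes _ = +-congˡ (∑-filter P? u xs)
  ... | no _  = trans (∑-filter P? u xs) (sym (+-identityˡ _))

-- Generalized pentagonal numbers.

triangular : ℕ → ℕ
triangular zero    = 0
triangular (suc n) = triangular n ℕ.+ suc n

-- The numbers n (3n - 1) / 2, written as |n|² plus a triangular number. This avoids halving and
-- truncated subtraction, and the two signs of n give literally the two exponents that arise at each
-- step of Shanks' sums.
pentagonal : ℤ → ℕ
pentagonal (+ zero)  = 0
pentagonal (+ suc n) = suc n ℕ.* suc n ℕ.+ triangular n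
pentagonal -[1+ n ]  = suc n ℕ.* suc n ℕ.+ triangular (suc n)

2*triangular : ∀ n → + 2 ℤ.* + triangular n ≡ + n ℤ.* (+ 1 ℤ.+ + n)
2*triangular zero    = ≡.refl
2*triangular (suc n) = begin
  + 2 ℤ.* (+ triangular n ℤ.+ (+ 1 ℤ.+ + n))        ≡⟨ ℤₚ.*-distribˡ-+ (+ 2) (+ triangular n) (+ 1 ℤ.+ + n) ⟩
  + 2 ℤ.* + triangular n ℤ.+ + 2 ℤ.* (+ 1 ℤ.+ + n)  ≡⟨ ≡.cong (ℤ._+ + 2 ℤ.* (+ 1 ℤ.+ + n)) (2*triangular n) ⟩
  + n ℤ.* (+ 1 ℤ.+ + n) ℤ.+ + 2 ℤ.* (+ 1 ℤ.+ + n)   ≡⟨ identity (+ n) ⟩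
  (+ 1 ℤ.+ + n) ℤ.* (+ 1 ℤ.+ (+ 1 ℤ.+ + n))         ∎
  where
  open ≡.≡-Reasoning
  identity : ∀ x → x ℤ.* (+ 1 ℤ.+ x) ℤ.+ + 2 ℤ.* (+ 1 ℤ.+ x) ≡ (+ 1 ℤ.+ x) ℤ.* (+ 1 ℤ.+ (+ 1 ℤ.+ x))
  identity = ℤSolver.solve-∀

2*pentagonal : ∀ n → + 2 ℤ.* + pentagonal n ≡ n ℤ.* (+ 3 ℤ.* n ℤ.- + 1)
2*pentagonal (+ zero)  = ≡.refl
2*pentagonal (+ suc n) = begin
  + 2 ℤ.* (+ (suc n ℕ.* suc n) ℤ.+ + triangular n)     ≡⟨ ≡.cong (λ x → + 2 ℤ.* (x ℤ.+ + triangular n)) (ℤₚ.pos-* (suc n) (suc n)) ⟩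
  + 2 ℤ.* (s ℤ.* s ℤ.+ + triangular n)                 ≡⟨ ℤₚ.*-distribˡ-+ (+ 2) (s ℤ.* s) (+ triangular n) ⟩
  + 2 ℤ.* (s ℤ.* s) ℤ.+ + 2 ℤ.* + triangular n         ≡⟨ ≡.cong (ℤ._+_ (+ 2 ℤ.* (s ℤ.* s))) (2*triangular n) ⟩
  + 2 ℤ.* (s ℤ.* s) ℤ.+ + n ℤ.* s                      ≡⟨ identity (+ n) ⟩
  s ℤ.* (+ 3 ℤ.* s ℤ.- + 1)                            ∎
  where
  open ≡.≡-Reasoning
  s = + 1 ℤ.+ + n
  identity : ∀ x → + 2 ℤ.* ((+ 1 ℤ.+ x) ℤ.* (+ 1 ℤ.+ x)) ℤ.+ x ℤ.* (+ 1 ℤ.+ x)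
                   ≡ (+ 1 ℤ.+ x) ℤ.* (+ 3 ℤ.* (+ 1 ℤ.+ x) ℤ.- + 1)
  identity = ℤSolver.solve-∀
2*pentagonal -[1+ n ] = begin
  + 2 ℤ.* (+ (suc n ℕ.* suc n) ℤ.+ + triangular (suc n)) ≡⟨ ≡.cong (λ x → + 2 ℤ.* (x ℤ.+ + triangular (suc n))) (ℤₚ.pos-* (suc n) (suc n)) ⟩
  + 2 ℤ.* (s ℤ.* s ℤ.+ + triangular (suc n))           ≡⟨ ℤₚ.*-distribˡ-+ (+ 2) (s ℤ.* s) (+ triangular (suc n)) ⟩
  + 2 ℤ.* (s ℤ.* s) ℤ.+ + 2 ℤ.* + triangular (suc n)   ≡⟨ ≡.cong (ℤ._+_ (+ 2 ℤ.* (s ℤ.* s))) (2*triangular (suc n)) ⟩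
  + 2 ℤ.* (s ℤ.* s) ℤ.+ s ℤ.* (+ 1 ℤ.+ s)              ≡⟨ identity s ⟩
  ℤ.- s ℤ.* (+ 3 ℤ.* ℤ.- s ℤ.- + 1)                    ∎
  where
  open ≡.≡-Reasoning
  s = + suc n
  identity : ∀ x → + 2 ℤ.* (x ℤ.* x) ℤ.+ x ℤ.* (+ 1 ℤ.+ x) ≡ ℤ.- x ℤ.* (+ 3 ℤ.* ℤ.- x ℤ.- + 1)
  identity = ℤSolver.solve-∀

-- Makes the search finite: every n with p(n) = N lies in `interval N`.
∣n∣≤pentagonal : ∀ n → ℤ.∣ n ∣ ≤ pentagonal n
∣n∣≤pentagonal (+ zero)  = z≤n
∣n∣≤pentagonal (+ suc n) = ℕₚ.≤-trans (ℕₚ.m≤m*n (suc n) (suc n)) (ℕₚ.m≤m+n _ _)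
∣n∣≤pentagonal -[1+ n ]  = ℕₚ.≤-trans (ℕₚ.m≤m*n (suc n) (suc n)) (ℕₚ.m≤m+n _ _)

interval : ℕ → List ℤ
interval zero    = + 0 ∷ []
interval (suc k) = + suc k ∷ -[1+ k ] ∷ interval k

interval-enumerates : ∀ k → Enumerates (λ n → ℤ.∣ n ∣ ≤ k) (interval k)
interval-enumerates k = enumerates (distinct k) (sound k) (complete k)
  where
  sound : ∀ k {n} → n ∈ interval k → ℤ.∣ n ∣ ≤ k
  sound zero    (here ≡.refl)         = z≤n
  sound (suc k) (here ≡.refl)         = ℕₚ.≤-refl
  sound (suc k) (there (here ≡.refl)) = ℕₚ.≤-refl
  sound (suc k) (there (there n∈))    = ℕₚ.m≤n⇒m≤1+n (sound k n∈)

  complete : ∀ k {n} → ℤ.∣ n ∣ ≤ k → n ∈ interval k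
  complete zero    {+ zero} _ = here ≡.refl
  complete (suc k) {n} ∣n∣≤ with ℕₚ.m≤n⇒m<n∨m≡n ∣n∣≤
  ... | inj₁ (s≤s ∣n∣≤k) = there (there (complete k ∣n∣≤k))
  complete (suc k) {+ suc k}    ∣n∣≤ | inj₂ ≡.refl = here ≡.refl
  complete (suc k) { -[1+ k ] } ∣n∣≤ | inj₂ ≡.refl = there (here ≡.refl)

  fresh : ∀ {m} k → k < ℤ.∣ m ∣ → All (λ n → m ≡.≢ n) (interval k)
  fresh k k<∣m∣ = All.tabulate (λ { n∈ ≡.refl → ℕₚ.<⇒≱ k<∣m∣ (sound k n∈) })

  distinct : ∀ k → Unique (interval k)
  distinct zero    = [] ∷ []
  distinct (suc k) = ((λ ()) ∷ fresh k ℕₚ.≤-refl) ∷ fresh k ℕₚ.≤-refl ∷ distinct k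

withPentagonal : ℕ → List ℤ
withPentagonal N = filter (λ n → pentagonal n ℕ.≟ N) (interval N)

withPentagonal-enumerates : ∀ N → Enumerates (λ n → pentagonal n ≡ N) (withPentagonal N)
withPentagonal-enumerates N = enumerates unique (proj₂ ∘ sound)
  (λ { {n} ≡.refl → complete (∣n∣≤pentagonal n , ≡.refl) })
  where open Enumerates (enumerates-filter (λ n → pentagonal n ℕ.≟ N) (interval-enumerates N))

-- Euler's identity through finite sums.

module PentagonalNumberTheorem {c ℓ} (R : CommutativeRing c ℓ) (3≈0 : CharacteristicThree R) where

  open InfiniteProducts R 3≈0 public
  open Sums R public
  open import Relation.Binary.Reasoning.Setoid setoid

  sign : ℕ → R.Carrier
  sign zero    = R.1#
  sign (suc n) = R.- sign n

  signS : ℕ → Series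
  signS zero    = 1#
  signS (suc n) = - signS n

  -- The product of 1 - q^j over s < j ≤ s + d, which is the quotient of `pochhammer (s + d)` by
  -- `pochhammer s` without a division.
  gap : ℕ → ℕ → Series
  gap s zero    = 1#
  gap s (suc d) = gap s d * (1# - X ^ (s ℕ.+ suc d))

  gap≈pochhammer : ∀ n → gap 0 n ≈ pochhammer n
  gap≈pochhammer zero    = refl
  gap≈pochhammer (suc n) = *-congʳ (gap≈pochhammer n)

  gap-left : ∀ s d → gap s (suc d) ≈ (1# - X ^ suc s) * gap (suc s) d
  gap-left s zero    = trans (*-congˡ (+-congˡ (-‿cong (reflexive (≡.cong (X ^_) (ℕₚ.+-comm s 1)))))) (*-comm _ _)
  gap-left s (suc d) = begin
    gap s (suc d) * (1# - X ^ (s ℕ.+ suc (suc d)))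
      ≈⟨ *-cong (gap-left s d) (+-congˡ (-‿cong (reflexive (≡.cong (X ^_) (ℕₚ.+-suc s (suc d)))))) ⟩
    (1# - X ^ suc s) * gap (suc s) d * (1# - X ^ (suc s ℕ.+ suc d))
      ≈⟨ *-assoc _ _ _ ⟩
    (1# - X ^ suc s) * gap (suc s) (suc d) ∎

  -- Shanks' finite form of Euler's identity: the full sum ∑_{s ≤ n} is theta n exactly, and
  -- agrees with its first term ∏_{j ≤ n} (1 - q^j) up to q^n.
  term : ℕ → ℕ → Series
  term n s = signS s * gap s (n ℕ.∸ s) * X ^ (s ℕ.* n ℕ.+ triangular s)

  partial : ℕ → ℕ → Series
  partial n zero    = term n 0
  partial n (suc s) = partial n s + term n (suc s)

  theta : ℕ → Series
  theta zero    = 1#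
  theta (suc n) = theta n + signS (suc n) * (X ^ pentagonal (+ suc n) + X ^ pentagonal -[1+ n ])

  -- Telescoping: the changes of the terms 0, ..., s between consecutive rows collapse to one
  -- product. At d = 0 the gap is empty and this product is one of the two new monomials of `theta`;
  -- the other one is the last term of the new row.
  partial-difference : ∀ s d → partial (suc (s ℕ.+ d)) s ≈
    partial (s ℕ.+ d) s - signS s * gap s d * X ^ (suc s ℕ.* suc (s ℕ.+ d) ℕ.+ triangular s)
  partial-difference zero d = trans
    (*-congʳ (*-congˡ refl))
    (trans (solve 2 (λ g n → con 𝟏 :* (g :* (con 𝟏 :- n)) :* con 𝟏 := con 𝟏 :* g :* con 𝟏 :- con 𝟏 :* g :* n)
             refl (gap 0 d) (X ^ suc d))
           (+-congˡ (-‿cong (*-congˡ (reflexive (≡.cong (X ^_) e))))))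
    where
    e : suc d ≡ 1 ℕ.* suc d ℕ.+ 0
    e = ≡.sym (≡.trans (ℕₚ.+-identityʳ _) (ℕₚ.+-identityʳ _))
  partial-difference (suc s) d = begin
    partial n s + - σ * gap (suc s) (n ℕ.∸ suc s) * X ^ (suc s ℕ.* n ℕ.+ triangular (suc s))
      ≈⟨ +-cong ih (*-cong (*-congˡ (trans (reflexive (≡.cong (gap (suc s)) n∸)) (*-congˡ (+-congˡ (-‿cong
           (reflexive (≡.cong (X ^_) (ℕₚ.+-suc (suc s) d)))))))) E₂) ⟩
    partial m s - σ * ((1# - x) * g) * E + - σ * (g * (1# - N)) * (E * x)
      -- The two products σ x g E cancel. What remains is the next term of row m and the next
      -- remainder.
      ≈⟨ solve 6 (λ p σ x g e n → p :- σ :* ((con 𝟏 :- x) :* g) :* e :+ :- σ :* (g :* (con 𝟏 :- n)) :* (e :* x) :=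
            (p :+ :- σ :* g :* e) :- :- σ :* g :* (n :* (e :* x))) refl (partial m s) σ x g E N ⟩
    (partial m s + - σ * g * E) - - σ * g * (N * (E * x))
      ≈⟨ +-cong (+-congˡ (*-cong (*-congˡ (reflexive (≡.cong (gap (suc s)) (≡.sym (ℕₚ.m+n∸m≡n (suc s) d))))) E₃))
                (-‿cong (*-congˡ E₄)) ⟩
    partial m (suc s) - - σ * g * X ^ (suc (suc s) ℕ.* n ℕ.+ triangular (suc s)) ∎
    where
    m = suc s ℕ.+ d
    n = suc m
    σ = signS s
    g = gap (suc s) d
    x = X ^ suc s
    N = X ^ n
    E = X ^ (suc s ℕ.* n ℕ.+ triangular s)
    n∸ : n ℕ.∸ suc s ≡ suc d
    n∸ = ≡.trans (≡.cong (ℕ._∸ suc s) (≡.sym (ℕₚ.+-suc (suc s) d))) (ℕₚ.m+n∸m≡n (suc s) (suc d))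
    ih : partial n s ≈ partial m s - σ * ((1# - x) * g) * E
    ih = trans (≡.subst (λ k → partial (suc k) s ≈ partial k s - σ * gap s (suc d) * X ^ (suc s ℕ.* suc k ℕ.+ triangular s))
                 (ℕₚ.+-suc s d) (partial-difference s (suc d)))
               (+-congˡ (-‿cong (*-congʳ (*-congˡ (gap-left s d)))))
    E₂ : X ^ (suc s ℕ.* n ℕ.+ triangular (suc s)) ≈ E * x
    E₂ = trans (reflexive (≡.cong (X ^_) (≡.sym (ℕₚ.+-assoc (suc s ℕ.* n) (triangular s) (suc s)))))
               (^-homo-* X (suc s ℕ.* n ℕ.+ triangular s) (suc s))
    e₃ : ∀ s m t → suc s ℕ.* suc m ℕ.+ t ≡ suc s ℕ.* m ℕ.+ (t ℕ.+ suc s)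
    e₃ = ℕSolver.solve-∀
    E₃ : E ≈ X ^ (suc s ℕ.* m ℕ.+ triangular (suc s))
    E₃ = reflexive (≡.cong (X ^_) (e₃ s m (triangular s)))
    E₄ : N * (E * x) ≈ X ^ (suc (suc s) ℕ.* n ℕ.+ triangular (suc s))
    E₄ = trans (*-congˡ (sym E₂)) (trans (sym (^-homo-* X n _))
      (reflexive (≡.cong (X ^_) (≡.sym (ℕₚ.+-assoc n (suc s ℕ.* n) (triangular (suc s)))))))

  partial≈theta : ∀ n → partial n n ≈ theta n
  partial≈theta zero    = solve 0 (con 𝟏 :* con 𝟏 :* con 𝟏 := con 𝟏) refl
  partial≈theta (suc n) = begin
    partial (suc n) n + - σ * gap (suc n) (n ℕ.∸ n) * X ^ (suc n ℕ.* suc n ℕ.+ triangular (suc n))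
      ≈⟨ +-cong difference (*-congʳ (*-congˡ (reflexive (≡.cong (gap (suc n)) (ℕₚ.n∸n≡0 n))))) ⟩
    (partial n n - σ * 1# * X ^ pentagonal (+ suc n)) + - σ * 1# * X ^ pentagonal -[1+ n ]
      ≈⟨ +-congʳ (+-congʳ (partial≈theta n)) ⟩
    (theta n - σ * 1# * X ^ pentagonal (+ suc n)) + - σ * 1# * X ^ pentagonal -[1+ n ]
      ≈⟨ solve 4 (λ p σ a b → (p :- σ :* con 𝟏 :* a) :+ :- σ :* con 𝟏 :* b := p :+ :- σ :* (a :+ b)) refl _ _ _ _ ⟩
    theta (suc n) ∎
    where
    σ = signS n
    difference : partial (suc n) n ≈ partial n n - σ * 1# * X ^ pentagonal (+ suc n)
    difference = ≡.subst (λ k → partial (suc k) n ≈ partial k n - σ * 1# * X ^ (suc n ℕ.* suc k ℕ.+ triangular n))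
      (ℕₚ.+-identityʳ n) (partial-difference n 0)

  -- In row n every term with s ≥ 1 starts at degree s n + s (s + 1) / 2 > n, so through degree n
  -- only the term s = 0 counts.
  theta⟶euler : theta ⟶ euler
  theta⟶euler .agree n k k≤n = R.trans (R.sym (partial≈theta n .at k))
    (R.trans (first-term n) (R.trans (term₀≈ .at k) (pochhammer⟶euler .agree n k k≤n)))
    where
    term₀≈ : term n 0 ≈ pochhammer n
    term₀≈ = trans (solve 1 (λ g → con 𝟏 :* g :* con 𝟏 := g) refl (gap 0 n)) (gap≈pochhammer n)
    first-term : ∀ s → partial n s k R.≈ term n 0 k
    first-term zero    = R.refl
    first-term (suc s) = R.trans (R.+-cong (first-term s) (R.trans
        (*-comm (signS (suc s) * gap (suc s) (n ℕ.∸ suc s)) _ .at k)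
        (X^*-< (suc s ℕ.* n ℕ.+ triangular (suc s)) _ (ℕₚ.≤-<-trans k≤n n<))))
      (R.+-identityʳ _)
      where
      n< : n < suc s ℕ.* n ℕ.+ triangular (suc s)
      n< = ℕₚ.<-≤-trans (ℕₚ.m<m+n n (ℕ.s≤s ℕ.z≤n))
             (ℕₚ.+-mono-≤ (ℕₚ.m≤m+n n (s ℕ.* n)) (ℕₚ.m≤n+m (suc s) (triangular s)))

  sgn : ℤ → R.Carrier
  sgn n = sign ℤ.∣ n ∣

  X^-coefficient : ∀ e k → (X ^ e) k R.≈ indicator (e ℕ.≟ k) R.1#
  X^-coefficient e k with e ℕ.≟ k
  ... | yes ≡.refl = R.trans (R.sym (*-identityʳ (X ^ e) .at e))
    (≡.subst (λ j → (X ^ e * 1#) j R.≈ R.1#) (ℕₚ.+-identityʳ e) (X^*-+ e 1# 0))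
  ... | no e≢k with k ℕ.<? e
  ...   | yes k<e = R.trans (R.sym (*-identityʳ (X ^ e) .at k)) (X^*-< e 1# k<e)
  ...   | no k≮e  = R.trans (R.sym (*-identityʳ (X ^ e) .at k))
    (beyond (k ℕ.∸ e) (ℕₚ.m+[n∸m]≡n (ℕₚ.≮⇒≥ k≮e)))
    where
    beyond : ∀ d → e ℕ.+ d ≡ k → (X ^ e * 1#) k R.≈ R.0#
    beyond zero    e≡k    = contradiction (≡.trans (≡.sym (ℕₚ.+-identityʳ e)) e≡k) e≢k
    beyond (suc d) ≡.refl = X^*-+ e 1# (suc d)

  signS-* : ∀ s f n → (signS s * f) n R.≈ sign s R.* f n
  signS-* zero    f n = C-* R.1# f n
  signS-* (suc s) f n = R.trans (sym (-‿distribˡ-* (signS s) f) .at n)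
    (R.trans (R.-‿cong (signS-* s f n)) (R-‿distribˡ-* (sign s) (f n)))
    where
    open import Algebra.Properties.Ring ring using (-‿distribˡ-*)
    open import Algebra.Properties.Ring R.ring using () renaming (-‿distribˡ-* to R-‿distribˡ-*)

  indicator-* : ∀ {P : Set} (P? : Dec P) a → a R.* indicator P? R.1# R.≈ indicator P? a
  indicator-* (yes _) a = R.*-identityʳ a
  indicator-* (no _)  a = R.zeroʳ a

  theta-coefficient : ∀ n k → theta n k R.≈ ∑ (λ m → indicator (pentagonal m ℕ.≟ k) (sgn m)) (interval n)
  theta-coefficient zero zero    = R.sym (R.+-identityʳ _)
  theta-coefficient zero (suc k) = R.sym (R.+-identityʳ _)
  theta-coefficient (suc n) k = R-Reasoning.begin
    theta n k R.+ (signS (suc n) * (X ^ pentagonal (+ suc n) + X ^ pentagonal -[1+ n ])) k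
      R-Reasoning.≈⟨ R.+-cong (theta-coefficient n k) (signS-* (suc n) _ k) ⟩
    rest R.+ sign (suc n) R.* ((X ^ pentagonal (+ suc n)) k R.+ (X ^ pentagonal -[1+ n ]) k)
      R-Reasoning.≈⟨ R.+-congˡ (R.distribˡ _ _ _) ⟩
    rest R.+ (sign (suc n) R.* (X ^ pentagonal (+ suc n)) k R.+ sign (suc n) R.* (X ^ pentagonal -[1+ n ]) k)
      R-Reasoning.≈⟨ R.+-congˡ (R.+-cong (coefficient (+ suc n)) (coefficient -[1+ n ])) ⟩
    rest R.+ (δ (+ suc n) R.+ δ -[1+ n ])
      R-Reasoning.≈⟨ R.+-comm _ _ ⟩
    δ (+ suc n) R.+ δ -[1+ n ] R.+ rest
      R-Reasoning.≈⟨ R.+-assoc _ _ _ ⟩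
    δ (+ suc n) R.+ (δ -[1+ n ] R.+ rest) R-Reasoning.∎
    where
    import Relation.Binary.Reasoning.Setoid R.setoid as R-Reasoning
    δ : ℤ → R.Carrier
    δ m = indicator (pentagonal m ℕ.≟ k) (sgn m)
    rest = ∑ δ (interval n)
    coefficient : ∀ m → sgn m R.* (X ^ pentagonal m) k R.≈ δ m
    coefficient m = R.trans (R.*-congˡ (X^-coefficient (pentagonal m) k)) (indicator-* (pentagonal m ℕ.≟ k) (sgn m))

  pentagonal-number-theorem : ∀ N → euler N R.≈ ∑ sgn (withPentagonal N)
  pentagonal-number-theorem N = R.trans (R.sym (theta⟶euler .agree N N ℕₚ.≤-refl))
    (R.trans (theta-coefficient N N) (R.sym (∑-filter (λ n → pentagonal n ℕ.≟ N) sgn (interval N))))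

-- Pentagonal numbers modulo 5 and 25.

pentagonal-ℤ : ∀ {n} c N → pentagonal n ≡ c ℕ.+ N ℕ.* 5 → n ℤ.* (+ 3 ℤ.* n ℤ.- + 1) ≡ + 2 ℤ.* (+ c ℤ.+ + N ℤ.* + 5)
pentagonal-ℤ {n} c N eq = ≡.trans (≡.sym (2*pentagonal n))
  (≡.cong (λ x → + 2 ℤ.* x) (≡.trans (≡.cong +_ eq) (≡.cong (λ x → + c ℤ.+ x) (ℤₚ.pos-* N 5))))

-- Residues are read off from 2 p(n) = n (3n - 1), a polynomial in n: replacing n by its remainder r
-- modulo 5 leaves five cases to test.
pentagonal-residue : ∀ n c N → pentagonal n ≡ c ℕ.+ N ℕ.* 5 →
  ∃₂ λ r k → r < 5 × n ≡ + r ℤ.+ k ℤ.* + 5 × + 5 ℤ∣.∣ + 2 ℤ.* + c ℤ.- + r ℤ.* (+ 3 ℤ.* + r ℤ.- + 1)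
pentagonal-residue n c N eq = r , k , n%ℕd<d n 5 , n≡ , ℤ∣.divides q (begin
  + 2 ℤ.* + c ℤ.- + r ℤ.* (+ 3 ℤ.* + r ℤ.- + 1)
    ≡⟨ identity₁ (+ c) (+ r) (+ N) ⟩
  + 2 ℤ.* (+ c ℤ.+ + N ℤ.* + 5) ℤ.- (+ r ℤ.* (+ 3 ℤ.* + r ℤ.- + 1) ℤ.+ + 2 ℤ.* + N ℤ.* + 5)
    ≡⟨ ≡.cong (ℤ._- (+ r ℤ.* (+ 3 ℤ.* + r ℤ.- + 1) ℤ.+ + 2 ℤ.* + N ℤ.* + 5))
         (≡.trans (≡.sym (pentagonal-ℤ {n} c N eq)) (≡.cong (λ n → n ℤ.* (+ 3 ℤ.* n ℤ.- + 1)) n≡)) ⟩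
  (+ r ℤ.+ k ℤ.* + 5) ℤ.* (+ 3 ℤ.* (+ r ℤ.+ k ℤ.* + 5) ℤ.- + 1)
    ℤ.- (+ r ℤ.* (+ 3 ℤ.* + r ℤ.- + 1) ℤ.+ + 2 ℤ.* + N ℤ.* + 5)
    ≡⟨ identity₂ (+ r) k (+ N) ⟩
  q ℤ.* + 5 ∎)
  where
  open ≡.≡-Reasoning
  r = n %ℕ 5
  k = n /ℕ 5
  q = k ℤ.* (+ 6 ℤ.* + r ℤ.- + 1) ℤ.+ + 15 ℤ.* k ℤ.* k ℤ.- + 2 ℤ.* + N
  n≡ : n ≡ + r ℤ.+ k ℤ.* + 5
  n≡ = a≡a%ℕn+[a/ℕn]*n n 5
  identity₁ : ∀ c r N → + 2 ℤ.* c ℤ.- r ℤ.* (+ 3 ℤ.* r ℤ.- + 1)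
    ≡ + 2 ℤ.* (c ℤ.+ N ℤ.* + 5) ℤ.- (r ℤ.* (+ 3 ℤ.* r ℤ.- + 1) ℤ.+ + 2 ℤ.* N ℤ.* + 5)
  identity₁ = ℤSolver.solve-∀
  identity₂ : ∀ r k N → (r ℤ.+ k ℤ.* + 5) ℤ.* (+ 3 ℤ.* (r ℤ.+ k ℤ.* + 5) ℤ.- + 1)
    ℤ.- (r ℤ.* (+ 3 ℤ.* r ℤ.- + 1) ℤ.+ + 2 ℤ.* N ℤ.* + 5)
    ≡ (k ℤ.* (+ 6 ℤ.* r ℤ.- + 1) ℤ.+ + 15 ℤ.* k ℤ.* k ℤ.- + 2 ℤ.* N) ℤ.* + 5
  identity₂ = ℤSolver.solve-∀

-- Modulo 5 the values of r (3r - 1) for r = 0, ..., 4 are 0, 2, 0, 4, 4, so p(n) is 0, 1 or 2. The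
-- numerals tested are the differences 2c - r (3r - 1), here with c = 3.
nonresidue₃ : ∀ r → r < 5 → ¬ + 5 ℤ∣.∣ + 2 ℤ.* + 3 ℤ.- + r ℤ.* (+ 3 ℤ.* + r ℤ.- + 1)
nonresidue₃ 0 _ = from-no (+ 5 ℤ∣.∣? + 6)
nonresidue₃ 1 _ = from-no (+ 5 ℤ∣.∣? + 4)
nonresidue₃ 2 _ = from-no (+ 5 ℤ∣.∣? -[1+ 3 ])
nonresidue₃ 3 _ = from-no (+ 5 ℤ∣.∣? -[1+ 17 ])
nonresidue₃ 4 _ = from-no (+ 5 ℤ∣.∣? -[1+ 37 ])
nonresidue₃ (suc (suc (suc (suc (suc _))))) (s≤s (s≤s (s≤s (s≤s (s≤s ())))))

nonresidue₄ : ∀ r → r < 5 → ¬ + 5 ℤ∣.∣ + 2 ℤ.* + 4 ℤ.- + r ℤ.* (+ 3 ℤ.* + r ℤ.- + 1)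
nonresidue₄ 0 _ = from-no (+ 5 ℤ∣.∣? + 8)
nonresidue₄ 1 _ = from-no (+ 5 ℤ∣.∣? + 6)
nonresidue₄ 2 _ = from-no (+ 5 ℤ∣.∣? -[1+ 1 ])
nonresidue₄ 3 _ = from-no (+ 5 ℤ∣.∣? -[1+ 15 ])
nonresidue₄ 4 _ = from-no (+ 5 ℤ∣.∣? -[1+ 35 ])
nonresidue₄ (suc (suc (suc (suc (suc _))))) (s≤s (s≤s (s≤s (s≤s (s≤s ())))))

residue₁ : ∀ r → r < 5 → + 5 ℤ∣.∣ + 2 ℤ.* + 1 ℤ.- + r ℤ.* (+ 3 ℤ.* + r ℤ.- + 1) → r ≡ 1
residue₁ 0 _ 5∣ = contradiction 5∣ (from-no (+ 5 ℤ∣.∣? + 2))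
residue₁ 1 _ _  = ≡.refl
residue₁ 2 _ 5∣ = contradiction 5∣ (from-no (+ 5 ℤ∣.∣? -[1+ 7 ]))
residue₁ 3 _ 5∣ = contradiction 5∣ (from-no (+ 5 ℤ∣.∣? -[1+ 21 ]))
residue₁ 4 _ 5∣ = contradiction 5∣ (from-no (+ 5 ℤ∣.∣? -[1+ 41 ]))
residue₁ (suc (suc (suc (suc (suc _))))) (s≤s (s≤s (s≤s (s≤s (s≤s ()))))) _

pentagonal≢3 : ∀ n N → pentagonal n ≢ 3 ℕ.+ N ℕ.* 5
pentagonal≢3 n N eq = let r , _ , r<5 , _ , 5∣ = pentagonal-residue n 3 N eq in nonresidue₃ r r<5 5∣

pentagonal≢4 : ∀ n N → pentagonal n ≢ 4 ℕ.+ N ℕ.* 5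
pentagonal≢4 n N eq = let r , _ , r<5 , _ , 5∣ = pentagonal-residue n 4 N eq in nonresidue₄ r r<5 5∣

pentagonal≡1 : ∀ n N → pentagonal n ≡ 1 ℕ.+ N ℕ.* 5 → ∃ λ k → n ≡ + 1 ℤ.- k ℤ.* + 5
pentagonal≡1 n N eq =
  let r , k , r<5 , n≡ , 5∣ = pentagonal-residue n 1 N eq
  in ℤ.- k , ≡.trans n≡ (≡.trans (≡.cong (λ r → + r ℤ.+ k ℤ.* + 5) (residue₁ r r<5 5∣)) (identity k))
  where
  identity : ∀ k → + 1 ℤ.+ k ℤ.* + 5 ≡ + 1 ℤ.- (ℤ.- k) ℤ.* + 5
  identity = ℤSolver.solve-∀

2*-injective : ∀ {a b} → + 2 ℤ.* + a ≡ + 2 ℤ.* + b → a ≡ b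
2*-injective {a} {b} eq = ℤₚ.+-injective (ℤₚ.*-cancelˡ-≡ (+ 2) (+ a) (+ b) eq)

-- For n = 1 - 5k one has 6n - 1 = -5 (6k - 1), so the square 24 p(n) + 1 = (6n - 1)² acquires a
-- factor 25. With 1 + 5k instead, p(-k) would appear in place of p(k).
pentagonal-1-5k : ∀ k → pentagonal (+ 1 ℤ.- k ℤ.* + 5) ≡ 1 ℕ.+ pentagonal k ℕ.* 5 ℕ.* 5
pentagonal-1-5k k = 2*-injective (begin
  + 2 ℤ.* + pentagonal n                                       ≡⟨ 2*pentagonal n ⟩
  n ℤ.* (+ 3 ℤ.* n ℤ.- + 1)                                    ≡⟨ identity k ⟩
  + 2 ℤ.+ k ℤ.* (+ 3 ℤ.* k ℤ.- + 1) ℤ.* + 5 ℤ.* + 5            ≡⟨ ≡.cong (λ x → + 2 ℤ.+ x ℤ.* + 5 ℤ.* + 5) (2*pentagonal k) ⟨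
  + 2 ℤ.+ (+ 2 ℤ.* + pentagonal k) ℤ.* + 5 ℤ.* + 5             ≡⟨ identity′ (+ pentagonal k) ⟩
  + 2 ℤ.* (+ 1 ℤ.+ + pentagonal k ℤ.* + 5 ℤ.* + 5)             ≡⟨ ≡.cong (λ x → + 2 ℤ.* (+ 1 ℤ.+ x ℤ.* + 5)) (ℤₚ.pos-* (pentagonal k) 5) ⟨
  + 2 ℤ.* (+ 1 ℤ.+ + (pentagonal k ℕ.* 5) ℤ.* + 5)             ≡⟨ ≡.cong (λ x → + 2 ℤ.* (+ 1 ℤ.+ x)) (ℤₚ.pos-* (pentagonal k ℕ.* 5) 5) ⟨
  + 2 ℤ.* + (1 ℕ.+ pentagonal k ℕ.* 5 ℕ.* 5)                   ∎)
  where
  open ≡.≡-Reasoning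
  n = + 1 ℤ.- k ℤ.* + 5
  identity : ∀ k → let n = + 1 ℤ.- k ℤ.* + 5 in
    n ℤ.* (+ 3 ℤ.* n ℤ.- + 1) ≡ + 2 ℤ.+ k ℤ.* (+ 3 ℤ.* k ℤ.- + 1) ℤ.* + 5 ℤ.* + 5
  identity = ℤSolver.solve-∀
  identity′ : ∀ p → + 2 ℤ.+ (+ 2 ℤ.* p) ℤ.* + 5 ℤ.* + 5 ≡ + 2 ℤ.* (+ 1 ℤ.+ p ℤ.* + 5 ℤ.* + 5)
  identity′ = ℤSolver.solve-∀

-- Pairs of pentagonal numbers with sum 2 modulo 5.

open import Algebra.Properties.AbelianGroup ℤₚ.+-0-abelianGroup using () renaming (∙-cancelˡ to +-cancelˡ)

-- 24 p(n) + 1 = (6n - 1)², so p(m) + p(n) ≡ 2 (mod 5) says that the norm of (6m - 1) + (6n - 1)i is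
-- divisible by 5; the two lines below are the divisibilities by the Gaussian primes above 5.
OnLine : ℤ → ℤ → Set
OnLine m n = + 5 ℤ∣.∣ m ℤ.- + 2 ℤ.* n ℤ.+ + 1

-- Modulo 5 the product of the two linear forms is 2 (p(m) + p(n)) + 1, which vanishes when the sum
-- is 2; since 5 is prime, it divides one of the forms.
lines-cover : ∀ m n N → pentagonal m ℕ.+ pentagonal n ≡ 2 ℕ.+ N ℕ.* 5 → OnLine m n ⊎ OnLine n m
lines-cover m n N eq = Sum.map ℤ∣.∣ᵤ⇒∣ ℤ∣.∣ᵤ⇒∣ (euclidsLemma ℤ.∣ a ∣ ℤ.∣ b ∣ (from-yes (prime? 5))
  (≡.subst (5 ∣_) (ℤₚ.abs-* a b) (ℤ∣.∣⇒∣ᵤ (ℤ∣.divides q a*b≡))))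
  where
  open ≡.≡-Reasoning
  a = m ℤ.- + 2 ℤ.* n ℤ.+ + 1
  b = n ℤ.- + 2 ℤ.* m ℤ.+ + 1
  q = + 1 ℤ.+ + 2 ℤ.* + N ℤ.- m ℤ.* m ℤ.- n ℤ.* n ℤ.+ m ℤ.* n
  identity₁ : ∀ m n → (m ℤ.- + 2 ℤ.* n ℤ.+ + 1) ℤ.* (n ℤ.- + 2 ℤ.* m ℤ.+ + 1)
    ≡ m ℤ.* (+ 3 ℤ.* m ℤ.- + 1) ℤ.+ n ℤ.* (+ 3 ℤ.* n ℤ.- + 1)
      ℤ.+ (+ 1 ℤ.- + 5 ℤ.* (m ℤ.* m) ℤ.- + 5 ℤ.* (n ℤ.* n) ℤ.+ + 5 ℤ.* (m ℤ.* n))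
  identity₁ = ℤSolver.solve-∀
  identity₂ : ∀ m n N → + 2 ℤ.* (+ 2 ℤ.+ N ℤ.* + 5)
      ℤ.+ (+ 1 ℤ.- + 5 ℤ.* (m ℤ.* m) ℤ.- + 5 ℤ.* (n ℤ.* n) ℤ.+ + 5 ℤ.* (m ℤ.* n))
    ≡ (+ 1 ℤ.+ + 2 ℤ.* N ℤ.- m ℤ.* m ℤ.- n ℤ.* n ℤ.+ m ℤ.* n) ℤ.* + 5
  identity₂ = ℤSolver.solve-∀
  total : m ℤ.* (+ 3 ℤ.* m ℤ.- + 1) ℤ.+ n ℤ.* (+ 3 ℤ.* n ℤ.- + 1) ≡ + 2 ℤ.* (+ 2 ℤ.+ + N ℤ.* + 5)
  total = begin
    m ℤ.* (+ 3 ℤ.* m ℤ.- + 1) ℤ.+ n ℤ.* (+ 3 ℤ.* n ℤ.- + 1)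
      ≡⟨ ≡.cong₂ ℤ._+_ (2*pentagonal m) (2*pentagonal n) ⟨
    + 2 ℤ.* + pentagonal m ℤ.+ + 2 ℤ.* + pentagonal n
      ≡⟨ ℤₚ.*-distribˡ-+ (+ 2) (+ pentagonal m) (+ pentagonal n) ⟨
    + 2 ℤ.* (+ pentagonal m ℤ.+ + pentagonal n)
      ≡⟨ ≡.cong (λ k → + 2 ℤ.* (+ k)) eq ⟩
    + 2 ℤ.* (+ 2 ℤ.+ + (N ℕ.* 5))
      ≡⟨ ≡.cong (λ x → + 2 ℤ.* (+ 2 ℤ.+ x)) (ℤₚ.pos-* N 5) ⟩
    + 2 ℤ.* (+ 2 ℤ.+ + N ℤ.* + 5) ∎
  a*b≡ : a ℤ.* b ≡ q ℤ.* + 5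
  a*b≡ = ≡.trans (identity₁ m n) (≡.trans (≡.cong (λ s → s ℤ.+
    (+ 1 ℤ.- + 5 ℤ.* (m ℤ.* m) ℤ.- + 5 ℤ.* (n ℤ.* n) ℤ.+ + 5 ℤ.* (m ℤ.* n))) total) (identity₂ m n (+ N)))

onLine-1-5k : ∀ k l → OnLine (+ 1 ℤ.- k ℤ.* + 5) (+ 1 ℤ.- l ℤ.* + 5)
onLine-1-5k k l = ℤ∣.divides (+ 2 ℤ.* l ℤ.- k) (identity k l)
  where
  identity : ∀ k l → (+ 1 ℤ.- k ℤ.* + 5) ℤ.- + 2 ℤ.* (+ 1 ℤ.- l ℤ.* + 5) ℤ.+ + 1 ≡ (+ 2 ℤ.* l ℤ.- k) ℤ.* + 5
  identity = ℤSolver.solve-∀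

-- The combination 2 (n - 2m + 1) + 4 (m - 2n + 1) = 6 (1 - n) eliminates m. The two lines therefore
-- meet modulo 5 only in m = n = 1, which are the pairs counted by b².
onBothLines : ∀ {m n} → OnLine m n → OnLine n m → ∃ λ k → n ≡ + 1 ℤ.- k ℤ.* + 5
onBothLines {m} {n} (ℤ∣.divides x ex) (ℤ∣.divides y ey) = k , (begin
  n
    ≡⟨ identity₁ m n ⟩
  + 1 ℤ.- (+ 2 ℤ.* (n ℤ.- + 2 ℤ.* m ℤ.+ + 1) ℤ.+ + 4 ℤ.* (m ℤ.- + 2 ℤ.* n ℤ.+ + 1) ℤ.+ (n ℤ.- + 1) ℤ.* + 5)
    ≡⟨ ≡.cong₂ (λ y x → + 1 ℤ.- (+ 2 ℤ.* y ℤ.+ + 4 ℤ.* x ℤ.+ (n ℤ.- + 1) ℤ.* + 5)) ey ex ⟩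
  + 1 ℤ.- (+ 2 ℤ.* (y ℤ.* + 5) ℤ.+ + 4 ℤ.* (x ℤ.* + 5) ℤ.+ (n ℤ.- + 1) ℤ.* + 5)
    ≡⟨ identity₂ n x y ⟩
  + 1 ℤ.- k ℤ.* + 5 ∎)
  where
  open ≡.≡-Reasoning
  k = + 2 ℤ.* y ℤ.+ + 4 ℤ.* x ℤ.+ (n ℤ.- + 1)
  identity₁ : ∀ m n → n ≡ + 1 ℤ.- (+ 2 ℤ.* (n ℤ.- + 2 ℤ.* m ℤ.+ + 1) ℤ.+ + 4 ℤ.* (m ℤ.- + 2 ℤ.* n ℤ.+ + 1) ℤ.+ (n ℤ.- + 1) ℤ.* + 5)
  identity₁ = ℤSolver.solve-∀
  identity₂ : ∀ n x y → + 1 ℤ.- (+ 2 ℤ.* (y ℤ.* + 5) ℤ.+ + 4 ℤ.* (x ℤ.* + 5) ℤ.+ (n ℤ.- + 1) ℤ.* + 5)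
    ≡ + 1 ℤ.- (+ 2 ℤ.* y ℤ.+ + 4 ℤ.* x ℤ.+ (n ℤ.- + 1)) ℤ.* + 5
  identity₂ = ℤSolver.solve-∀

linePoint : ℤ × ℤ → ℤ × ℤ
linePoint (n , j) = + 2 ℤ.* n ℤ.- + 1 ℤ.+ j ℤ.* + 5 , n

linePoint-injective : ∀ {x y} → linePoint x ≡ linePoint y → x ≡ y
linePoint-injective {n , j} {n′ , j′} eq with ≡.cong (λ (m , n) → n) eq
... | ≡.refl = ≡.cong (n ,_) (ℤₚ.*-cancelʳ-≡ j j′ (+ 5)
  (+-cancelˡ (+ 2 ℤ.* n ℤ.- + 1) (j ℤ.* + 5) (j′ ℤ.* + 5) (≡.cong (λ (m , n) → m) eq)))

onLine-linePoint : ∀ n j → OnLine (+ 2 ℤ.* n ℤ.- + 1 ℤ.+ j ℤ.* + 5) n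
onLine-linePoint n j = ℤ∣.divides j (identity n j)
  where
  identity : ∀ n j → (+ 2 ℤ.* n ℤ.- + 1 ℤ.+ j ℤ.* + 5) ℤ.- + 2 ℤ.* n ℤ.+ + 1 ≡ j ℤ.* + 5
  identity = ℤSolver.solve-∀

onLine⇒linePoint : ∀ {m n} → OnLine m n → ∃ λ j → (m , n) ≡ linePoint (n , j)
onLine⇒linePoint {m} {n} (ℤ∣.divides j eq) = j , ≡.cong (_, n)
  (≡.trans (identity m n) (≡.cong (λ x → + 2 ℤ.* n ℤ.- + 1 ℤ.+ x) eq))
  where
  identity : ∀ m n → m ≡ + 2 ℤ.* n ℤ.- + 1 ℤ.+ (m ℤ.- + 2 ℤ.* n ℤ.+ + 1)
  identity = ℤSolver.solve-∀

-- Along the points of the line with a fixed j, p(m) + p(n) is a quadratic polynomial in n, symmetric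
-- about (1 - 4j)/2.
flip : ℤ × ℤ → ℤ × ℤ
flip (n , j) = + 1 ℤ.- n ℤ.- + 4 ℤ.* j , j

flip-involutive : ∀ x → flip (flip x) ≡ x
flip-involutive (n , j) = ≡.cong (_, j) (identity n j)
  where
  identity : ∀ n j → + 1 ℤ.- (+ 1 ℤ.- n ℤ.- + 4 ℤ.* j) ℤ.- + 4 ℤ.* j ≡ n
  identity = ℤSolver.solve-∀

flip-injective : ∀ {x y} → flip x ≡ flip y → x ≡ y
flip-injective {x} {y} eq = ≡.trans (≡.sym (flip-involutive x)) (≡.trans (≡.cong flip eq) (flip-involutive y))

pentagonalSum : ℤ × ℤ → ℕ
pentagonalSum (m , n) = pentagonal m ℕ.+ pentagonal n

2*pentagonalSum : ∀ m n → + 2 ℤ.* + pentagonalSum (m , n) ≡ m ℤ.* (+ 3 ℤ.* m ℤ.- + 1) ℤ.+ n ℤ.* (+ 3 ℤ.* n ℤ.- + 1)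
2*pentagonalSum m n = ≡.trans (ℤₚ.*-distribˡ-+ (+ 2) (+ pentagonal m) (+ pentagonal n))
  (≡.cong₂ ℤ._+_ (2*pentagonal m) (2*pentagonal n))

pentagonalSum-flip : ∀ x → pentagonalSum (linePoint (flip x)) ≡ pentagonalSum (linePoint x)
pentagonalSum-flip x@(n , j) = 2*-injective
  (≡.trans (2*pentagonalSum (+ 2 ℤ.* (+ 1 ℤ.- n ℤ.- + 4 ℤ.* j) ℤ.- + 1 ℤ.+ j ℤ.* + 5) (+ 1 ℤ.- n ℤ.- + 4 ℤ.* j))
  (≡.trans (identity n j) (≡.sym (2*pentagonalSum (+ 2 ℤ.* n ℤ.- + 1 ℤ.+ j ℤ.* + 5) n))))
  where
  identity : ∀ n j →
    let n′ = + 1 ℤ.- n ℤ.- + 4 ℤ.* j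
        m′ = + 2 ℤ.* n′ ℤ.- + 1 ℤ.+ j ℤ.* + 5
        m  = + 2 ℤ.* n ℤ.- + 1 ℤ.+ j ℤ.* + 5
    in m′ ℤ.* (+ 3 ℤ.* m′ ℤ.- + 1) ℤ.+ n′ ℤ.* (+ 3 ℤ.* n′ ℤ.- + 1)
       ≡ m ℤ.* (+ 3 ℤ.* m ℤ.- + 1) ℤ.+ n ℤ.* (+ 3 ℤ.* n ℤ.- + 1)
  identity = ℤSolver.solve-∀

∣j∣-bound : ∀ n j {M} → pentagonalSum (linePoint (n , j)) ≡ M → ℤ.∣ j ∣ ≤ 3 ℕ.* M ℕ.+ 1
∣j∣-bound n j ≡.refl = begin
  ℤ.∣ j ∣                                         ≤⟨ ℕₚ.m≤m*n ℤ.∣ j ∣ 5 ⟩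
  ℤ.∣ j ∣ ℕ.* 5                                   ≡⟨ ℤₚ.abs-* j (+ 5) ⟨
  ℤ.∣ j ℤ.* + 5 ∣                                 ≡⟨ ≡.cong ℤ.∣_∣ (identity n j) ⟩
  ℤ.∣ m ℤ.- + 2 ℤ.* n ℤ.+ + 1 ∣                   ≤⟨ ℤₚ.∣i+j∣≤∣i∣+∣j∣ (m ℤ.- + 2 ℤ.* n) (+ 1) ⟩
  ℤ.∣ m ℤ.- + 2 ℤ.* n ∣ ℕ.+ 1                     ≤⟨ ℕₚ.+-monoˡ-≤ 1 (ℤₚ.∣i-j∣≤∣i∣+∣j∣ m (+ 2 ℤ.* n)) ⟩
  ℤ.∣ m ∣ ℕ.+ ℤ.∣ + 2 ℤ.* n ∣ ℕ.+ 1               ≡⟨ ≡.cong (λ x → ℤ.∣ m ∣ ℕ.+ x ℕ.+ 1) (ℤₚ.abs-* (+ 2) n) ⟩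
  ℤ.∣ m ∣ ℕ.+ 2 ℕ.* ℤ.∣ n ∣ ℕ.+ 1                 ≤⟨ ℕₚ.+-monoˡ-≤ 1 (ℕₚ.+-mono-≤ m≤ (ℕₚ.*-monoʳ-≤ 2 n≤)) ⟩
  3 ℕ.* M ℕ.+ 1                                   ∎
  where
  open ℕₚ.≤-Reasoning
  m = + 2 ℤ.* n ℤ.- + 1 ℤ.+ j ℤ.* + 5
  M = pentagonalSum (m , n)
  m≤ : ℤ.∣ m ∣ ≤ M
  m≤ = ℕₚ.≤-trans (∣n∣≤pentagonal m) (ℕₚ.m≤m+n _ _)
  n≤ : ℤ.∣ n ∣ ≤ M
  n≤ = ℕₚ.≤-trans (∣n∣≤pentagonal n) (ℕₚ.m≤n+m _ (pentagonal m))
  identity : ∀ n j → j ℤ.* + 5 ≡ (+ 2 ℤ.* n ℤ.- + 1 ℤ.+ j ℤ.* + 5) ℤ.- + 2 ℤ.* n ℤ.+ + 1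
  identity = ℤSolver.solve-∀

onLine? : ∀ m n → Dec (OnLine m n)
onLine? m n = + 5 ℤ∣.∣? (m ℤ.- + 2 ℤ.* n ℤ.+ + 1)

OnLine₁ OnLine₂ : ℤ × ℤ → Set
OnLine₁ (m , n) = OnLine m n
OnLine₂ (m , n) = OnLine n m

onLine₁? : Decidable OnLine₁
onLine₁? (m , n) = onLine? m n

onLine₂? : Decidable OnLine₂
onLine₂? (m , n) = onLine? n m

onBoth? : Decidable (λ x → OnLine₁ x × OnLine₂ x)
onBoth? x = onLine₁? x ×-dec onLine₂? x

pairs₂ : ℕ → List (ℤ × ℤ)
pairs₂ N = convolution withPentagonal withPentagonal (2 ℕ.+ N ℕ.* 5)

pairs₂-enumerates : ∀ N → Enumerates (λ x → pentagonalSum x ≡ 2 ℕ.+ N ℕ.* 5) (pairs₂ N)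
pairs₂-enumerates N = enumerates unique
  (λ {x} x∈ → from {x} (sound x∈)) (λ {x} eq → complete (pentagonal (proj₁ x) , pentagonal (proj₂ x) , eq , ≡.refl , ≡.refl))
  where
  graded : Enumerates (Graded (λ i n → pentagonal n ≡ i) (λ i n → pentagonal n ≡ i) (2 ℕ.+ N ℕ.* 5)) (pairs₂ N)
  graded = enumerates-convolution (λ { ≡.refl ≡.refl → ≡.refl })
    withPentagonal-enumerates withPentagonal-enumerates (2 ℕ.+ N ℕ.* 5)
  open Enumerates graded
  from : ∀ {x} → Graded (λ i n → pentagonal n ≡ i) (λ i n → pentagonal n ≡ i) (2 ℕ.+ N ℕ.* 5) x →
         pentagonalSum x ≡ 2 ℕ.+ N ℕ.* 5
  from (_ , _ , eq , ≡.refl , ≡.refl) = eq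

linePoints : ℕ → List (ℤ × ℤ)
linePoints M = filter (λ x → pentagonalSum (linePoint x) ℕ.≟ M)
  (cartesianProduct (interval M) (interval (3 ℕ.* M ℕ.+ 1)))

linePoints-enumerates : ∀ M → Enumerates (λ x → pentagonalSum (linePoint x) ≡ M) (linePoints M)
linePoints-enumerates M = enumerates unique (proj₂ ∘ sound)
  (λ { {n , j} ≡.refl → complete ((ℕₚ.≤-trans (∣n∣≤pentagonal n) (ℕₚ.m≤n+m _ (pentagonal (proj₁ (linePoint (n , j))))) , ∣j∣-bound n j ≡.refl) , ≡.refl) })
  where
  open Enumerates (enumerates-filter (λ x → pentagonalSum (linePoint x) ℕ.≟ M)
    (enumerates-× (interval-enumerates M) (interval-enumerates (3 ℕ.* M ℕ.+ 1))))

swap-injective : ∀ {x y : ℤ × ℤ} → swap x ≡ swap y → x ≡ y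
swap-injective eq = ≡.cong swap eq

onLine₁-↭ : ∀ N → map linePoint (linePoints (2 ℕ.+ N ℕ.* 5)) ↭ filter onLine₁? (pairs₂ N)
onLine₁-↭ N = enumerates-↭ (enumerates-map linePoint-injective (linePoints-enumerates (2 ℕ.+ N ℕ.* 5)))
  (enumerates-filter onLine₁? (pairs₂-enumerates N))
  (λ { ((n , j) , eq , ≡.refl) → eq , onLine-linePoint n j })
  (λ { {m , n} (eq , on) → let j , x≡ = onLine⇒linePoint on in
       (n , j) , ≡.trans (≡.cong pentagonalSum (≡.sym x≡)) eq , x≡ })

flip-↭ : ∀ M → map flip (linePoints M) ↭ linePoints M
flip-↭ M = enumerates-↭ (enumerates-map flip-injective (linePoints-enumerates M)) (linePoints-enumerates M)
  (λ { (x , eq , ≡.refl) → ≡.trans (pentagonalSum-flip x) eq })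
  (λ {x} eq → flip x , ≡.trans (pentagonalSum-flip x) eq , ≡.sym (flip-involutive x))

onLine₂-↭ : ∀ N → map swap (filter onLine₁? (pairs₂ N)) ↭ filter onLine₂? (pairs₂ N)
onLine₂-↭ N = enumerates-↭
  (enumerates-map swap-injective (enumerates-filter onLine₁? (pairs₂-enumerates N)))
  (enumerates-filter onLine₂? (pairs₂-enumerates N))
  (λ { ((m , n) , (eq , on) , ≡.refl) → ≡.trans (ℕₚ.+-comm (pentagonal n) (pentagonal m)) eq , on })
  (λ { {m , n} (eq , on) → (n , m) , (≡.trans (ℕₚ.+-comm (pentagonal n) (pentagonal m)) eq , on) , ≡.refl })

onBoth-↭ : ∀ N → let section₁ = λ i → withPentagonal (1 ℕ.+ i ℕ.* 5) in
           convolution section₁ section₁ N ↭ filter onBoth? (pairs₂ N)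
onBoth-↭ N = enumerates-↭
  (enumerates-convolution
    (λ { {i} {j} eq eq′ → ℕₚ.*-cancelʳ-≡ i j 5 (ℕₚ.suc-injective (≡.trans (≡.sym eq) eq′)) })
    (λ i → withPentagonal-enumerates (1 ℕ.+ i ℕ.* 5)) (λ i → withPentagonal-enumerates (1 ℕ.+ i ℕ.* 5)) N)
  (enumerates-filter onBoth? (pairs₂-enumerates N))
  (λ {x} → to {x}) (λ {x} → from {x})
  where
  P : ℕ → ℤ → Set
  P i n = pentagonal n ≡ 1 ℕ.+ i ℕ.* 5
  total : ∀ i j → (1 ℕ.+ i ℕ.* 5) ℕ.+ (1 ℕ.+ j ℕ.* 5) ≡ 2 ℕ.+ (i ℕ.+ j) ℕ.* 5
  total = ℕSolver.solve-∀
  to : ∀ {x} → Graded P P N x → pentagonalSum x ≡ 2 ℕ.+ N ℕ.* 5 × OnLine₁ x × OnLine₂ x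
  to {m , n} (i , j , i+j≡N , ei , ej) =
    let k , m≡ = pentagonal≡1 m i ei
        l , n≡ = pentagonal≡1 n j ej
    in ≡.trans (≡.cong₂ ℕ._+_ ei ej) (≡.trans (total i j) (≡.cong (λ N → 2 ℕ.+ N ℕ.* 5) i+j≡N))
     , ≡.subst₂ OnLine (≡.sym m≡) (≡.sym n≡) (onLine-1-5k k l)
     , ≡.subst₂ OnLine (≡.sym n≡) (≡.sym m≡) (onLine-1-5k l k)
  from : ∀ {x} → pentagonalSum x ≡ 2 ℕ.+ N ℕ.* 5 × OnLine₁ x × OnLine₂ x → Graded P P N x
  from {m , n} (eq , on , on′) =
    let l , n≡ = onBothLines {m} {n} on on′
        k , m≡ = onBothLines {n} {m} on′ on
        i = pentagonal k ℕ.* 5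
        j = pentagonal l ℕ.* 5
        pm≡ = ≡.trans (≡.cong pentagonal m≡) (pentagonal-1-5k k)
        pn≡ = ≡.trans (≡.cong pentagonal n≡) (pentagonal-1-5k l)
    in i , j , ℕₚ.*-cancelʳ-≡ (i ℕ.+ j) N 5 (ℕₚ.+-cancelˡ-≡ 2 _ _ (≡.trans (≡.sym (total i j))
         (≡.trans (≡.sym (≡.cong₂ ℕ._+_ pm≡ pn≡)) eq))) , pm≡ , pn≡

section₁-↭ : ∀ M → map (λ k → + 1 ℤ.- k ℤ.* + 5) (withPentagonal M) ↭ withPentagonal (1 ℕ.+ M ℕ.* 5 ℕ.* 5)
section₁-↭ M = enumerates-↭ (enumerates-map injective (withPentagonal-enumerates M))
  (withPentagonal-enumerates (1 ℕ.+ M ℕ.* 5 ℕ.* 5))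
  (λ { (k , ≡.refl , ≡.refl) → pentagonal-1-5k k })
  (λ {n} eq → from eq (pentagonal≡1 n (M ℕ.* 5) eq))
  where
  injective : ∀ {k l} → + 1 ℤ.- k ℤ.* + 5 ≡ + 1 ℤ.- l ℤ.* + 5 → k ≡ l
  injective {k} {l} eq = ℤₚ.*-cancelʳ-≡ k l (+ 5) (ℤₚ.neg-injective (ℤ+-cancelˡ (+ 1) _ _ eq))
    where open import Algebra.Properties.AbelianGroup ℤₚ.+-0-abelianGroup using () renaming (∙-cancelˡ to ℤ+-cancelˡ)
  from : ∀ {n} → pentagonal n ≡ 1 ℕ.+ M ℕ.* 5 ℕ.* 5 → ∃ (λ k → n ≡ + 1 ℤ.- k ℤ.* + 5) →
         ∃ λ k → pentagonal k ≡ M × n ≡ + 1 ℤ.- k ℤ.* + 5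
  from eq (k , n≡) = k , ℕₚ.*-cancelʳ-≡ (pentagonal k) M 5 (ℕₚ.*-cancelʳ-≡ (pentagonal k ℕ.* 5) (M ℕ.* 5) 5
    (ℕₚ.suc-injective (≡.trans (≡.sym (≡.trans (≡.cong pentagonal n≡) (pentagonal-1-5k k))) eq))) , n≡

-- p(1 - 5k) ≡ 1 (mod 25).
pentagonal≢1+5r : ∀ r → 0 < r → r < 5 → ∀ n M → pentagonal n ≢ 1 ℕ.+ (r ℕ.+ M ℕ.* 5) ℕ.* 5
pentagonal≢1+5r r 0<r r<5 n M eq = ℕₚ.<⇒≱ r<5 (∣⇒≤ {{ℕ.>-nonZero 0<r}} (∣m+n∣m⇒∣n 5∣ (n∣m*n M)))
  where
  k  = proj₁ (pentagonal≡1 n (r ℕ.+ M ℕ.* 5) eq)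
  n≡ = proj₂ (pentagonal≡1 n (r ℕ.+ M ℕ.* 5) eq)
  pk*5≡ : pentagonal k ℕ.* 5 ≡ r ℕ.+ M ℕ.* 5
  pk*5≡ = ℕₚ.*-cancelʳ-≡ (pentagonal k ℕ.* 5) (r ℕ.+ M ℕ.* 5) 5
    (ℕₚ.suc-injective (≡.trans (≡.sym (≡.trans (≡.cong pentagonal n≡) (pentagonal-1-5k k))) eq))
  5∣ : 5 ∣ M ℕ.* 5 ℕ.+ r
  5∣ = ≡.subst (5 ∣_) (≡.trans pk*5≡ (ℕₚ.+-comm r (M ℕ.* 5))) (n∣m*n (pentagonal k))

-- The sections of Euler's product.

module EulerSections {c ℓ} (R : CommutativeRing c ℓ) (3≈0 : CharacteristicThree R) where

  open PentagonalNumberTheorem R 3≈0 public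
  open import Relation.Binary.Reasoning.Setoid R.setoid
  private module S = CharacteristicThreeSolver R 3≈0
  open S using () renaming (solve to solveR; _:=_ to _:=R_; _:+_ to _:+R_; _:*_ to _:*R_; :-_ to :-R_; con to conR; 𝟏 to 𝟏R)
  open import Algebra.Properties.Ring R.ring using () renaming (-‿involutive to R-‿involutive)

  sgn-suc : ∀ n → sgn (+ 1 ℤ.+ n) R.≈ R.- sgn n
  sgn-suc (+ n)        = R.refl
  sgn-suc -[1+ zero ]  = R.sym (R-‿involutive R.1#)
  sgn-suc -[1+ suc n ] = R.sym (R-‿involutive (sign (suc n)))

  sign² : ∀ n → sign n R.* sign n R.≈ R.1#
  sign² zero    = R.*-identityˡ R.1#
  sign² (suc n) = R.trans (solveR 1 (λ x → :-R x :*R :-R x :=R x :*R x) R.refl (sign n)) (sign² n)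

  sgn-ℕ+ : ∀ k n → sgn (+ k ℤ.+ n) R.≈ sign k R.* sgn n
  sgn-ℕ+ zero    n = R.trans (R.reflexive (≡.cong sgn (ℤₚ.+-identityˡ n))) (R.sym (R.*-identityˡ _))
  sgn-ℕ+ (suc k) n = begin
    sgn (+ 1 ℤ.+ + k ℤ.+ n)       ≈⟨ R.reflexive (≡.cong sgn (ℤₚ.+-assoc (+ 1) (+ k) n)) ⟩
    sgn (+ 1 ℤ.+ (+ k ℤ.+ n))     ≈⟨ sgn-suc (+ k ℤ.+ n) ⟩
    R.- sgn (+ k ℤ.+ n)           ≈⟨ R.-‿cong (sgn-ℕ+ k n) ⟩
    R.- (sign k R.* sgn n)        ≈⟨ solveR 2 (λ x y → :-R (x :*R y) :=R (:-R x) :*R y) R.refl _ _ ⟩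
    R.- sign k R.* sgn n          ∎

  sgn-+ : ∀ m n → sgn (m ℤ.+ n) R.≈ sgn m R.* sgn n
  sgn-+ (+ k)    n = sgn-ℕ+ k n
  sgn-+ -[1+ k ] n = begin
    sgn m+n                                     ≈⟨ R.*-identityˡ _ ⟨
    R.1# R.* sgn m+n                            ≈⟨ R.*-congʳ (sign² (suc k)) ⟨
    sign (suc k) R.* sign (suc k) R.* sgn m+n   ≈⟨ R.*-assoc _ _ _ ⟩
    sign (suc k) R.* (sign (suc k) R.* sgn m+n) ≈⟨ R.*-congˡ (sgn-ℕ+ (suc k) m+n) ⟨
    sign (suc k) R.* sgn (+ suc k ℤ.+ m+n)      ≈⟨ R.*-congˡ (R.reflexive (≡.cong sgn (identity (+ suc k) n))) ⟩
    sign (suc k) R.* sgn n                      ∎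
    where
    m+n = -[1+ k ] ℤ.+ n
    identity : ∀ x n → x ℤ.+ (ℤ.- x ℤ.+ n) ≡ n
    identity = ℤSolver.solve-∀

  sgn² : ∀ n → sgn n R.* sgn n R.≈ R.1#
  sgn² n = sign² ℤ.∣ n ∣

  sgn-opposite : ∀ n m k → n ℤ.+ m ≡ + 1 ℤ.+ (k ℤ.+ k) → sgn m R.≈ R.- sgn n
  sgn-opposite n m k eq = begin
    sgn m                                     ≈⟨ R.*-identityˡ _ ⟨
    R.1# R.* sgn m                            ≈⟨ R.*-congʳ (sgn² n) ⟨
    sgn n R.* sgn n R.* sgn m                 ≈⟨ R.*-assoc _ _ _ ⟩
    sgn n R.* (sgn n R.* sgn m)               ≈⟨ R.*-congˡ (R.trans (R.sym (sgn-+ n m)) (R.reflexive (≡.cong sgn eq))) ⟩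
    sgn n R.* sgn (+ 1 ℤ.+ (k ℤ.+ k))         ≈⟨ R.*-congˡ (R.trans (sgn-suc (k ℤ.+ k)) (R.-‿cong (R.trans (sgn-+ k k) (sgn² k)))) ⟩
    sgn n R.* R.- R.1#                        ≈⟨ solveR 1 (λ x → x :*R :-R conR 𝟏R :=R :-R x) R.refl (sgn n) ⟩
    R.- sgn n                                 ∎

  weight : ℤ × ℤ → R.Carrier
  weight (m , n) = sgn m R.* sgn n

  -- The four coordinates of a line point and of its reflection add up to 1 - 2j, which is odd.
  weight-flip : ∀ x → weight (linePoint (flip x)) R.≈ R.- weight (linePoint x)
  weight-flip (n , j) = begin
    sgn m′ R.* sgn n′    ≈⟨ sgn-+ m′ n′ ⟨
    sgn (m′ ℤ.+ n′)      ≈⟨ sgn-opposite (m ℤ.+ n) (m′ ℤ.+ n′) (ℤ.- j) (identity n j) ⟩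
    R.- sgn (m ℤ.+ n)    ≈⟨ R.-‿cong (sgn-+ m n) ⟩
    R.- weight (m , n)   ∎
    where
    n′ = + 1 ℤ.- n ℤ.- + 4 ℤ.* j
    m′ = + 2 ℤ.* n′ ℤ.- + 1 ℤ.+ j ℤ.* + 5
    m  = + 2 ℤ.* n ℤ.- + 1 ℤ.+ j ℤ.* + 5
    identity : ∀ n j →
      (+ 2 ℤ.* n ℤ.- + 1 ℤ.+ j ℤ.* + 5 ℤ.+ n)
        ℤ.+ (+ 2 ℤ.* (+ 1 ℤ.- n ℤ.- + 4 ℤ.* j) ℤ.- + 1 ℤ.+ j ℤ.* + 5 ℤ.+ (+ 1 ℤ.- n ℤ.- + 4 ℤ.* j))
      ≡ + 1 ℤ.+ (ℤ.- j ℤ.+ ℤ.- j)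
    identity = ℤSolver.solve-∀

  -- In characteristic 3 one has x = -x - x. A sum that a reflection turns into its own negative
  -- thus vanishes without pairing off its terms.
  x≈-x⇒x≈0 : ∀ {x} → x R.≈ R.- x → x R.≈ R.0#
  x≈-x⇒x≈0 {x} x≈-x = begin
    x               ≈⟨ solveR 1 (λ x → x :=R :-R x :+R :-R x) R.refl x ⟩
    R.- x R.+ R.- x ≈⟨ R.+-congʳ x≈-x ⟨
    x R.+ R.- x     ≈⟨ R.-‿inverseʳ x ⟩
    R.0#            ∎

  ∑-onLine₁ : ∀ N → ∑ weight (filter onLine₁? (pairs₂ N)) R.≈ R.0#
  ∑-onLine₁ N = begin
    ∑ weight (filter onLine₁? (pairs₂ N))    ≈⟨ ∑-↭ weight (onLine₁-↭ N) ⟨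
    ∑ weight (map linePoint Λ)               ≈⟨ R.reflexive (∑-map weight linePoint Λ) ⟩
    ∑ (weight ∘ linePoint) Λ                 ≈⟨ x≈-x⇒x≈0 antisymmetric ⟩
    R.0#                                     ∎
    where
    M = 2 ℕ.+ N ℕ.* 5
    Λ = linePoints M
    antisymmetric : ∑ (weight ∘ linePoint) Λ R.≈ R.- ∑ (weight ∘ linePoint) Λ
    antisymmetric = begin
      ∑ (weight ∘ linePoint) Λ               ≈⟨ ∑-↭ (weight ∘ linePoint) (flip-↭ M) ⟨
      ∑ (weight ∘ linePoint) (map flip Λ)    ≈⟨ R.reflexive (∑-map (weight ∘ linePoint) flip Λ) ⟩
      ∑ (weight ∘ linePoint ∘ flip) Λ        ≈⟨ ∑-cong-∈ Λ (λ {x} _ → weight-flip x) ⟩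
      ∑ (λ x → R.- weight (linePoint x)) Λ   ≈⟨ ∑-neg (weight ∘ linePoint) Λ ⟩
      R.- ∑ (weight ∘ linePoint) Λ           ∎

  ∑-onLine₂ : ∀ N → ∑ weight (filter onLine₂? (pairs₂ N)) R.≈ R.0#
  ∑-onLine₂ N = begin
    ∑ weight (filter onLine₂? (pairs₂ N))              ≈⟨ ∑-↭ weight (onLine₂-↭ N) ⟨
    ∑ weight (map swap (filter onLine₁? (pairs₂ N)))   ≈⟨ R.reflexive (∑-map weight swap (filter onLine₁? (pairs₂ N))) ⟩
    ∑ (weight ∘ swap) (filter onLine₁? (pairs₂ N))     ≈⟨ ∑-cong-∈ (filter onLine₁? (pairs₂ N)) (λ _ → R.*-comm _ _) ⟩
    ∑ weight (filter onLine₁? (pairs₂ N))              ≈⟨ ∑-onLine₁ N ⟩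
    R.0#                                               ∎

  inclusion-exclusion : ∀ {P Q : Set} (P? : Dec P) (Q? : Dec Q) → P ⊎ Q → ∀ a →
    a R.+ indicator (P? ×-dec Q?) a R.≈ indicator P? a R.+ indicator Q? a
  inclusion-exclusion (yes _) (yes _) _ a = R.refl
  inclusion-exclusion (yes _) (no _)  _ a = R.refl
  inclusion-exclusion (no _)  (yes _) _ a = R.+-comm _ _
  inclusion-exclusion (no ¬p) (no ¬q) (inj₁ p) a = contradiction p ¬p
  inclusion-exclusion (no ¬p) (no ¬q) (inj₂ q) a = contradiction q ¬q

  -- Every pair lies on at least one of the two lines, so by inclusion and exclusion the left side
  -- is the sum over one line plus the sum over the other, and the reflection makes both vanish.
  ∑-pairs₂ : ∀ N → ∑ weight (pairs₂ N) R.+ ∑ weight (filter onBoth? (pairs₂ N)) R.≈ R.0#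
  ∑-pairs₂ N = begin
    ∑ weight T R.+ ∑ weight (filter onBoth? T)
      ≈⟨ R.+-congˡ (∑-filter onBoth? weight T) ⟩
    ∑ weight T R.+ ∑ (λ x → indicator (onBoth? x) (weight x)) T
      ≈⟨ ∑-+ weight _ T ⟨
    ∑ (λ x → weight x R.+ indicator (onBoth? x) (weight x)) T
      ≈⟨ ∑-cong-∈ T (λ {x} x∈ → inclusion-exclusion (onLine₁? x) (onLine₂? x)
           (lines-cover (proj₁ x) (proj₂ x) N (Enumerates.sound (pairs₂-enumerates N) x∈)) (weight x)) ⟩
    ∑ (λ x → indicator (onLine₁? x) (weight x) R.+ indicator (onLine₂? x) (weight x)) T
      ≈⟨ ∑-+ _ _ T ⟩
    ∑ (λ x → indicator (onLine₁? x) (weight x)) T R.+ ∑ (λ x → indicator (onLine₂? x) (weight x)) T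
      ≈⟨ R.+-cong (∑-filter onLine₁? weight T) (∑-filter onLine₂? weight T) ⟨
    ∑ weight (filter onLine₁? T) R.+ ∑ weight (filter onLine₂? T)
      ≈⟨ R.+-cong (∑-onLine₁ N) (∑-onLine₂ N) ⟩
    R.0# R.+ R.0#
      ≈⟨ R.+-identityˡ _ ⟩
    R.0# ∎
    where T = pairs₂ N

  -- The section of f² is 2 a c + b², so this is the relation a c = -b² doubled. In terms of pairs,
  -- the added b² is the sum over the intersection of the two lines, by `onBoth-↭`.
  euler² : sec 2 (euler * euler) + sec 1 euler * sec 1 euler ≈ 0#
  euler² .at N = begin
    (euler * euler) (2 ℕ.+ N ℕ.* 5) R.+ (sec 1 euler * sec 1 euler) N
      ≈⟨ R.+-cong
           (*-cong-≤ (2 ℕ.+ N ℕ.* 5) (λ i _ → pentagonal-number-theorem i) (λ i _ → pentagonal-number-theorem i))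
           (*-cong-≤ N (λ i _ → pentagonal-number-theorem (1 ℕ.+ i ℕ.* 5)) (λ i _ → pentagonal-number-theorem (1 ℕ.+ i ℕ.* 5))) ⟩
    (generating sgn withPentagonal * generating sgn withPentagonal) (2 ℕ.+ N ℕ.* 5)
      R.+ (generating sgn section₁ * generating sgn section₁) N
      ≈⟨ R.+-cong (generating-* sgn sgn withPentagonal withPentagonal (2 ℕ.+ N ℕ.* 5)) (generating-* sgn sgn section₁ section₁ N) ⟨
    ∑ weight (pairs₂ N) R.+ ∑ weight (convolution section₁ section₁ N)
      ≈⟨ R.+-congˡ (∑-↭ weight (onBoth-↭ N)) ⟩
    ∑ weight (pairs₂ N) R.+ ∑ weight (filter onBoth? (pairs₂ N))
      ≈⟨ ∑-pairs₂ N ⟩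
    R.0# ∎
    where
    section₁ : ℕ → List ℤ
    section₁ i = withPentagonal (1 ℕ.+ i ℕ.* 5)

  euler-vanishes : ∀ N → (∀ n → pentagonal n ≢ N) → euler N R.≈ R.0#
  euler-vanishes N p≢N = R.trans (pentagonal-number-theorem N) (empty (withPentagonal N)
    (λ {n} n∈ → p≢N n (Enumerates.sound (withPentagonal-enumerates N) n∈)))
    where
    empty : ∀ xs → (∀ {n} → n ∈ xs → ⊥) → ∑ sgn xs R.≈ R.0#
    empty []       _  = R.refl
    empty (x ∷ xs) x∉ = ⊥-elim (x∉ (here ≡.refl))

  sec₃-euler : sec 3 euler ≈ 0#
  sec₃-euler .at N = euler-vanishes (3 ℕ.+ N ℕ.* 5) (λ n → pentagonal≢3 n N)

  sec₄-euler : sec 4 euler ≈ 0#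
  sec₄-euler .at N = euler-vanishes (4 ℕ.+ N ℕ.* 5) (λ n → pentagonal≢4 n N)

  -- The indices n with p(n) = 1 modulo 5 are those of the form 1 - 5k; there p(1 - 5k) = 1 + 25
  -- p(k), and 1 - 5k has the parity opposite to that of k. Hence section 1 is itself supported on
  -- multiples of 5, and is dissected a second time.
  sec₁-euler : sec 1 euler ≈ - dilate 4 euler
  sec₁-euler = sec₁-dissected
    where
    import Relation.Binary.Reasoning.Setoid setoid as ≈-Reasoning
    sec₀₁ : sec 0 (sec 1 euler) ≈ - euler
    sec₀₁ .at M = begin
      euler (1 ℕ.+ M ℕ.* 5 ℕ.* 5)                               ≈⟨ pentagonal-number-theorem (1 ℕ.+ M ℕ.* 5 ℕ.* 5) ⟩
      ∑ sgn (withPentagonal (1 ℕ.+ M ℕ.* 5 ℕ.* 5))              ≈⟨ ∑-↭ sgn (section₁-↭ M) ⟨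
      ∑ sgn (map (λ k → + 1 ℤ.- k ℤ.* + 5) (withPentagonal M))  ≈⟨ R.reflexive (∑-map sgn _ (withPentagonal M)) ⟩
      ∑ (λ k → sgn (+ 1 ℤ.- k ℤ.* + 5)) (withPentagonal M)
        ≈⟨ ∑-cong-∈ (withPentagonal M) (λ {k} _ → sgn-opposite k (+ 1 ℤ.- k ℤ.* + 5) (ℤ.- + 2 ℤ.* k) (identity k)) ⟩
      ∑ (λ k → R.- sgn k) (withPentagonal M)                    ≈⟨ ∑-neg sgn (withPentagonal M) ⟩
      R.- ∑ sgn (withPentagonal M)                              ≈⟨ R.-‿cong (pentagonal-number-theorem M) ⟨
      R.- euler M                                               ∎
      where
      identity : ∀ k → k ℤ.+ (+ 1 ℤ.- k ℤ.* + 5) ≡ + 1 ℤ.+ (ℤ.- + 2 ℤ.* k ℤ.+ ℤ.- + 2 ℤ.* k)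
      identity = ℤSolver.solve-∀
    secᵣ₁ : ∀ r → 0 < r → r < 5 → sec r (sec 1 euler) ≈ 0#
    secᵣ₁ r 0<r r<5 .at M = euler-vanishes (1 ℕ.+ (r ℕ.+ M ℕ.* 5) ℕ.* 5) (λ n → pentagonal≢1+5r r 0<r r<5 n M)
    spreadᵣ : ∀ r → 0 < r → r < 5 → spread 4 r (sec r (sec 1 euler)) ≈ 0#
    spreadᵣ r 0<r r<5 = trans (spread-cong 4 r (secᵣ₁ r 0<r r<5)) (coefficientwise (spread-0 4 r))
    sec₁-dissected : sec 1 euler ≈ - dilate 4 euler
    sec₁-dissected = ≈-Reasoning.begin
      sec 1 euler ≈-Reasoning.≈⟨ dissection (sec 1 euler) ⟩
      _ ≈-Reasoning.≈⟨ +-cong (+-cong (+-cong (+-cong (spread-cong 4 0 sec₀₁)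
          (spreadᵣ 1 (s≤s z≤n) (s≤s (s≤s z≤n))))
          (spreadᵣ 2 (s≤s z≤n) (s≤s (s≤s (s≤s z≤n)))))
          (spreadᵣ 3 (s≤s z≤n) (s≤s (s≤s (s≤s (s≤s z≤n))))))
          (spreadᵣ 4 (s≤s z≤n) (s≤s (s≤s (s≤s (s≤s (s≤s z≤n)))))) ⟩
      dilate 4 (- euler) + 0# + 0# + 0# + 0#
        ≈-Reasoning.≈⟨ solve 1 (λ x → x :+ con 𝟎 :+ con 𝟎 :+ con 𝟎 :+ con 𝟎 := x) refl _ ⟩
      dilate 4 (- euler) ≈-Reasoning.≈⟨ spread-neg 4 0 euler ⟩
      - dilate 4 euler ≈-Reasoning.∎

-- Polymorphic, because multiplication by f is carried out both on the sections of a series and on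
-- the formal polynomials of the solver.
record Quintuple {a} (A : Set a) : Set a where
  constructor quintuple
  field c₀ c₁ c₂ c₃ c₄ : A

-- The sections modulo 5 of (a(q⁵) + q b(q⁵) + q² c(q⁵)) g in terms of the sections of g.
multiplyQuintuple : ∀ {a} {A : Set a} → (A → A → A) → (A → A → A) → A → A → A → A → Quintuple A → Quintuple A
multiplyQuintuple _⊞_ _⊠_ a b c q (quintuple s₀ s₁ s₂ s₃ s₄) = quintuple
  (((a ⊠ s₀) ⊞ (b ⊠ (q ⊠ s₄))) ⊞ (c ⊠ (q ⊠ s₃)))
  (((a ⊠ s₁) ⊞ (b ⊠ s₀)) ⊞ (c ⊠ (q ⊠ s₄)))
  (((a ⊠ s₂) ⊞ (b ⊠ s₁)) ⊞ (c ⊠ s₀))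
  (((a ⊠ s₃) ⊞ (b ⊠ s₂)) ⊞ (c ⊠ s₁))
  (((a ⊠ s₄) ⊞ (b ⊠ s₃)) ⊞ (c ⊠ s₂))

-- The action of `U` modulo 3.

module Recurrence {c ℓ} (R : CommutativeRing c ℓ) (3≈0 : CharacteristicThree R)
             (ζ : CommutativeRing.Carrier R) (Φ₅ζ≈0 : FifthRoot.IsPrimitiveFifthRoot R ζ) where

  open Norms R 3≈0 ζ Φ₅ζ≈0 public
  open EulerSections R 3≈0 using (sec₁-euler; sec₃-euler; sec₄-euler; euler²)
  open import Relation.Binary.Reasoning.Setoid setoid

  -- `A₀`, `A₁`, `A₂` are the a, b, c of the dissection, and `Y` is a⁵ + 11 q b⁵ + q² c⁵ with 11
  -- reduced to -1.
  f f₅ A₀ A₁ A₂ Y : Series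
  f  = euler
  f₅ = dilate 4 euler
  A₀  = sec 0 f
  A₁  = sec 1 f
  A₂  = sec 2 f
  Y  = A₀ ^ 5 - X * A₁ ^ 5 + X ^ 2 * A₂ ^ 5

  spread-zero : ∀ j → spread 4 j 0# ≈ 0#
  spread-zero j .at n = spread-0 4 j n

  f-trinomial : f ≈ dilate 4 A₀ + spread 4 1 A₁ + spread 4 2 A₂
  f-trinomial = begin
    f ≈⟨ dissection f ⟩
    t + spread 4 3 (sec 3 f) + spread 4 4 (sec 4 f)
      ≈⟨ +-cong (+-congˡ (trans (spread-cong 4 3 sec₃-euler) (spread-zero 3)))
                (trans (spread-cong 4 4 sec₄-euler) (spread-zero 4)) ⟩
    t + 0# + 0#
      ≈⟨ solve 1 (λ t → t :+ con 𝟎 :+ con 𝟎 := t) refl t ⟩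
    t ∎
    where t = dilate 4 A₀ + spread 4 1 A₁ + spread 4 2 A₂

  record HasSections (g : Series) (s : Quintuple Series) : Set ℓ where
    constructor hasSections
    open Quintuple s
    field
      h₀ : sec 0 g ≈ c₀
      h₁ : sec 1 g ≈ c₁
      h₂ : sec 2 g ≈ c₂
      h₃ : sec 3 g ≈ c₃
      h₄ : sec 4 g ≈ c₄

  f*-sections : ∀ {g s} → HasSections g s → HasSections (f * g) (multiplyQuintuple _+_ _*_ A₀ A₁ A₂ X s)
  f*-sections {g} {quintuple s₀ s₁ s₂ s₃ s₄} (hasSections h₀ h₁ h₂ h₃ h₄) = hasSections
    (section 0 (s≤s z≤n) h₀ Xg₀ (trans (sec-X-zero (X * g)) (*-congˡ (trans (sec-X-suc 3 g) h₃))))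
    (section 1 (s≤s (s≤s z≤n)) h₁ (trans (sec-X-suc 0 g) h₀) (trans (sec-X-suc 0 (X * g)) Xg₀))
    (section 2 (s≤s (s≤s (s≤s z≤n))) h₂ (trans (sec-X-suc 1 g) h₁)
      (trans (sec-X-suc 1 (X * g)) (trans (sec-X-suc 0 g) h₀)))
    (section 3 (s≤s (s≤s (s≤s (s≤s z≤n)))) h₃ (trans (sec-X-suc 2 g) h₂)
      (trans (sec-X-suc 2 (X * g)) (trans (sec-X-suc 1 g) h₁)))
    (section 4 (s≤s (s≤s (s≤s (s≤s (s≤s z≤n))))) h₄ (trans (sec-X-suc 3 g) h₃)
      (trans (sec-X-suc 3 (X * g)) (trans (sec-X-suc 2 g) h₂)))
    where
    Xg₀ : sec 0 (X * g) ≈ X * s₄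
    Xg₀ = trans (sec-X-zero g) (*-congˡ h₄)
    f*g : f * g ≈ dilate 4 A₀ * g + dilate 4 A₁ * (X * g) + dilate 4 A₂ * (X * (X * g))
    f*g = trans (*-congʳ (trans f-trinomial (+-cong (+-congˡ (spread-X^ 4 1 A₁)) (spread-X^ 4 2 A₂))))
      (solve 5 (λ a b d q g → (a :+ q :^ 1 :* b :+ q :^ 2 :* d) :* g :=
        a :* g :+ b :* (q :* g) :+ d :* (q :* (q :* g))) refl (dilate 4 A₀) (dilate 4 A₁) (dilate 4 A₂) X g)
    section : ∀ r → r < 5 → ∀ {x y z} → sec r g ≈ x → sec r (X * g) ≈ y → sec r (X * (X * g)) ≈ z →
              sec r (f * g) ≈ A₀ * x + A₁ * y + A₂ * z
    section r r<5 {x} {y} {z} ex ey ez = begin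
      sec r (f * g) ≈⟨ sec-cong r f*g ⟩
      sec r (dilate 4 A₀ * g) + sec r (dilate 4 A₁ * (X * g)) + sec r (dilate 4 A₂ * (X * (X * g)))
        ≈⟨ +-cong (+-cong (sec-dilate-* r r<5 A₀ g) (sec-dilate-* r r<5 A₁ (X * g))) (sec-dilate-* r r<5 A₂ (X * (X * g))) ⟩
      A₀ * sec r g + A₁ * sec r (X * g) + A₂ * sec r (X * (X * g))
        ≈⟨ +-cong (+-cong (*-congˡ ex) (*-congˡ ey)) (*-congˡ ez) ⟩
      A₀ * x + A₁ * y + A₂ * z ∎

  1-sections : HasSections 1# (quintuple 1# 0# 0# 0# 0#)
  1-sections = hasSections (coefficientwise sec₀) (coefficientwise λ _ → R.refl) (coefficientwise λ _ → R.refl)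
    (coefficientwise λ _ → R.refl) (coefficientwise λ _ → R.refl)
    where
    sec₀ : ∀ n → sec 0 1# n R.≈ 1# n
    sec₀ zero    = R.refl
    sec₀ (suc n) = R.refl

  f-sections : HasSections f (quintuple A₀ A₁ A₂ 0# 0#)
  f-sections = hasSections refl refl refl sec₃-euler sec₄-euler

  A₁²+A₀A₂≈0 : A₁ ^ 2 + A₀ * A₂ ≈ 0#
  A₁²+A₀A₂≈0 = begin
    A₁ ^ 2 + A₀ * A₂
      -- `euler²` will give 2 A₀ A₂ + 2 A₁² = 0, and 2 = -1.
      ≈⟨ solve 3 (λ a b d → b :^ 2 :+ a :* d := :- (a :* d :+ b :* b :+ d :* a :+ b :* b)) refl A₀ A₁ A₂ ⟩
    - (A₀ * A₂ + A₁ * A₁ + A₂ * A₀ + A₁ * A₁)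
      ≈⟨ -‿cong (+-congʳ (HasSections.h₂ (f*-sections f-sections))) ⟨
    - (sec 2 (f * f) + A₁ * A₁)
      ≈⟨ -‿cong euler² ⟩
    - 0#
      ≈⟨ solve 0 (:- con 𝟎 := con 𝟎) refl ⟩
    0# ∎

  conjugate-trinomial : ∀ i a b d →
    conjugate i (dilate 4 a + spread 4 1 b + spread 4 2 d) ≈
    dilate 4 a + w ^ i * spread 4 1 b + (w ^ i) ^ 2 * spread 4 2 d
  conjugate-trinomial i a b d = begin
    twist z (dilate 4 a + spread 4 1 b + spread 4 2 d)
      ≈⟨ trans (twist-+ z _ _) (+-congʳ (twist-+ z _ _)) ⟩
    twist z (dilate 4 a) + twist z (spread 4 1 b) + twist z (spread 4 2 d)
      ≈⟨ +-cong (+-cong (section 0 a) (section 1 b)) (section 2 d) ⟩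
    (w ^ i) ^ 0 * dilate 4 a + (w ^ i) ^ 1 * spread 4 1 b + (w ^ i) ^ 2 * spread 4 2 d
      ≈⟨ +-congʳ (+-cong (*-identityˡ _) (*-congʳ (*-identityʳ _))) ⟩
    dilate 4 a + w ^ i * spread 4 1 b + (w ^ i) ^ 2 * spread 4 2 d ∎
    where
    z = ζ ^R i
    z^5≈1 : z ^R 5 R.≈ R.1#
    z^5≈1 = C≈ .at 0
      where
      C≈ : C (z ^R 5) ≈ 1#
      C≈ = begin
        C (z ^R 5)     ≈⟨ C-homo-^ z 5 ⟩
        C z ^ 5        ≈⟨ ^-congˡ 5 (C-homo-^ ζ i) ⟩
        (w ^ i) ^ 5    ≈⟨ ^-assocʳ w i 5 ⟩
        w ^ (i ℕ.* 5)  ≈⟨ reflexive (≡.cong (w ^_) (ℕₚ.*-comm i 5)) ⟩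
        w ^ (5 ℕ.* i)  ≈⟨ ^-assocʳ w 5 i ⟨
        (w ^ 5) ^ i    ≈⟨ ^-congˡ i w^5≈1 ⟩
        1# ^ i         ≈⟨ 1^n≈1 i ⟩
        1#             ∎
    section : ∀ j g → twist z (spread 4 j g) ≈ (w ^ i) ^ j * spread 4 j g
    section j g = trans (twist-spread 4 z^5≈1 j g)
      (*-congʳ (trans (C-homo-^ z j) (^-congˡ j (C-homo-^ ζ i))))

  -- Over the integers the relation b² = -a d gives a⁵ + 11 b⁵ + d⁵. The factors for i and 5 - i are
  -- paired, so that w enters only through s = w + w⁴ and t = w² + w³.
  trinomial-product : ∀ a b d → b ^ 2 + a * d ≈ 0# →
    (a + b + d) * (a + w ^ 1 * b + (w ^ 1) ^ 2 * d) * (a + w ^ 2 * b + (w ^ 2) ^ 2 * d)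
      * (a + w ^ 3 * b + (w ^ 3) ^ 2 * d) * (a + w ^ 4 * b + (w ^ 4) ^ 2 * d) ≈ a ^ 5 - b ^ 5 + d ^ 5
  trinomial-product a b d b²+ad≈0 = begin
    (a + b + d) * (a + w ^ 1 * b + (w ^ 1) ^ 2 * d) * (a + w ^ 2 * b + (w ^ 2) ^ 2 * d)
      * (a + w ^ 3 * b + (w ^ 3) ^ 2 * d) * (a + w ^ 4 * b + (w ^ 4) ^ 2 * d)
      ≈⟨ solve 5 (λ x₀ x₁ x₂ x₃ x₄ → x₀ :* x₁ :* x₂ :* x₃ :* x₄ := x₀ :* ((x₁ :* x₄) :* (x₂ :* x₃))) refl _ _ _ _ _ ⟩
    (a + b + d) * (((a + w ^ 1 * b + (w ^ 1) ^ 2 * d) * (a + w ^ 4 * b + (w ^ 4) ^ 2 * d))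
      * ((a + w ^ 2 * b + (w ^ 2) ^ 2 * d) * (a + w ^ 3 * b + (w ^ 3) ^ 2 * d)))
      ≈⟨ *-congˡ (*-cong
           (modulo w^5-1≈0 _ (solve 4 (λ a b d w →
             (a :+ w :^ 1 :* b :+ (w :^ 1) :^ 2 :* d) :* (a :+ w :^ 4 :* b :+ (w :^ 4) :^ 2 :* d) :=
             (a :^ 2 :+ b :^ 2 :+ d :^ 2) :+ (w :+ w :^ 4) :* (a :* b :+ b :* d) :+ (w :^ 2 :+ w :^ 3) :* (a :* d)
             :+ (w :^ 5 :- con 𝟏) :* (w :^ 3 :* (a :* d) :+ b :^ 2 :+ (w :^ 4 :+ w) :* (b :* d) :+ (w :^ 5 :+ con 𝟏) :* d :^ 2))
             refl a b d w))
           (modulo w^5-1≈0 _ (solve 4 (λ a b d w →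
             (a :+ w :^ 2 :* b :+ (w :^ 2) :^ 2 :* d) :* (a :+ w :^ 3 :* b :+ (w :^ 3) :^ 2 :* d) :=
             (a :^ 2 :+ b :^ 2 :+ d :^ 2) :+ (w :^ 2 :+ w :^ 3) :* (a :* b :+ b :* d) :+ (w :+ w :^ 4) :* (a :* d)
             :+ (w :^ 5 :- con 𝟏) :* (w :* (a :* d) :+ b :^ 2 :+ (w :^ 3 :+ w :^ 2) :* (b :* d) :+ (w :^ 5 :+ con 𝟏) :* d :^ 2))
             refl a b d w))) ⟩
    (a + b + d) * ((u + (w + w ^ 4) * v + (w ^ 2 + w ^ 3) * y) * (u + (w ^ 2 + w ^ 3) * v + (w + w ^ 4) * y))
      -- Both s + t and s t are -1, so s² + t² = 3 and the term in v y disappears; `k` is the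
      -- quotient of s t + 1 by Φ₅(w).
      ≈⟨ *-congˡ (modulo Φ₅w≈0 _ (solve 4 (λ u v y w → let k = con 𝟏 :+ w :^ 3 :- w in
             (u :+ (w :+ w :^ 4) :* v :+ (w :^ 2 :+ w :^ 3) :* y) :* (u :+ (w :^ 2 :+ w :^ 3) :* v :+ (w :+ w :^ 4) :* y) :=
             u :^ 2 :- u :* v :- u :* y :- v :^ 2 :- y :^ 2
             :+ :Φ₅ w :* (u :* v :+ u :* y :+ (v :^ 2 :+ y :^ 2) :* k :+ v :* y :* (:Φ₅ w :+ con 𝟏 :+ k)))
             refl u v y w)) ⟩
    (a + b + d) * (u ^ 2 - u * v - u * y - v ^ 2 - y ^ 2)
      ≈⟨ modulo b²+ad≈0 _ (solve 3 (λ a b d →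
           let u = a :^ 2 :+ b :^ 2 :+ d :^ 2
               v = a :* b :+ b :* d
               y = a :* d
           in (a :+ b :+ d) :* (u :^ 2 :- u :* v :- u :* y :- v :^ 2 :- y :^ 2) :=
              a :^ 5 :- b :^ 5 :+ d :^ 5 :+ (b :^ 2 :+ a :* d) :* (:- (a :* b :* d) :- b :^ 3)) refl a b d) ⟩
    a ^ 5 - b ^ 5 + d ^ 5 ∎
    where
    u = a ^ 2 + b ^ 2 + d ^ 2
    v = a * b + b * d
    y = a * d
    w^5-1≈0 : w ^ 5 - 1# ≈ 0#
    w^5-1≈0 = trans (+-congʳ w^5≈1) (-‿inverseʳ 1#)

  -- The product is taken at a(q⁵), q b(q⁵), q² c(q⁵). The relation b² + a c = 0 only acquires a
  -- factor q² there, and the result contains q only through q⁵.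
  norm-f : norm f ≈ dilate 4 Y
  norm-f = begin
    norm f      ≈⟨ norm-cong f-trinomial ⟩
    norm (a + b + d)
      ≈⟨ *-cong₅ refl (conjugate-trinomial 1 A₀ A₁ A₂) (conjugate-trinomial 2 A₀ A₁ A₂)
                      (conjugate-trinomial 3 A₀ A₁ A₂) (conjugate-trinomial 4 A₀ A₁ A₂) ⟩
    _           ≈⟨ trinomial-product a b d b²+ad≈0 ⟩
    a ^ 5 - b ^ 5 + d ^ 5
      ≈⟨ +-cong (+-congˡ (-‿cong (^-congˡ 5 b≈))) (^-congˡ 5 d≈) ⟩
    a ^ 5 - (X * dilate 4 A₁) ^ 5 + (X ^ 2 * dilate 4 A₂) ^ 5
      ≈⟨ solve 4 (λ q a b d → a :^ 5 :- (q :* b) :^ 5 :+ (q :^ 2 :* d) :^ 5 :=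
                    a :^ 5 :- q :^ 5 :* b :^ 5 :+ (q :^ 5) :^ 2 :* d :^ 5) refl X a (dilate 4 A₁) (dilate 4 A₂) ⟩
    a ^ 5 - X ^ 5 * dilate 4 A₁ ^ 5 + (X ^ 5) ^ 2 * dilate 4 A₂ ^ 5
      ≈⟨ +-cong (+-cong (dilate-^ 4 A₀ 5) (-‿cong (*-cong (dilate-X 4) (dilate-^ 4 A₁ 5))))
                (*-cong (^-congˡ 2 (dilate-X 4)) (dilate-^ 4 A₂ 5)) ⟨
    dilate 4 (A₀ ^ 5) - dilate 4 X * dilate 4 (A₁ ^ 5) + dilate 4 X ^ 2 * dilate 4 (A₂ ^ 5)
      ≈⟨ +-cong (+-congˡ (-‿cong (spread-* 4 0 X (A₁ ^ 5))))
                (trans (spread-* 4 0 (X ^ 2) (A₂ ^ 5)) (*-congʳ (dilate-^ 4 X 2))) ⟨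
    dilate 4 (A₀ ^ 5) - dilate 4 (X * A₁ ^ 5) + dilate 4 (X ^ 2 * A₂ ^ 5)
      ≈⟨ +-congʳ (trans (spread-+ 4 0 _ _) (+-congˡ (spread-neg 4 0 _))) ⟨
    dilate 4 (A₀ ^ 5 - X * A₁ ^ 5) + dilate 4 (X ^ 2 * A₂ ^ 5)
      ≈⟨ spread-+ 4 0 _ _ ⟨
    dilate 4 Y ∎
    where
    a = dilate 4 A₀
    b = spread 4 1 A₁
    d = spread 4 2 A₂
    b≈ : b ≈ X * dilate 4 A₁
    b≈ = trans (spread-X^ 4 1 A₁) (*-congʳ (*-identityʳ X))
    d≈ : d ≈ X ^ 2 * dilate 4 A₂
    d≈ = spread-X^ 4 2 A₂
    b²+ad≈0 : b ^ 2 + a * d ≈ 0#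
    b²+ad≈0 = begin
      b ^ 2 + a * d
        ≈⟨ +-cong (^-congˡ 2 b≈) (*-congˡ d≈) ⟩
      (X * dilate 4 A₁) ^ 2 + a * (X ^ 2 * dilate 4 A₂)
        ≈⟨ solve 4 (λ q a b d → (q :* b) :^ 2 :+ a :* (q :^ 2 :* d) := q :^ 2 :* (b :^ 2 :+ a :* d)) refl X a _ _ ⟩
      X ^ 2 * (dilate 4 A₁ ^ 2 + a * dilate 4 A₂)
        ≈⟨ *-congˡ (+-cong (dilate-^ 4 A₁ 2) (spread-* 4 0 A₀ A₂)) ⟨
      X ^ 2 * (dilate 4 (A₁ ^ 2) + dilate 4 (A₀ * A₂))
        ≈⟨ *-congˡ (spread-+ 4 0 _ _) ⟨
      X ^ 2 * dilate 4 (A₁ ^ 2 + A₀ * A₂)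
        ≈⟨ *-congˡ (trans (spread-cong 4 0 A₁²+A₀A₂≈0) (spread-zero 0)) ⟩
      X ^ 2 * 0#
        ≈⟨ zeroʳ _ ⟩
      0# ∎

  dilate-injective : ∀ {g h} → dilate 4 g ≈ dilate 4 h → g ≈ h
  dilate-injective {g} {h} eq = begin
    g                       ≈⟨ sec₀-dilate g ⟨
    sec 0 (dilate 4 g)      ≈⟨ sec-cong 0 eq ⟩
    sec 0 (dilate 4 h)      ≈⟨ sec₀-dilate h ⟩
    h                       ∎
    where
    sec₀-1 : sec 0 1# ≈ 1#
    sec₀-1 .at zero    = R.refl
    sec₀-1 .at (suc n) = R.refl
    sec₀-dilate : ∀ g → sec 0 (dilate 4 g) ≈ g
    sec₀-dilate g = begin
      sec 0 (dilate 4 g)       ≈⟨ sec-cong 0 (*-identityʳ _) ⟨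
      sec 0 (dilate 4 g * 1#)  ≈⟨ sec-dilate-* 0 (s≤s z≤n) g 1# ⟩
      g * sec 0 1#             ≈⟨ trans (*-congˡ sec₀-1) (*-identityʳ g) ⟩
      g                        ∎

  -- The norm of f is computed in two ways, from the dissection (`norm-f`) and from the product
  -- (`norm-euler`); then q⁵ is replaced by q.
  Y*f₅≈f⁶ : Y * f₅ ≈ f ^ 6
  Y*f₅≈f⁶ = dilate-injective (begin
    dilate 4 (Y * f₅)            ≈⟨ spread-* 4 0 Y f₅ ⟩
    dilate 4 Y * dilate 4 f₅     ≈⟨ *-congʳ norm-f ⟨
    norm f * dilate 4 f₅         ≈⟨ norm-euler ⟩
    f₅ * f₅ ^ 5                  ≈⟨ dilate-^ 4 f 6 ⟨
    dilate 4 (f ^ 6)             ∎)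

  sec₂-f⁷ : sec 2 (f ^ 7) ≈ - (f₅ * f ^ 6) - X * f₅ ^ 7
  sec₂-f⁷ = begin
    sec 2 (f ^ 7)
      ≈⟨ HasSections.h₂ (f*-sections (f*-sections (f*-sections (f*-sections (f*-sections
           (f*-sections (f*-sections 1-sections))))))) ⟩
    -- The seven multiplications by a + q b + q² c are run on formal polynomials. Modulo 3 and a c =
    -- -b² the section collapses to -b² Y + q b⁷, where b = -f₅ and the norm identity then apply.
    _ ≈⟨ modulo A₁²+A₀A₂≈0 _ (solve 4 (λ a b d q →
           let step = multiplyQuintuple _:+_ _:*_ a b d q
           in Quintuple.c₂ (step (step (step (step (step (step (step
                (quintuple (con 𝟏) (con 𝟎) (con 𝟎) (con 𝟎) (con 𝟎))))))))) :=
              (:- (b :^ 2 :* (a :^ 5 :- q :* b :^ 5 :+ q :^ 2 :* d :^ 5)) :+ q :* b :^ 7)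
              :+ (b :^ 2 :+ a :* d) :* (a :^ 5 :- a :^ 2 :* b :* d :^ 2 :* q :+ a :* b :^ 3 :* d :* q
                   :- b :^ 5 :* q :+ d :^ 5 :* q :^ 2)) refl A₀ A₁ A₂ X) ⟩
    - (A₁ ^ 2 * Y) + X * A₁ ^ 7
      ≈⟨ +-cong (-‿cong (*-congʳ (^-congˡ 2 sec₁-euler))) (*-congˡ (^-congˡ 7 sec₁-euler)) ⟩
    - ((- f₅) ^ 2 * Y) + X * (- f₅) ^ 7
      ≈⟨ solve 3 (λ f y q → :- ((:- f) :^ 2 :* y) :+ q :* (:- f) :^ 7 :=
                    :- (f :* (y :* f)) :- q :* f :^ 7) refl f₅ Y X ⟩
    - (f₅ * (Y * f₅)) - X * f₅ ^ 7
      ≈⟨ +-congʳ (-‿cong (*-congˡ Y*f₅≈f⁶)) ⟩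
    - (f₅ * f ^ 6) - X * f₅ ^ 7 ∎

  U : Series → Series
  U = sec 2

  -- Opaque, because comparing F or G at an argument such as 2 + (2 + n * 5) * 5 would otherwise unfold
  -- the Cauchy products into a sum of that many terms.
  opaque
    F G : Series
    F = f ^ 7 * f₅
    G = X * f * f₅ ^ 7

    F-def : F ≈ f ^ 7 * f₅
    F-def = refl

    UF≈-F-G : U F ≈ - F - G
    UF≈-F-G = begin
      sec 2 (f ^ 7 * f₅)  ≈⟨ sec-cong 2 (*-comm (f ^ 7) f₅) ⟩
      sec 2 (f₅ * f ^ 7)  ≈⟨ sec-dilate-* 2 (s≤s (s≤s (s≤s z≤n))) f (f ^ 7) ⟩
      f * sec 2 (f ^ 7)   ≈⟨ *-congˡ sec₂-f⁷ ⟩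
      f * (- (f₅ * f ^ 6) - X * f₅ ^ 7)
        ≈⟨ solve 3 (λ f g q → f :* (:- (g :* f :^ 6) :- q :* g :^ 7) := :- (f :^ 7 :* g) :- q :* f :* g :^ 7)
             refl f f₅ X ⟩
      - F - G ∎

    -- The factor f₅⁷ is a series in q⁵ and comes out as f⁷. What remains are the sections of q f,
    -- those of f moved by one place: section 1 of f governs `U G`, and the vanishing sections 3 and
    -- 4 of f become sections 4 and 0 of `G`.
    sec-G : ∀ r → r < 5 → sec r G ≈ f ^ 7 * sec r (X * f)
    sec-G r r<5 = begin
      sec r (X * f * f₅ ^ 7)               ≈⟨ sec-cong r (*-comm _ _) ⟩
      sec r (f₅ ^ 7 * (X * f))             ≈⟨ sec-cong r (*-congʳ (dilate-^ 4 f 7)) ⟨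
      sec r (dilate 4 (f ^ 7) * (X * f))   ≈⟨ sec-dilate-* r r<5 (f ^ 7) (X * f) ⟩
      f ^ 7 * sec r (X * f)                ∎

    UG≈-F : U G ≈ - F
    UG≈-F = begin
      sec 2 G                 ≈⟨ sec-G 2 (s≤s (s≤s (s≤s z≤n))) ⟩
      f ^ 7 * sec 2 (X * f)   ≈⟨ *-congˡ (trans (sec-X-suc 1 f) sec₁-euler) ⟩
      f ^ 7 * - f₅            ≈⟨ solve 2 (λ x y → x :* :- y := :- (x :* y)) refl (f ^ 7) f₅ ⟩
      - F                     ∎

  sec₄-G : sec 4 G ≈ 0#
  sec₄-G = begin
    sec 4 G                 ≈⟨ sec-G 4 ℕₚ.≤-refl ⟩
    f ^ 7 * sec 4 (X * f)   ≈⟨ *-congˡ (trans (sec-X-suc 3 f) sec₃-euler) ⟩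
    f ^ 7 * 0#              ≈⟨ zeroʳ _ ⟩
    0#                      ∎

  sec₀-G : sec 0 G ≈ 0#
  sec₀-G = begin
    sec 0 G                 ≈⟨ sec-G 0 (s≤s z≤n) ⟩
    f ^ 7 * sec 0 (X * f)   ≈⟨ *-congˡ (trans (sec-X-zero f) (*-congˡ sec₄-euler)) ⟩
    f ^ 7 * (X * 0#)        ≈⟨ trans (*-congˡ (zeroʳ _)) (zeroʳ _) ⟩
    0#                      ∎

  U²F : U (U F) ≈ - F + G
  U²F = begin
    U (U F)             ≈⟨ sec-cong 2 UF≈-F-G ⟩
    - U F - U G         ≈⟨ +-cong (-‿cong UF≈-F-G) (-‿cong UG≈-F) ⟩
    - (- F - G) - (- F) ≈⟨ solve 2 (λ f g → :- (:- f :- g) :- (:- f) := :- f :+ g) refl F G ⟩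
    - F + G             ∎

  U³F : U (U (U F)) ≈ G
  U³F = begin
    U (U (U F))         ≈⟨ sec-cong 2 U²F ⟩
    - U F + U G         ≈⟨ +-cong (-‿cong UF≈-F-G) UG≈-F ⟩
    - (- F - G) - F     ≈⟨ solve 2 (λ f g → :- (:- f :- g) :- f := g) refl F G ⟩
    G                   ∎

  U⁴F : U (U (U (U F))) ≈ F + F
  U⁴F = begin
    U (U (U (U F)))     ≈⟨ sec-cong 2 U³F ⟩
    U G                 ≈⟨ UG≈-F ⟩
    - F                 ≈⟨ solve 1 (λ f → :- f := f :+ f) refl F ⟩
    F + F               ∎

-- Generating functions of regular partitions.

PartsAtMost : (l k n : ℕ) → List ℕ → Set
PartsAtMost l k n α = (IsPartition α × IsRegular l α × sum α ≡ n) × All (_≤ k) α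

regularPartitions : (l n : ℕ) → List (List ℕ)
regularPartitions l n = filter (λ α → isPartition? α ×-dec isRegular? l α ×-dec sum α ℕ.≟ n) (boundedLists n n)

regularPartitions-enumerates : ∀ l n → Enumerates (λ α → IsPartition α × IsRegular l α × sum α ≡ n) (regularPartitions l n)
regularPartitions-enumerates l n = enumerates unique (proj₂ ∘ sound)
  (λ { P@(Pα , _ , ≡.refl) → complete (partition∈boundedLists Pα ℕₚ.≤-refl , P) })
  where
  open Enumerates (enumerates-filter (λ α → isPartition? α ×-dec isRegular? l α ×-dec sum α ℕ.≟ n)
    (enumerates {P = _∈ boundedLists n n} (boundedLists-unique n n) (λ x → x) (λ x → x)))

partsAtMost : (l k n : ℕ) → List (List ℕ)
partsAtMost l k n = filter (All.all? (_≤? k)) (regularPartitions l n)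

partsAtMost-enumerates : ∀ l k n → Enumerates (PartsAtMost l k n) (partsAtMost l k n)
partsAtMost-enumerates l k n = enumerates-filter (All.all? (_≤? k)) (regularPartitions-enumerates l n)

-- No part exceeds the sum, so the bound k is automatic once n ≤ k. This is the convergence of
-- `partSeries` to `regularSeries`.
partsAtMost-sum : ∀ l {k n} → n ≤ k → partsAtMost l k n ↭ regularPartitions l n
partsAtMost-sum l {k} {n} n≤k = enumerates-↭ (partsAtMost-enumerates l k n) (regularPartitions-enumerates l n) proj₁
  (λ { {α} P@(_ , _ , ≡.refl) → P , All.map (λ p≤ → ℕₚ.≤-trans p≤ n≤k) (parts≤sum α) })

weaken : ∀ {l k n α} → PartsAtMost l k n α → PartsAtMost l (suc k) n α
weaken (P , α≤k) = P , All.map ℕₚ.m≤n⇒m≤1+n α≤k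

tail≤head : ∀ {p α} → Linked _≥_ (p ∷ α) → All (_≤ p) α
tail≤head linked with Linked⇒AllPairs (λ x≥y y≥z → ℕₚ.≤-trans y≥z x≥y) linked
... | p≥α ∷ _ = p≥α

-- The largest part stands at the head: either it equals k + 1 and can be removed, or k bounds all
-- parts. The inequality `suc k ℕ.≤ n` guards the truncated subtraction.
headOrStrengthen : ∀ {l k n α} → PartsAtMost l (suc k) n α →
  PartsAtMost l k n α ⊎ ∃ λ β → PartsAtMost l (suc k) (n ℕ.∸ suc k) β × (α ≡ suc k ∷ β × suc k ℕ.≤ n)
headOrStrengthen {α = []} (P , _) = inj₁ (P , [])
headOrStrengthen {k = k} {α = p ∷ β} (P@((0<p ∷ 0<β , linked) , _ ∷ rβ , ≡.refl) , p≤ ∷ β≤) with ℕₚ.m≤n⇒m<n∨m≡n p≤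
... | inj₁ (s≤s p≤k) = inj₁ (P , p≤k ∷ All.map (λ q≤p → ℕₚ.≤-trans q≤p p≤k) (tail≤head linked))
... | inj₂ ≡.refl    = inj₂ (β , (((0<β , Linked.tail linked) , rβ , ≡.sym (ℕₚ.m+n∸m≡n (suc k) (sum β))) , β≤) , ≡.refl , ℕₚ.m≤m+n _ _)

addPart : ∀ {l k n β} → ¬ l ∣ suc k → PartsAtMost l (suc k) n β → PartsAtMost l (suc k) (suc k ℕ.+ n) (suc k ∷ β)
addPart {k = k} l∤ (((0<β , linked) , rβ , ≡.refl) , β≤) = ((s≤s z≤n ∷ 0<β , link linked β≤) , l∤ ∷ rβ , ≡.refl) , ℕₚ.≤-refl ∷ β≤
  where
  link : ∀ {β} → Linked _≥_ β → All (_≤ suc k) β → Linked _≥_ (suc k ∷ β)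
  link []       _         = [-]
  link [-]      (q≤ ∷ _)  = q≤ ∷ [-]
  link (r ∷ rs) (q≤ ∷ _)  = q≤ ∷ (r ∷ rs)

∣⇒strengthen : ∀ {l k n α} → l ∣ suc k → PartsAtMost l (suc k) n α → PartsAtMost l k n α
∣⇒strengthen l∣ P with headOrStrengthen P
... | inj₁ Q                     = Q
∣⇒strengthen l∣ ((_ , l∤ ∷ _ , _) , _) | inj₂ (_ , _ , ≡.refl , _) = contradiction l∣ l∤

partsAtMost-∣ : ∀ {l k} → l ∣ suc k → ∀ n → partsAtMost l (suc k) n ↭ partsAtMost l k n
partsAtMost-∣ {l} {k} l∣ n = enumerates-↭ (partsAtMost-enumerates l (suc k) n) (partsAtMost-enumerates l k n)
  (∣⇒strengthen l∣) weaken

partsAtMost-< : ∀ {l k n} → n < suc k → partsAtMost l (suc k) n ↭ partsAtMost l k n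
partsAtMost-< {l} {k} {n} n<k = enumerates-↭ (partsAtMost-enumerates l (suc k) n) (partsAtMost-enumerates l k n)
  strengthen weaken
  where
  strengthen : ∀ {α} → PartsAtMost l (suc k) n α → PartsAtMost l k n α
  strengthen P with headOrStrengthen P
  ... | inj₁ Q                  = Q
  ... | inj₂ (_ , _ , _ , k<n) = contradiction k<n (ℕₚ.<⇒≱ n<k)

partsAtMost-∤ : ∀ {l k} → ¬ l ∣ suc k → ∀ n → partsAtMost l (suc k) (suc k ℕ.+ n) ↭
                partsAtMost l k (suc k ℕ.+ n) ++ map (suc k ∷_) (partsAtMost l (suc k) n)
partsAtMost-∤ {l} {k} l∤ n = enumerates-↭ (partsAtMost-enumerates l (suc k) (suc k ℕ.+ n))
  (enumerates-++ (λ { (_ , k<k ∷ _) (_ , _ , ≡.refl) → ℕₚ.<-irrefl ≡.refl k<k })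
    (partsAtMost-enumerates l k (suc k ℕ.+ n))
    (enumerates-map (λ { ≡.refl → ≡.refl }) (partsAtMost-enumerates l (suc k) n)))
  to from
  where
  to : ∀ {α} → PartsAtMost l (suc k) (suc k ℕ.+ n) α →
       PartsAtMost l k (suc k ℕ.+ n) α ⊎ ∃ λ β → PartsAtMost l (suc k) n β × α ≡ suc k ∷ β
  to P with headOrStrengthen P
  ... | inj₁ Q                = inj₁ Q
  ... | inj₂ (β , Q , α≡ , _) = inj₂ (β , ≡.subst (λ n → PartsAtMost l (suc k) n β) (ℕₚ.m+n∸m≡n (suc k) n) Q , α≡)
  from : ∀ {α} → PartsAtMost l k (suc k ℕ.+ n) α ⊎ (∃ λ β → PartsAtMost l (suc k) n β × α ≡ suc k ∷ β) →
         PartsAtMost l (suc k) (suc k ℕ.+ n) α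
  from (inj₁ Q)                = weaken Q
  from (inj₂ (β , Q , ≡.refl)) = addPart l∤ Q

bipartitions-↭ : ∀ l m n → regularBipartitions l m n ↭ convolution (regularPartitions l) (regularPartitions m) n
bipartitions-↭ l m n = enumerates-↭
  (enumerates (regularBipartitions-unique l m n)
    (λ {αβ} → Equivalence.to (∈-regularBipartitions l m n αβ))
    (λ {αβ} → Equivalence.from (∈-regularBipartitions l m n αβ)))
  (enumerates-convolution (λ { (_ , _ , ≡.refl) (_ , _ , ≡.refl) → ≡.refl })
    (regularPartitions-enumerates l) (regularPartitions-enumerates m) n)
  (λ (Pα , Pβ , eq , rα , rβ) → _ , _ , eq , (Pα , rα , ≡.refl) , (Pβ , rβ , ≡.refl))
  (λ { (_ , _ , eq , (Pα , rα , ≡.refl) , (Pβ , rβ , ≡.refl)) → Pα , Pβ , eq , rα , rβ })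

module PartitionSeries {c ℓ} (R : CommutativeRing c ℓ) (3≈0 : CharacteristicThree R) where

  open InfiniteProducts R 3≈0
  open Sums R
  open import Algebra.Properties.Monoid.Mult R.+-monoid using () renaming (_×_ to _×R_)
  open import Relation.Binary.Reasoning.Setoid setoid

  one : List ℕ → R.Carrier
  one _ = R.1#

  ∑-1 : ∀ {A : Set} {u : A → R.Carrier} → (∀ x → u x R.≈ R.1#) → ∀ xs → ∑ u xs R.≈ length xs ×R R.1#
  ∑-1 u≈1 []       = R.refl
  ∑-1 u≈1 (x ∷ xs) = R.+-cong (u≈1 x) (∑-1 u≈1 xs)

  partSeries : ℕ → ℕ → Series
  partSeries l k = generating one (partsAtMost l k)

  regularSeries : ℕ → Series
  regularSeries l = generating one (regularPartitions l)

  partSeries-0 : ∀ l → partSeries l 0 ≈ 1#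
  partSeries-0 l .at n = R.trans (∑-↭ one (enumerates-↭ (partsAtMost-enumerates l 0 n) (trivial n) to from)) (value n)
    where
    trivialList : ℕ → List (List ℕ)
    trivialList zero    = [] ∷ []
    trivialList (suc n) = []
    trivial : ∀ n → Enumerates (λ α → α ≡ [] × n ≡ 0) (trivialList n)
    trivial zero    = enumerates ([] ∷ []) (λ { (here eq) → eq , ≡.refl }) (λ { (≡.refl , _) → here ≡.refl })
    trivial (suc n) = enumerates [] (λ ()) (λ ())
    to : ∀ {α} → PartsAtMost l 0 n α → α ≡ [] × n ≡ 0
    to {[]}    ((_ , _ , ≡.refl) , _)              = ≡.refl , ≡.refl
    to {p ∷ α} (((0<p ∷ _ , _) , _) , p≤0 ∷ _) = contradiction p≤0 (ℕₚ.<⇒≱ 0<p)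
    from : ∀ {α} → α ≡ [] × n ≡ 0 → PartsAtMost l 0 n α
    from (≡.refl , ≡.refl) = (([] , []) , [] , ≡.refl) , []
    value : ∀ n → ∑ one (trivialList n) R.≈ 1# n
    value zero    = R.+-identityʳ _
    value (suc n) = R.refl

  partSeries-∣ : ∀ {l k} → l ∣ suc k → partSeries l (suc k) ≈ partSeries l k
  partSeries-∣ l∣ .at n = ∑-↭ one (partsAtMost-∣ l∣ n)

  -- Removing one part k + 1 may leave others of the same size, so the same series recurs on the
  -- right: the geometric series of 1 / (1 - q^(k+1)) in implicit form.
  partSeries-∤ : ∀ {l k} → ¬ l ∣ suc k → partSeries l (suc k) ≈ partSeries l k + X ^ suc k * partSeries l (suc k)
  partSeries-∤ {l} {k} l∤ .at n with n ℕ.<? suc k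
  ... | yes n<k = R.trans (∑-↭ one (partsAtMost-< n<k))
    (R.sym (R.trans (R.+-congˡ (X^*-< (suc k) (partSeries l (suc k)) n<k)) (R.+-identityʳ _)))
  ... | no n≮k = ≡.subst (λ n → partSeries l (suc k) n R.≈ (partSeries l k + X ^ suc k * partSeries l (suc k)) n)
    (ℕₚ.m+[n∸m]≡n (ℕₚ.≮⇒≥ n≮k)) (step (n ℕ.∸ suc k))
    where
    step : ∀ d → partSeries l (suc k) (suc k ℕ.+ d) R.≈ (partSeries l k + X ^ suc k * partSeries l (suc k)) (suc k ℕ.+ d)
    step d = R.trans (∑-↭ one (partsAtMost-∤ l∤ d)) (R.trans (∑-++ one (partsAtMost l k (suc k ℕ.+ d)) _)
      (R.+-congˡ (R.trans (R.reflexive (∑-map one (suc k ∷_) (partsAtMost l (suc k) d)))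
                          (R.sym (X^*-+ (suc k) (partSeries l (suc k)) d)))))

  -- The finite form of ∏ (1 - q^(lj)) / (1 - q^j). An admissible part size cancels its factor of
  -- `pochhammer`; a size divisible by l leaves its factor standing in `multiples`.
  partSeries-pochhammer : ∀ l k → partSeries l k * pochhammer k ≈ multiples l k
  partSeries-pochhammer l zero = trans (*-congʳ (partSeries-0 l)) (*-identityˡ 1#)
  partSeries-pochhammer l (suc k) with l ∣? suc k
  ... | yes l∣ = begin
    partSeries l (suc k) * (pochhammer k * (1# - X ^ suc k)) ≈⟨ *-congʳ (partSeries-∣ l∣) ⟩
    partSeries l k * (pochhammer k * (1# - X ^ suc k))       ≈⟨ *-assoc _ _ _ ⟨
    partSeries l k * pochhammer k * (1# - X ^ suc k)         ≈⟨ *-congʳ (partSeries-pochhammer l k) ⟩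
    multiples l k * (1# - X ^ suc k)                         ∎
  ... | no l∤ = begin
    P′ * (pochhammer k * (1# - x))       ≈⟨ solve 3 (λ p t x → p :* (t :* (con 𝟏 :- x)) := (p :- x :* p) :* t) refl P′ (pochhammer k) x ⟩
    (P′ - x * P′) * pochhammer k         ≈⟨ *-congʳ (+-congʳ (partSeries-∤ l∤)) ⟩
    (P + x * P′ - x * P′) * pochhammer k ≈⟨ solve 3 (λ p y t → (p :+ y :- y) :* t := p :* t) refl P (x * P′) (pochhammer k) ⟩
    P * pochhammer k                     ≈⟨ partSeries-pochhammer l k ⟩
    multiples l k                        ≈⟨ *-identityʳ _ ⟨
    multiples l k * 1#                   ∎
    where
    P  = partSeries l k
    P′ = partSeries l (suc k)
    x  = X ^ suc k

  partSeries⟶regularSeries : ∀ l → partSeries l ⟶ regularSeries l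
  partSeries⟶regularSeries l .agree k n n≤k = ∑-↭ one (partsAtMost-sum l n≤k)

  regularSeries-* : ∀ l → regularSeries (suc l) * euler ≈ dilate l euler
  regularSeries-* l = ⟶-unique (⟶-* (partSeries⟶regularSeries (suc l)) pochhammer⟶euler)
    (multiples⟶dilate-euler l) (partSeries-pochhammer (suc l))

  -- As h has constant term 1, the constant term of the product is `g 0`, which must vanish; then
  -- the tail of g satisfies the same hypothesis.
  zeroProduct : ∀ {h} → h 0 R.≈ R.1# → ∀ g → g * h ≈ 0# → g ≈ 0#
  zeroProduct {h} h₀≈1 g gh≈0 .at n = go n g (gh≈0 .at)
    where
    go : ∀ n g → (∀ n → (g * h) n R.≈ R.0#) → g n R.≈ R.0#
    go n g gh≈0 = coefficient n
      where
      g₀≈0 : g 0 R.≈ R.0#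
      g₀≈0 = R.trans (R.sym (R.*-identityʳ _)) (R.trans (R.*-congˡ (R.sym h₀≈1)) (gh≈0 0))
      coefficient : ∀ n → g n R.≈ R.0#
      coefficient zero    = g₀≈0
      coefficient (suc n) = go n (tail g) (λ n → R.trans (R.sym (R.+-identityˡ _))
        (R.trans (R.+-congʳ (R.sym (R.trans (R.*-congʳ g₀≈0) (R.zeroˡ _)))) (gh≈0 (suc n))))

  cancelʳ : ∀ {h} → h 0 R.≈ R.1# → ∀ f g → f * h ≈ g * h → f ≈ g
  cancelʳ {h} h₀≈1 f g fh≈gh = begin
    f          ≈⟨ solve 2 (λ f g → f := (f :- g) :+ g) refl f g ⟩
    f - g + g  ≈⟨ +-congʳ (zeroProduct h₀≈1 (f - g) (trans
                    (solve 3 (λ f g h → (f :- g) :* h := f :* h :- g :* h) refl f g h)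
                    (trans (+-congʳ fh≈gh) (-‿inverseʳ _)))) ⟩
    0# + g     ≈⟨ +-identityˡ g ⟩
    g          ∎

  -- With R₉ and R₅ the series of regular partitions, R₉ f = f(q⁹) = f⁹ and R₅ f = f₅. Cancelling
  -- one f gives R₉ = f⁸, and one of these eight factors turns R₅ into f₅.
  bipartitionSeries : ∀ n → B 9 5 n ×R R.1# R.≈ (euler ^ 7 * dilate 4 euler) n
  bipartitionSeries n = R.trans (R.sym count) (product .at n)
    where
    count : (regularSeries 9 * regularSeries 5) n R.≈ B 9 5 n ×R R.1#
    count = R.trans (R.sym (generating-* one one (regularPartitions 9) (regularPartitions 5) n))
      (R.trans (∑-↭ _ (↭-sym (bipartitions-↭ 9 5 n))) (∑-1 (λ _ → R.*-identityˡ _) (regularBipartitions 9 5 n)))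
    regular₉ : regularSeries 9 ≈ euler ^ 8
    regular₉ = cancelʳ R.refl _ _ (begin
      regularSeries 9 * euler  ≈⟨ regularSeries-* 8 ⟩
      dilate 8 euler           ≈⟨ euler^9 ⟨
      euler ^ 9                ≈⟨ *-comm _ _ ⟩
      euler ^ 8 * euler        ∎)
    product : regularSeries 9 * regularSeries 5 ≈ euler ^ 7 * dilate 4 euler
    product = begin
      regularSeries 9 * regularSeries 5       ≈⟨ *-congʳ regular₉ ⟩
      euler ^ 8 * regularSeries 5             ≈⟨ solve 3 (λ f g p → (f :* g) :* p := g :* (p :* f)) refl euler (euler ^ 7) (regularSeries 5) ⟩
      euler ^ 7 * (regularSeries 5 * euler)   ≈⟨ *-congˡ (regularSeries-* 4) ⟩
      euler ^ 7 * dilate 4 euler              ∎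

-- In terms of 2n + 1 this is multiplication by 5, its fixed point being -1/2; hence the halves in
-- the indices of the theorem.
next : ℕ → ℕ
next n = 2 ℕ.+ n ℕ.* 5

-- From identities of series to counts.

module CoefficientCongruences {c ℓ} (R : CommutativeRing c ℓ) (3≈0 : CharacteristicThree R)
             (ζ : CommutativeRing.Carrier R) (Φ₅ζ≈0 : FifthRoot.IsPrimitiveFifthRoot R ζ) where

  open Recurrence R 3≈0 ζ Φ₅ζ≈0
  open PartitionSeries R 3≈0 using (bipartitionSeries)
  open import Algebra.Properties.Monoid.Mult R.+-monoid using (×-homo-+) renaming (_×_ to _×R_)
  open import Relation.Binary.Reasoning.Setoid R.setoid

  bipartitionCount≈F : ∀ n → B 9 5 n ×R R.1# R.≈ F n
  bipartitionCount≈F n = R.trans (bipartitionSeries n) (R.sym (F-def .at n))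

  module _ (b : ℕ → ℕ) (b≈F : ∀ n → b n ×R R.1# R.≈ F n) where

    b-next⁴ : ∀ n → b (next (next (next (next n)))) ×R R.1# R.≈ (2 ℕ.* b n) ×R R.1#
    b-next⁴ n = begin
      b (next (next (next (next n)))) ×R R.1#   ≈⟨ b≈F (next (next (next (next n)))) ⟩
      F (next (next (next (next n))))           ≈⟨ U⁴F .at n ⟩
      F n R.+ F n                               ≈⟨ R.+-cong (b≈F n) (b≈F n) ⟨
      b n ×R R.1# R.+ b n ×R R.1#               ≈⟨ ×-homo-+ R.1# (b n) (b n) ⟨
      (b n ℕ.+ b n) ×R R.1#                     ≡⟨ ≡.cong (λ c → (b n ℕ.+ c) ×R R.1#) (ℕₚ.+-identityʳ (b n)) ⟨
      (2 ℕ.* b n) ×R R.1#                       ∎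

    b-next³ : ∀ r → sec r G ≈ 0# → ∀ n → b (next (next (next (r ℕ.+ n ℕ.* 5)))) ×R R.1# R.≈ 0 ×R R.1#
    b-next³ r secG≈0 n = begin
      b (next (next (next k))) ×R R.1#  ≈⟨ b≈F (next (next (next k))) ⟩
      F (next (next (next k)))          ≈⟨ U³F .at k ⟩
      G k                               ≈⟨ secG≈0 .at n ⟩
      R.0#                              ∎
      where k = r ℕ.+ n ℕ.* 5

-- The field with 81 elements.

open import Data.Nat using (_+_; _*_; _∸_; _^_; _/_; _%_)

-- The carrier is ℕ under congruence, so that n-fold multiples of 1 in the extensions have the
-- number n itself as constant coordinate; `𝔽₈₁-injective` reads congruences modulo 3 off from it.
-- Negation is doubling.
ℤ/3 : CommutativeRing 0ℓ 0ℓ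
ℤ/3 = record
  { Carrier = ℕ ; _≈_ = λ a b → a % 3 ≡ b % 3 ; _+_ = _+_ ; _*_ = _*_ ; -_ = 2 *_ ; 0# = 0 ; 1# = 1
  ; isCommutativeRing = record
    { isRing = record
      { +-isAbelianGroup = record
        { isGroup = record
          { isMonoid = record
            { isSemigroup = record
              { isMagma = record
                { isEquivalence = record { refl = ≡.refl ; sym = ≡.sym ; trans = ≡.trans }
                ; ∙-cong = λ {a} {b} {c} {d} → +-cong a b c d
                }
              ; assoc = λ a b c → ≡.cong (_% 3) (ℕₚ.+-assoc a b c)
              }
            ; identity = (λ a → ≡.refl) , (λ a → ≡.cong (_% 3) (ℕₚ.+-identityʳ a))
            }
          ; inverse = (λ a → ≡.trans (≡.cong (_% 3) (ℕₚ.+-comm (2 * a) a)) (inverse a)) , inverse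
          ; ⁻¹-cong = λ {a} {b} → *-cong 2 2 a b ≡.refl
          }
        ; comm = λ a b → ≡.cong (_% 3) (ℕₚ.+-comm a b)
        }
      ; *-cong = λ {a} {b} {c} {d} → *-cong a b c d
      ; *-assoc = λ a b c → ≡.cong (_% 3) (ℕₚ.*-assoc a b c)
      ; *-identity = (λ a → ≡.cong (_% 3) (ℕₚ.*-identityˡ a)) , (λ a → ≡.cong (_% 3) (ℕₚ.*-identityʳ a))
      ; distrib = (λ a b c → ≡.cong (_% 3) (ℕₚ.*-distribˡ-+ a b c)) , (λ a b c → ≡.cong (_% 3) (ℕₚ.*-distribʳ-+ a b c))
      }
    ; *-comm = λ a b → ≡.cong (_% 3) (ℕₚ.*-comm a b)
    }
  }
  where
  +-cong : ∀ a b c d → a % 3 ≡ b % 3 → c % 3 ≡ d % 3 → (a + c) % 3 ≡ (b + d) % 3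
  +-cong a b c d a≡b c≡d = ≡.trans (%-distribˡ-+ a c 3)
    (≡.trans (≡.cong₂ (λ x y → (x + y) % 3) a≡b c≡d) (≡.sym (%-distribˡ-+ b d 3)))
  *-cong : ∀ a b c d → a % 3 ≡ b % 3 → c % 3 ≡ d % 3 → (a * c) % 3 ≡ (b * d) % 3
  *-cong a b c d a≡b c≡d = ≡.trans (%-distribˡ-* a c 3)
    (≡.trans (≡.cong₂ (λ x y → (x * y) % 3) a≡b c≡d) (≡.sym (%-distribˡ-* b d 3)))
  inverse : ∀ a → (a + 2 * a) % 3 ≡ 0
  inverse a = ≡.trans (≡.cong (_% 3) (ℕₚ.*-comm 3 a)) (m*n%n≡0 a 3)

-- R[x]/(x² - u x - v), the pair (a , b) standing for a + b x.
module QuadraticExtension {c ℓ} (R : CommutativeRing c ℓ) (3≈0 : CharacteristicThree R)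
                          (u v : CommutativeRing.Carrier R) where

  private module R = CommutativeRing R
  open CharacteristicThreeSolver R 3≈0

  commutativeRing : CommutativeRing c ℓ
  commutativeRing = record
    { Carrier = R.Carrier × R.Carrier
    ; _≈_ = λ (a , b) (a′ , b′) → (a R.≈ a′) × (b R.≈ b′)
    ; _+_ = λ (a , b) (a′ , b′) → a R.+ a′ , b R.+ b′
    ; _*_ = λ (a , b) (a′ , b′) → a R.* a′ R.+ v R.* (b R.* b′) , a R.* b′ R.+ b R.* a′ R.+ u R.* (b R.* b′)
    ; -_ = λ (a , b) → R.- a , R.- b
    ; 0# = R.0# , R.0#
    ; 1# = R.1# , R.0#
    ; isCommutativeRing = record
      { isRing = record
        { +-isAbelianGroup = record
          { isGroup = record
            { isMonoid = record
              { isSemigroup = record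
                { isMagma = record
                  { isEquivalence = record
                    { refl = R.refl , R.refl
                    ; sym = λ (p , q) → R.sym p , R.sym q
                    ; trans = λ (p , q) (p′ , q′) → R.trans p p′ , R.trans q q′
                    }
                  ; ∙-cong = λ (p , q) (p′ , q′) → R.+-cong p p′ , R.+-cong q q′
                  }
                ; assoc = λ _ _ _ → R.+-assoc _ _ _ , R.+-assoc _ _ _
                }
              ; identity = (λ _ → R.+-identityˡ _ , R.+-identityˡ _) , (λ _ → R.+-identityʳ _ , R.+-identityʳ _)
              }
            ; inverse = (λ _ → R.-‿inverseˡ _ , R.-‿inverseˡ _) , (λ _ → R.-‿inverseʳ _ , R.-‿inverseʳ _)
            ; ⁻¹-cong = λ (p , q) → R.-‿cong p , R.-‿cong q
            }
          ; comm = λ _ _ → R.+-comm _ _ , R.+-comm _ _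
          }
        ; *-cong = λ (p , q) (p′ , q′) →
            R.+-cong (R.*-cong p p′) (R.*-congˡ (R.*-cong q q′)) ,
            R.+-cong (R.+-cong (R.*-cong p q′) (R.*-cong q p′)) (R.*-congˡ (R.*-cong q q′))
        ; *-assoc = λ (a , b) (a′ , b′) (a″ , b″) →
            solve 8 (λ u v a b a′ b′ a″ b″ → let c = a :* a′ :+ v :* (b :* b′)
                                                 d = a :* b′ :+ b :* a′ :+ u :* (b :* b′)
                                                 c′ = a′ :* a″ :+ v :* (b′ :* b″)
                                                 d′ = a′ :* b″ :+ b′ :* a″ :+ u :* (b′ :* b″)
              in c :* a″ :+ v :* (d :* b″) := a :* c′ :+ v :* (b :* d′)) R.refl u v a b a′ b′ a″ b″ ,
            solve 8 (λ u v a b a′ b′ a″ b″ → let c = a :* a′ :+ v :* (b :* b′)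
                                                 d = a :* b′ :+ b :* a′ :+ u :* (b :* b′)
                                                 c′ = a′ :* a″ :+ v :* (b′ :* b″)
                                                 d′ = a′ :* b″ :+ b′ :* a″ :+ u :* (b′ :* b″)
              in c :* b″ :+ d :* a″ :+ u :* (d :* b″) := a :* d′ :+ b :* c′ :+ u :* (b :* d′)) R.refl u v a b a′ b′ a″ b″
        ; *-identity =
            (λ (a , b) → solve 3 (λ v a b → con 𝟏 :* a :+ v :* (con 𝟎 :* b) := a) R.refl v a b ,
                         solve 3 (λ u a b → con 𝟏 :* b :+ con 𝟎 :* a :+ u :* (con 𝟎 :* b) := b) R.refl u a b) ,
            (λ (a , b) → solve 3 (λ v a b → a :* con 𝟏 :+ v :* (b :* con 𝟎) := a) R.refl v a b ,
                         solve 3 (λ u a b → a :* con 𝟎 :+ b :* con 𝟏 :+ u :* (b :* con 𝟎) := b) R.refl u a b)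
        ; distrib =
            (λ (a , b) (a′ , b′) (a″ , b″) →
              solve 7 (λ v a b a′ b′ a″ b″ → a :* (a′ :+ a″) :+ v :* (b :* (b′ :+ b″)) :=
                (a :* a′ :+ v :* (b :* b′)) :+ (a :* a″ :+ v :* (b :* b″))) R.refl v a b a′ b′ a″ b″ ,
              solve 7 (λ u a b a′ b′ a″ b″ → a :* (b′ :+ b″) :+ b :* (a′ :+ a″) :+ u :* (b :* (b′ :+ b″)) :=
                (a :* b′ :+ b :* a′ :+ u :* (b :* b′)) :+ (a :* b″ :+ b :* a″ :+ u :* (b :* b″))) R.refl u a b a′ b′ a″ b″) ,
            (λ (a , b) (a′ , b′) (a″ , b″) →
              solve 7 (λ v a b a′ b′ a″ b″ → (a′ :+ a″) :* a :+ v :* ((b′ :+ b″) :* b) :=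
                (a′ :* a :+ v :* (b′ :* b)) :+ (a″ :* a :+ v :* (b″ :* b))) R.refl v a b a′ b′ a″ b″ ,
              solve 7 (λ u a b a′ b′ a″ b″ → (a′ :+ a″) :* b :+ (b′ :+ b″) :* a :+ u :* ((b′ :+ b″) :* b) :=
                (a′ :* b :+ b′ :* a :+ u :* (b′ :* b)) :+ (a″ :* b :+ b″ :* a :+ u :* (b″ :* b))) R.refl u a b a′ b′ a″ b″)
        }
      ; *-comm = λ (a , b) (a′ , b′) →
          solve 5 (λ v a b a′ b′ → a :* a′ :+ v :* (b :* b′) := a′ :* a :+ v :* (b′ :* b)) R.refl v a b a′ b′ ,
          solve 5 (λ u a b a′ b′ → a :* b′ :+ b :* a′ :+ u :* (b :* b′) := a′ :* b :+ b′ :* a :+ u :* (b′ :* b)) R.refl u a b a′ b′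
      }
    }

  characteristicThree : CharacteristicThree commutativeRing
  characteristicThree = 3≈0 , R.trans (R.+-identityʳ _) (R.+-identityʳ _)

-- 𝔽₈₁ = 𝔽₃(τ)(ζ) with τ² = -τ + 1 and ζ² = τ ζ - 1, so that ζ is a fifth root of unity and τ = ζ + ζ⁻¹.
module 𝔽₃⟨τ⟩ = QuadraticExtension ℤ/3 ≡.refl 2 1
module 𝔽₃⟨τ,ζ⟩ = QuadraticExtension 𝔽₃⟨τ⟩.commutativeRing 𝔽₃⟨τ⟩.characteristicThree (0 , 1) (2 , 0)

𝔽₈₁ : CommutativeRing 0ℓ 0ℓ
𝔽₈₁ = 𝔽₃⟨τ,ζ⟩.commutativeRing

𝔽₈₁-3≈0 : CharacteristicThree 𝔽₈₁
𝔽₈₁-3≈0 = 𝔽₃⟨τ,ζ⟩.characteristicThree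

ζ₅ : CommutativeRing.Carrier 𝔽₈₁
ζ₅ = (0 , 0) , (1 , 0)

Φ₅ζ₅≈0 : FifthRoot.IsPrimitiveFifthRoot 𝔽₈₁ ζ₅
Φ₅ζ₅≈0 = (≡.refl , ≡.refl) , (≡.refl , ≡.refl)

open import Algebra.Properties.Monoid.Mult (CommutativeRing.+-monoid 𝔽₈₁) public using () renaming (_×_ to _×₈₁_)

𝔽₈₁-injective : ∀ m n → CommutativeRing._≈_ 𝔽₈₁ (m ×₈₁ CommutativeRing.1# 𝔽₈₁) (n ×₈₁ CommutativeRing.1# 𝔽₈₁) → m % 3 ≡ n % 3
𝔽₈₁-injective m n ((m≈n , _) , _) = ≡.trans (≡.cong (_% 3) (≡.sym (constant m))) (≡.trans m≈n (≡.cong (_% 3) (constant n)))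
  where
  constant : ∀ n → proj₁ (proj₁ (n ×₈₁ CommutativeRing.1# 𝔽₈₁)) ≡ n
  constant zero    = ≡.refl
  constant (suc n) = ≡.cong suc (constant n)

-- Indices and iteration.

open CommutativeRing 𝔽₈₁ using (_≈_; 1#)
open Recurrence 𝔽₈₁ 𝔽₈₁-3≈0 ζ₅ Φ₅ζ₅≈0 using (F; sec₀-G; sec₄-G)
open CoefficientCongruences 𝔽₈₁ 𝔽₈₁-3≈0 ζ₅ Φ₅ζ₅≈0 using (bipartitionCount≈F; b-next⁴; b-next³)

-- (5^(4m) - 1)/2
half : ℕ → ℕ
half zero    = 0
half (suc m) = 312 + 625 * half m

5^4m : ∀ m → 5 ^ (4 * m) ≡ 1 + half m * 2
5^4m zero    = ≡.refl
5^4m (suc m) = begin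
  5 ^ (4 * suc m)                  ≡⟨ ≡.cong (5 ^_) (ℕₚ.*-suc 4 m) ⟩
  5 ^ (4 + 4 * m)                  ≡⟨ ℕₚ.^-distribˡ-+-* 5 4 (4 * m) ⟩
  625 * 5 ^ (4 * m)                ≡⟨ ≡.cong (625 *_) (5^4m m) ⟩
  625 * (1 + half m * 2)           ≡⟨ identity (half m) ⟩
  1 + (312 + 625 * half m) * 2     ∎
  where
  open ≡.≡-Reasoning
  identity : ∀ h → 625 * (1 + h * 2) ≡ 1 + (312 + 625 * h) * 2
  identity = ℕSolver.solve-∀

index₁ : ∀ m n → 5 ^ (4 * m) * n + (5 ^ (4 * m) ∸ 1) / 2 ≡ (1 + half m * 2) * n + half m
index₁ m n = begin
  5 ^ (4 * m) * n + (5 ^ (4 * m) ∸ 1) / 2          ≡⟨ ≡.cong (λ e → e * n + (e ∸ 1) / 2) (5^4m m) ⟩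
  (1 + half m * 2) * n + (half m * 2) / 2          ≡⟨ ≡.cong (λ x → (1 + half m * 2) * n + x) (m*n/n≡m (half m) 2) ⟩
  (1 + half m * 2) * n + half m                    ∎
  where open ≡.≡-Reasoning

-- Twice the index plus one is 5^(4m+3) (10n + 2k + 1) = 5^(4m) 5³ (2 (k + 5n) + 1): three
-- applications of `next` to k + 5n, followed by m blocks of four.
index₂ : ∀ m n k → 5 ^ (4 * m + 4) * n + ((2 * k + 1) * 5 ^ (4 * m + 3) ∸ 1) / 2
                   ≡ (1 + half m * 2) * next (next (next (k + n * 5))) + half m
index₂ m n k = begin
  5 ^ (4 * m + 4) * n + ((2 * k + 1) * 5 ^ (4 * m + 3) ∸ 1) / 2
    ≡⟨ ≡.cong₂ (λ x y → x * n + ((2 * k + 1) * y ∸ 1) / 2) (power 4) (power 3) ⟩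
  (1 + h * 2) * 625 * n + ((2 * k + 1) * ((1 + h * 2) * 125) ∸ 1) / 2
    ≡⟨ ≡.cong (λ x → (1 + h * 2) * 625 * n + (x ∸ 1) / 2) (identity₁ h k) ⟩
  (1 + h * 2) * 625 * n + (62 + 125 * h + 125 * k * (1 + h * 2)) * 2 / 2
    ≡⟨ ≡.cong (λ x → (1 + h * 2) * 625 * n + x) (m*n/n≡m (62 + 125 * h + 125 * k * (1 + h * 2)) 2) ⟩
  (1 + h * 2) * 625 * n + (62 + 125 * h + 125 * k * (1 + h * 2))
    ≡⟨ identity₂ h k n ⟩
  (1 + h * 2) * next (next (next (k + n * 5))) + h ∎
  where
  open ≡.≡-Reasoning
  h = half m
  power : ∀ i → 5 ^ (4 * m + i) ≡ (1 + h * 2) * 5 ^ i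
  power i = ≡.trans (ℕₚ.^-distribˡ-+-* 5 (4 * m) i) (≡.cong (_* 5 ^ i) (5^4m m))
  identity₁ : ∀ h k → (2 * k + 1) * ((1 + h * 2) * 125) ≡ 1 + (62 + 125 * h + 125 * k * (1 + h * 2)) * 2
  identity₁ = ℕSolver.solve-∀
  identity₂ : ∀ h k n → (1 + h * 2) * 625 * n + (62 + 125 * h + 125 * k * (1 + h * 2))
    ≡ (1 + h * 2) * (2 + (2 + (2 + (k + n * 5) * 5) * 5) * 5) + h
  identity₂ = ℕSolver.solve-∀

module Iteration (b : ℕ → ℕ) (b-next⁴ : ∀ n → b (next (next (next (next n)))) % 3 ≡ (2 * b n) % 3) where

  -- Raising m by one applies `next` four more times to the index, and each such block yields a
  -- factor 2.
  iterate : ∀ m n → b ((1 + half m * 2) * n + half m) % 3 ≡ (2 ^ m * b n) % 3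
  iterate zero n = ≡.cong (_% 3) (≡.trans (≡.cong b (identity n)) (≡.sym (ℕₚ.*-identityˡ _)))
    where
    identity : ∀ n → (1 + 0) * n + 0 ≡ n
    identity = ℕSolver.solve-∀
  iterate (suc m) n = begin
    b ((1 + half (suc m) * 2) * n + half (suc m)) % 3   ≡⟨ ≡.cong (λ k → b k % 3) (identity (half m) n) ⟩
    b (next (next (next (next k)))) % 3                 ≡⟨ b-next⁴ k ⟩
    (2 * b k) % 3                                       ≡⟨ %-distribˡ-* 2 (b k) 3 ⟩
    (2 * (b k % 3)) % 3                                 ≡⟨ ≡.cong (λ c → (2 * c) % 3) (iterate m n) ⟩
    (2 * ((2 ^ m * b n) % 3)) % 3                       ≡⟨ %-distribˡ-* 2 (2 ^ m * b n) 3 ⟨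
    (2 * (2 ^ m * b n)) % 3                             ≡⟨ ≡.cong (_% 3) (ℕₚ.*-assoc 2 (2 ^ m) (b n)) ⟨
    (2 ^ suc m * b n) % 3                               ∎
    where
    open ≡.≡-Reasoning
    k = (1 + half m * 2) * n + half m
    identity : ∀ h n → (1 + (312 + 625 * h) * 2) * n + (312 + 625 * h)
      ≡ 2 + (2 + (2 + (2 + ((1 + h * 2) * n + h) * 5) * 5) * 5) * 5
    identity = ℕSolver.solve-∀

  congruence : ∀ n m → b (5 ^ (4 * m) * n + (5 ^ (4 * m) ∸ 1) / 2) % 3 ≡ (2 ^ m * b n) % 3
  congruence n m = ≡.trans (≡.cong (λ i → b i % 3) (index₁ m n)) (iterate m n)

  vanishing : ∀ n m k → b (next (next (next (k + n * 5)))) % 3 ≡ 0 →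
    b (5 ^ (4 * m + 4) * n + ((2 * k + 1) * 5 ^ (4 * m + 3) ∸ 1) / 2) % 3 ≡ 0
  vanishing n m k bi≡0 = begin
    b (5 ^ (4 * m + 4) * n + ((2 * k + 1) * 5 ^ (4 * m + 3) ∸ 1) / 2) % 3
      ≡⟨ ≡.cong (λ i → b i % 3) (index₂ m n k) ⟩
    b ((1 + half m * 2) * i + half m) % 3   ≡⟨ iterate m i ⟩
    (2 ^ m * b i) % 3                       ≡⟨ %-distribˡ-* (2 ^ m) (b i) 3 ⟩
    ((2 ^ m % 3) * (b i % 3)) % 3           ≡⟨ ≡.cong (λ c → ((2 ^ m % 3) * c) % 3) bi≡0 ⟩
    ((2 ^ m % 3) * 0) % 3                   ≡⟨ ≡.cong (_% 3) (ℕₚ.*-zeroʳ (2 ^ m % 3)) ⟩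
    0                                       ∎
    where
    open ≡.≡-Reasoning
    i = next (next (next (k + n * 5)))

congruences : (b : ℕ → ℕ) → (∀ n → b n ×₈₁ 1# ≈ F n) → (n m : ℕ) →
    (b (5 ^ (4 * m) * n + (5 ^ (4 * m) ∸ 1) / 2) % 3 ≡ (2 ^ m * b n) % 3)
    × ((k : ℕ) → (k ≡ 4 ⊎ k ≡ 5) →
    b (5 ^ (4 * m + 4) * n + ((2 * k + 1) * 5 ^ (4 * m + 3) ∸ 1) / 2) % 3 ≡ 0)
congruences b b≈F n m = congruence n m , vanishes
  where
  open Iteration b (λ n → 𝔽₈₁-injective (b (next (next (next (next n))))) (2 * b n) (b-next⁴ b b≈F n))
  vanishes : ∀ k → k ≡ 4 ⊎ k ≡ 5 →
    b (5 ^ (4 * m + 4) * n + ((2 * k + 1) * 5 ^ (4 * m + 3) ∸ 1) / 2) % 3 ≡ 0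
  vanishes k (inj₁ ≡.refl) = vanishing n m k
    (𝔽₈₁-injective (b (next (next (next (4 + n * 5))))) 0 (b-next³ b b≈F 4 sec₄-G n))
  -- For k = 5 the inner index 5 + 5n is 5 (n + 1), so section 0 of `G` is used at n + 1.
  vanishes k (inj₂ ≡.refl) = vanishing n m k
    (𝔽₈₁-injective (b (next (next (next (suc n * 5))))) 0 (b-next³ b b≈F 0 sec₀-G (suc n)))

theorem1p2 : (n m : ℕ) →
    (B 9 5 (5 ^ (4 * m) * n + (5 ^ (4 * m) ∸ 1) / 2) % 3 ≡ (2 ^ m * B 9 5 n) % 3)
    × ((k : ℕ) → (k ≡ 4 ⊎ k ≡ 5) →
    B 9 5 (5 ^ (4 * m + 4) * n + ((2 * k + 1) * 5 ^ (4 * m + 3) ∸ 1) / 2) % 3 ≡ 0)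
theorem1p2 = congruences (B 9 5) bipartitionCount≈F
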